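{- Let $\mathcal{D}$ be a nontrivial balanced quadriculated disk. For $N\in\mathbb{N}$ let $\mathbf{T}_1$ and $\mathbf{T}_2$ be two independent (uniformly) random domino tilings of $\mathcal{D}\times[0,N]$. If $\mathcal{D}$ is strongly irregular, then there exists $c\in(0,1)$ such that $\mathbb{P}(\mathbf{T}_1\approx\mathbf{T}_2)=o(c^N)$ as $N\to\infty$.
   Context: A quadriculated disk $\mathcal{D}\subset\mathbb{R}^2$ is a finite union of closed unit squares with vertices in $\mathbb{Z}^2$ that is homeomorphic to a closed disk. The unit square $[a,a+1]\times[b,b+1]$, $(a,b)\in\mathbb{Z}^2$, is white if $a+b$ is even and black if $a+b$ is odd. Two unit squares are adjacent if they share an edge. $\mathcal{D}$ is balanced if it contains equally many white and black unit squares; it is trivial if each of its unit squares is adjacent to at most two other unit squares of $\mathcal{D}$, and nontrivial otherwise. A (3D) domino is a union of two unit cubes (with vertices in $\mathbb{Z}^3$) sharing a face; a tiling of a cubiculated region is a covering of it by dominoes contained in it with pairwise disjoint interiors. A flip removes two parallel dominoes of a tiling whose union is a $2\times2\times1$ slab (in any orientation) and puts them back in the other possible position. For tilings $\mathbf{t}_1,\mathbf{t}_2$ of $\mathcal{D}\times[0,N]$, $\mathbf{t}_1\approx\mathbf{t}_2$ means they can be joined by a finite sequence of flips. Domino group. A plug is a union $p\subseteq\mathcal{D}$ of unit squares of $\mathcal{D}$ with equally many white and black squares; $\mathbf{p}_\circ=\emptyset$ is the empty plug. Two plugs are disjoint if their interiors are disjoint. A planar domino is a union of two adjacent unit squares.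 The 2-complex $\mathcal{C}_{\mathcal{D}}$ is defined as follows. - Vertices: the plugs. - Edges: for every two distinct disjoint plugs $p_1,p_2$, one edge between $p_1$ and $p_2$ for each planar domino tiling of $\mathcal{D}\smallsetminus\mathrm{int}(p_1\cup p_2)$ (the empty region has exactly one tiling, the empty one); also one loop at $\mathbf{p}_\circ$ for each planar domino tiling of $\mathcal{D}$. - 2-cells: (i) for each loop $f$, a disk attached along $f*f$ (so that a projective plane results); (ii) for each two edges joining the same two distinct plugs whose tilings differ by a single planar flip (replacing two parallel dominoes forming a $2\times2$ square by the other two), a disk attached along the resulting bigon; (iii) for each four plugs $p_1,p_2,p_3,p_4$ with $p_2$ disjoint from $p_1$ and from $p_4$, and $p_2=p_3\cup d$ where $d$ is a domino whose two unit squares are not in $p_3$, and for each tiling $f_1^*$ of $\mathcal{D}\smallsetminus\mathrm{int}(p_1\cup p_2)$ and each tiling $f_2^*$ of $\mathcal{D}\smallsetminus\mathrm{int}(p_2\cup p_4)$, a disk attached along the quadrilateral $p_1\to p_2\to p_4\to p_3\to p_1$ with edges $f_1^*$, $f_2^*$, $f_2^*\cup\{d\}$, $f_1^*\cup\{d\}$. The domino group is $G_{\mathcal{D}}=\pi_1(\mathcal{C}_{\mathcal{D}},\mathbf{p}_\circ)$. The even domino group $G_{\mathcal{D}}^+$ is the kernel of the homomorphism $G_{\mathcal{D}}\to\mathbb{Z}/(2)$ sending a closed edge path of length $N$ to $N \bmod 2$. The disk $\mathcal{D}$ is strongly irregular if there exists a surjective homomorphism from $G_{\mathcal{D}}^+$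 onto the free group $F_2$ of rank two. -}

module Defs where

open import Level using (0ℓ)
open import Algebra.Bundles using (Group)
open import Algebra.Morphism.Structures using (module GroupMorphisms)
import Data.Bool.Properties as Bool
open import Data.Empty using (⊥; ⊥-elim-irr)
open import Data.Fin using (Fin; toℕ)
import Data.Fin.Properties as Fin
open import Data.Fin.Subset
  using (Subset; Side; inside; outside; _∈_; _∉_; _∩_; _∪_; ∁; ⁅_⁆; Empty; ∣_∣)
  renaming (⊤ to full; ⊥ to empty)
open import Data.Fin.Subset.Properties using (_∈?_; ∪-comm; ∩-comm; ∩-zeroˡ)
open import Data.Integer as ℤ using (ℤ; +_)
import Data.Integer.Properties as ℤ
open import Data.List as List using (List; []; _∷_; length; filter; mapMaybe; cartesianProduct)
open import Data.List.Membership.Propositional using () renaming (_∈_ to _∈ˡ_)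
open import Data.List.Membership.Propositional.Properties
  using (∈-cartesianProductWith⁺)
open import Data.List.Relation.Unary.Any using (here; there)
open import Data.Maybe using (Maybe; just; nothing)
open import Data.Nat as ℕ using (ℕ; zero; suc; NonZero; parity)
open import Data.Nat.Divisibility using (_∣?_)
import Data.Nat.Properties as ℕ
open import Data.Parity as ℙ using (Parity; 0ℙ)
import Data.Parity.Properties as ℙ
open import Data.Product using (Σ-syntax; ∃-syntax; _×_; _,_; proj₁; proj₂; uncurry)
import Data.Product.Properties as Product
open import Data.Rational as ℚ using (ℚ; 0ℚ; 1ℚ)
open import Data.Sign as Sign using (Sign; opposite)
import Data.Sign.Properties as Sign
open import Data.Sum using (_⊎_; inj₁; inj₂)
open import Data.Unit using (⊤; tt)
open import Data.Vec as Vec using (Vec; []; _∷_; lookup; _[_]%=_; _[_]≔_; _∷ʳ_)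
import Data.Vec.Properties as Vec
open import Data.Vec.Relation.Unary.Unique.Propositional using (Unique)
open import Function using (_∘_; Surjective)
open import Relation.Binary.Construct.Closure.ReflexiveTransitive using (Star; ε; _◅_; _◅◅_)
import Relation.Binary.Construct.Closure.ReflexiveTransitive.Properties as Star
open import Relation.Binary.PropositionalEquality
  using (_≡_; _≢_; refl; sym; trans; cong; cong₂; subst)
open import Relation.Nullary using (¬_; Dec; yes; no; does; ¬?)
open import Relation.Nullary.Decidable using (map′; _×-dec_; _⊎-dec_; _→-dec_)
open import Relation.Unary using (Pred)

private variable d n : ℕ

Point : Set
Point = ℚ × ℚ

dist : Point → Point → ℚ
dist (x , y) (x′ , y′) = ℚ.∣ x ℚ.- x′ ∣ ℚ.⊔ ℚ.∣ y ℚ.- y′ ∣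

-- The points (with real coordinates) of the closure in ℝ² of a set P of
-- rational points, as regular Cauchy sequences in P.
record RealPoint (P : Pred Point 0ℓ) : Set where
  field
    approx  : ℕ → Point
    within  : ∀ m → P (approx m)
    regular : ∀ m k → dist (approx m) (approx k) ℚ.≤ (+ 1 ℚ./ suc m) ℚ.+ (+ 1 ℚ./ suc k)

open RealPoint public

-- The real distance between u and v is at most r.
DistAtMost : {P : Pred Point 0ℓ} → ℚ → RealPoint P → RealPoint P → Set
DistAtMost r u v = ∀ m → dist (approx u m) (approx v m) ℚ.≤ r ℚ.+ (+ 2 ℚ./ suc m)

-- All the sets considered are compact, so that continuity is uniform.
Continuous : {P Q : Pred Point 0ℓ} → (RealPoint P → RealPoint Q) → Set
Continuous f = ∀ r → 0ℚ ℚ.< r → ∃[ s ] (0ℚ ℚ.< s ×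
  (∀ u v → DistAtMost s u v → DistAtMost r (f u) (f v)))

record Homeomorphic (P Q : Pred Point 0ℓ) : Set where
  field
    to        : RealPoint P → RealPoint Q
    from      : RealPoint Q → RealPoint P
    to-cont   : Continuous to
    from-cont : Continuous from
    from∘to   : ∀ u → DistAtMost 0ℚ (from (to u)) u
    to∘from   : ∀ v → DistAtMost 0ℚ (to (from v)) v

ClosedDisk : Pred Point 0ℓ
ClosedDisk (x , y) = x ℚ.* x ℚ.+ y ℚ.* y ℚ.≤ 1ℚ

-- The vector c stands for the unit cube ∏ [cᵢ , cᵢ + 1].
Cube : ℕ → Set
Cube d = Vec ℤ d

Region : ℕ → ℕ → Set
Region d n = Vec (Cube d) n

shift : Fin d → Cube d → Cube d
shift k c = c [ k ]%= ℤ.suc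

IsShift : Region d n → Fin d → Fin n → Fin n → Set
IsShift R k i j = lookup R j ≡ shift k (lookup R i)

isShift? : (R : Region d n) (k : Fin d) (i j : Fin n) → Dec (IsShift R k i j)
isShift? R k i j = Vec.≡-dec ℤ._≟_ _ _

-- (i , k) is the domino consisting of the cube with index i and its
-- translate by one unit in direction k; each domino arises exactly once.
Domino : ℕ → ℕ → Set
Domino d n = Fin n × Fin d

Covers : Region d n → Domino d n → Fin n → Set
Covers R (i , k) j = j ≡ i ⊎ IsShift R k i j

DominoSet : ℕ → ℕ → Set
DominoSet d n = Vec (Subset d) n

infix 4 _∈ᵈ_
_∈ᵈ_ : Domino d n → DominoSet d n → Set
(i , k) ∈ᵈ t = k ∈ lookup t i

insert delete : Domino d n → DominoSet d n → DominoSet d n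
insert (i , k) t = t [ i ]%= (_[ k ]≔ inside)
delete (i , k) t = t [ i ]%= (_[ k ]≔ outside)

-- The subset S of the indices of R selects a subregion of R.

Contained : Region d n → Subset n → DominoSet d n → Set
Contained R S t = ∀ i k → (i , k) ∈ᵈ t → i ∈ S × ∃[ j ] (j ∈ S × IsShift R k i j)

Covering : Region d n → Subset n → DominoSet d n → Set
Covering R S t = ∀ j → j ∈ S → ∃[ i ] ∃[ k ] ((i , k) ∈ᵈ t × Covers R (i , k) j)

PairwiseDisjoint : Region d n → DominoSet d n → Set
PairwiseDisjoint R t = ∀ i k i′ k′ j → (i , k) ∈ᵈ t → (i′ , k′) ∈ᵈ t →
  Covers R (i , k) j → Covers R (i′ , k′) j → (i , k) ≡ (i′ , k′)

IsTiling : Region d n → Subset n → DominoSet d n → Set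
IsTiling R S t = Contained R S t × Covering R S t × PairwiseDisjoint R t

-- The proof is irrelevant, so that tilings are equal as soon as they
-- consist of the same dominoes.
record Tiling (R : Region d n) (S : Subset n) : Set where
  constructor tiling
  field
    dominoes  : DominoSet d n
    .isTiling : IsTiling R S dominoes

open Tiling public

-- For the square with corner a and sides in the directions k, l, two
-- parallel dominoes in direction k are replaced by two in direction l.
FlipSet : Region d n → DominoSet d n → DominoSet d n → Set
FlipSet R t t′ = ∃[ k ] ∃[ l ] ∃[ a ] ∃[ b ] ∃[ c ]
  ( k ≢ l × IsShift R l a b × IsShift R k a c
  × (a , k) ∈ᵈ t × (b , k) ∈ᵈ t
  × t′ ≡ insert (a , l) (insert (c , l) (delete (a , k) (delete (b , k) t))))

Flip : {R : Region d n} {S : Subset n} → Tiling R S → Tiling R S → Set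
Flip {R = R} t t′ = FlipSet R (dominoes t) (dominoes t′)

infix 4 _≈_
_≈_ : {R : Region d n} {S : Subset n} → Tiling R S → Tiling R S → Set
_≈_ = Star Flip

InSquare : Cube 2 → Pred Point 0ℓ
InSquare (a ∷ b ∷ []) (x , y) =
  (a ℚ./ 1 ℚ.≤ x × x ℚ.≤ ℤ.suc a ℚ./ 1) × (b ℚ./ 1 ℚ.≤ y × y ℚ.≤ ℤ.suc b ℚ./ 1)

Union : Region 2 n → Pred Point 0ℓ
Union R p = ∃[ i ] InSquare (lookup R i) p

record QuadriculatedDisk : Set where
  field
    size     : ℕ
    squares  : Region 2 size
    distinct : Unique squares
    disk     : Homeomorphic (Union squares) ClosedDisk

isWhite : Cube 2 → Side
isWhite (a ∷ b ∷ []) = does (2 ∣? ℤ.∣ a ℤ.+ b ∣)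

white : Region 2 n → Subset n
white = Vec.map isWhite

BalancedSet : Region 2 n → Subset n → Set
BalancedSet R S = ∣ S ∩ white R ∣ ≡ ∣ S ∩ ∁ (white R) ∣

Balanced : QuadriculatedDisk → Set
Balanced 𝓓 = BalancedSet squares full
  where open QuadriculatedDisk 𝓓

Adjacent : Region d n → Fin n → Fin n → Set
Adjacent R i j = ∃[ k ] (IsShift R k i j ⊎ IsShift R k j i)

adjacent? : (R : Region d n) (i j : Fin n) → Dec (Adjacent R i j)
adjacent? R i j = Fin.any? λ k → isShift? R k i j ⊎-dec isShift? R k j i

Trivial : QuadriculatedDisk → Set
Trivial 𝓓 = ∀ i → ∣ Vec.tabulate (λ j → does (adjacent? squares i j)) ∣ ℕ.≤ 2
  where open QuadriculatedDisk 𝓓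

Nontrivial : QuadriculatedDisk → Set
Nontrivial 𝓓 = ¬ Trivial 𝓓

cylinder : Region 2 n → (N : ℕ) → Region 3 (n ℕ.* N)
cylinder R N = Vec.map (λ (c , k) → c ∷ʳ (+ toℕ k)) (Vec.allPairs R (Vec.allFin N))

-- Step p q is the set of oriented edges from p to q, and Cell the set of
-- closed paths along which 2-cells are attached.
module EdgePath
  {V : Set} {Step : V → V → Set}
  (rev : ∀ {p q} → Step p q → Step q p)
  (rev-involutive : ∀ {p q} (s : Step p q) → rev (rev s) ≡ s)
  (Cell : ∀ {p} → Star Step p p → Set)
  where

  Path : V → V → Set
  Path = Star Step

  infix 4 _≃_
  data _≃_ : ∀ {p q} → Path p q → Path p q → Set where
    ≃-refl  : ∀ {p q} {γ : Path p q} → γ ≃ γ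
    ≃-sym   : ∀ {p q} {γ δ : Path p q} → γ ≃ δ → δ ≃ γ
    ≃-trans : ∀ {p q} {γ δ η : Path p q} → γ ≃ δ → δ ≃ η → γ ≃ η
    ≃-cong  : ∀ {p q r} {γ γ′ : Path p q} {δ δ′ : Path q r} →
              γ ≃ γ′ → δ ≃ δ′ → γ ◅◅ δ ≃ γ′ ◅◅ δ′
    cancel  : ∀ {p q} (s : Step p q) → s ◅ rev s ◅ ε ≃ ε
    fill    : ∀ {p} {γ : Path p p} → Cell γ → γ ≃ ε

  inverse : ∀ {p q} → Path p q → Path q p
  inverse ε       = ε
  inverse (s ◅ γ) = inverse γ ◅◅ (rev s ◅ ε)

  private
    ≡⇒≃ : ∀ {p q} {γ δ : Path p q} → γ ≡ δ → γ ≃ δ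
    ≡⇒≃ refl = ≃-refl

    assoc : ∀ {p q r s} (γ : Path p q) (δ : Path q r) (η : Path r s) →
            (γ ◅◅ δ) ◅◅ η ≃ γ ◅◅ (δ ◅◅ η)
    assoc γ δ η = ≡⇒≃ (Star.◅◅-assoc γ δ η)

    identityʳ : ∀ {p q} (γ : Path p q) → γ ◅◅ ε ≃ γ
    identityʳ ε       = ≃-refl
    identityʳ (s ◅ γ) = ≃-cong {γ = s ◅ ε} ≃-refl (identityʳ γ)

    cancel′ : ∀ {p q} (s : Step p q) → rev s ◅ s ◅ ε ≃ ε
    cancel′ s = subst (λ s′ → rev s ◅ s′ ◅ ε ≃ ε) (rev-involutive s) (cancel (rev s))

    collapse : ∀ {p q r t} (γ : Path p q) (η : Path q r) (η′ : Path r q) (δ : Path q t) →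
               η ◅◅ η′ ≃ ε → (γ ◅◅ η) ◅◅ (η′ ◅◅ δ) ≃ γ ◅◅ δ
    collapse γ η η′ δ e =
      ≃-trans (assoc γ η (η′ ◅◅ δ))
        (≃-cong ≃-refl (≃-trans (≃-sym (assoc η η′ δ)) (≃-cong e ≃-refl)))

    inverseʳ : ∀ {p q} (γ : Path p q) → γ ◅◅ inverse γ ≃ ε
    inverseʳ ε       = ≃-refl
    inverseʳ (s ◅ γ) = ≃-trans
      (≃-cong {γ = s ◅ ε} ≃-refl
        (≃-trans (≃-sym (assoc γ (inverse γ) _)) (≃-cong (inverseʳ γ) ≃-refl)))
      (cancel s)

    inverseˡ : ∀ {p q} (γ : Path p q) → inverse γ ◅◅ γ ≃ ε
    inverseˡ ε       = ≃-refl
    inverseˡ (s ◅ γ) = ≃-trans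
      (collapse (inverse γ) (rev s ◅ ε) (s ◅ ε) γ (cancel′ s))
      (inverseˡ γ)

    inverse-cong : ∀ {p q} {γ δ : Path p q} → γ ≃ δ → inverse γ ≃ inverse δ
    inverse-cong {γ = γ} {δ} e =
      ≃-trans (≃-sym (identityʳ _))
        (≃-trans (≃-cong ≃-refl (≃-sym (inverseʳ δ)))
          (≃-trans (≃-cong (≃-refl {γ = inverse γ}) (≃-cong (≃-sym e) (≃-refl {γ = inverse δ})))
            (≃-trans (≃-sym (assoc (inverse γ) γ (inverse δ)))
              (≃-cong (inverseˡ γ) ≃-refl))))

  π₁ : V → Group 0ℓ 0ℓ
  π₁ p = record
    { Carrier = Path p p
    ; _≈_     = _≃_
    ; _∙_     = _◅◅_
    ; ε       = ε
    ; _⁻¹     = inverse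
    ; isGroup = record
      { isMonoid = record
        { isSemigroup = record
          { isMagma = record
            { isEquivalence = record { refl = ≃-refl ; sym = ≃-sym ; trans = ≃-trans }
            ; ∙-cong        = ≃-cong
            }
          ; assoc = assoc
          }
        ; identity = (λ _ → ≃-refl) , identityʳ
        }
      ; inverse = inverseˡ , inverseʳ
      ; ⁻¹-cong = inverse-cong
      }
    }

  pathLength : ∀ {p q} → Path p q → ℕ
  pathLength ε       = 0
  pathLength (s ◅ γ) = suc (pathLength γ)

  pathLength-◅◅ : ∀ {p q r} (γ : Path p q) (δ : Path q r) →
                  pathLength (γ ◅◅ δ) ≡ pathLength γ ℕ.+ pathLength δ
  pathLength-◅◅ ε       δ = refl
  pathLength-◅◅ (s ◅ γ) δ = cong suc (pathLength-◅◅ γ δ)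

  pathParity : ∀ {p q} → Path p q → Parity
  pathParity γ = parity (pathLength γ)

  module _ (even : ∀ {p} {γ : Path p p} → Cell γ → pathParity γ ≡ 0ℙ) where

    private
      homo : ∀ {p q r} (γ : Path p q) (δ : Path q r) →
             pathParity (γ ◅◅ δ) ≡ pathParity γ ℙ.+ pathParity δ
      homo γ δ = trans (cong parity (pathLength-◅◅ γ δ))
                       (ℙ.+-homo-+ (pathLength γ) (pathLength δ))

      parity-cong : ∀ {p q} {γ δ : Path p q} → γ ≃ δ → pathParity γ ≡ pathParity δ
      parity-cong ≃-refl        = refl
      parity-cong (≃-sym e)     = sym (parity-cong e)
      parity-cong (≃-trans e f) = trans (parity-cong e) (parity-cong f)
      parity-cong (≃-cong {γ = γ} {γ′} {δ} {δ′} e f) =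
        trans (homo γ δ)
          (trans (cong₂ ℙ._+_ (parity-cong e) (parity-cong f)) (sym (homo γ′ δ′)))
      parity-cong (cancel s)    = refl
      parity-cong (fill c)      = even c

      parity-inverse : ∀ {p q} (γ : Path p q) → pathParity (inverse γ) ≡ pathParity γ
      parity-inverse ε       = refl
      parity-inverse (s ◅ γ) =
        trans (homo (inverse γ) (rev s ◅ ε))
          (trans (cong (ℙ._+ parity 1) (parity-inverse γ))
            (trans (ℙ.+-comm (pathParity γ) (parity 1))
              (sym (ℙ.+-homo-+ 1 (pathLength γ)))))

    pathParity-isGroupHomomorphism : ∀ p →
      GroupMorphisms.IsGroupHomomorphism (Group.rawGroup (π₁ p))
        (Group.rawGroup ℙ.+-0-group) pathParity
    pathParity-isGroupHomomorphism p = record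
      { isMonoidHomomorphism = record
        { isMagmaHomomorphism = record
          { isRelHomomorphism = record { cong = parity-cong }
          ; homo = homo
          }
        ; ε-homo = refl
        }
      ; ⁻¹-homo = parity-inverse
      }

kernel : (G H : Group 0ℓ 0ℓ) {φ : Group.Carrier G → Group.Carrier H} →
         GroupMorphisms.IsGroupHomomorphism (Group.rawGroup G) (Group.rawGroup H) φ →
         Group 0ℓ 0ℓ
kernel G H {φ} φ-hom = record
  { Carrier = Σ[ x ∈ G.Carrier ] φ x H.≈ H.ε
  ; _≈_     = λ x y → proj₁ x G.≈ proj₁ y
  ; _∙_     = λ (x , φx) (y , φy) → x G.∙ y ,
      H.trans (φ.homo x y) (H.trans (H.∙-cong φx φy) (H.identityˡ H.ε))
  ; ε       = G.ε , φ.ε-homo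
  ; _⁻¹     = λ (x , φx) → x G.⁻¹ ,
      H.trans (φ.⁻¹-homo x) (H.trans (H.⁻¹-cong φx)
        (H.trans (H.sym (H.identityˡ _)) (H.inverseʳ H.ε)))
  ; isGroup = record
    { isMonoid = record
      { isSemigroup = record
        { isMagma = record
          { isEquivalence = record { refl = G.refl ; sym = G.sym ; trans = G.trans }
          ; ∙-cong        = G.∙-cong
          }
        ; assoc = λ x y z → G.assoc (proj₁ x) (proj₁ y) (proj₁ z)
        }
      ; identity = (λ x → G.identityˡ (proj₁ x)) , (λ x → G.identityʳ (proj₁ x))
      }
    ; inverse = (λ x → G.inverseˡ (proj₁ x)) , (λ x → G.inverseʳ (proj₁ x))
    ; ⁻¹-cong = G.⁻¹-cong
    }
  }
  where
  module G = Group G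
  module H = Group H
  module φ = GroupMorphisms.IsGroupHomomorphism φ-hom

-- Words in the letters x and their formal inverses, up to cancellation:
-- the fundamental group of a bouquet of circles indexed by X.
freeGroup : Set → Group 0ℓ 0ℓ
freeGroup X = EdgePath.π₁ {V = ⊤} {Step = λ _ _ → X × Sign}
  (λ (x , ±) → x , opposite ±)
  (λ (x , ±) → cong (x ,_) (Sign.opposite-selfInverse refl))
  (λ _ → ⊥) tt

F₂ : Group 0ℓ 0ℓ
F₂ = freeGroup (Fin 2)

module DominoComplex {n : ℕ} (R : Region 2 n) where

  record Plug : Set where
    constructor plug
    field
      support   : Subset n
      .balanced : BalancedSet R support

  open Plug public

  emptyPlug : Plug
  emptyPlug = plug empty (cong ∣_∣ (trans (∩-zeroˡ (white R)) (sym (∩-zeroˡ (∁ (white R))))))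

  DisjointPlugs : Plug → Plug → Set
  DisjointPlugs p q = Empty (support p ∩ support q)

  -- The closure of the complement of the union of the two plugs.
  complement : Plug → Plug → Subset n
  complement p q = ∁ (support p ∪ support q)

  -- An edge between distinct plugs has one orientation from each end,
  -- whereas a loop has two orientations from the empty plug to itself.
  data Step : Plug → Plug → Set where
    edge : ∀ {p q} .(p≢q : p ≢ q) .(disj : DisjointPlugs p q) →
           Tiling R (complement p q) → Step p q
    loop : Sign → Tiling R full → Step emptyPlug emptyPlug

  stepDominoes : ∀ {p q} → Step p q → DominoSet 2 n
  stepDominoes (edge _ _ f) = dominoes f
  stepDominoes (loop _ f)   = dominoes f

  rev : ∀ {p q} → Step p q → Step q p
  rev {p} {q} (edge p≢q disj (tiling t t-tiles)) =
    edge (p≢q ∘ sym)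
         (subst Empty (∩-comm (support p) (support q)) disj)
         (tiling t (subst (λ S → IsTiling R (∁ S) t) (∪-comm (support p) (support q)) t-tiles))
  rev (loop ± f) = loop (opposite ±) f

  rev-involutive : ∀ {p q} (s : Step p q) → rev (rev s) ≡ s
  rev-involutive (edge _ _ f) = refl
  rev-involutive (loop ± f)   = cong (λ s → loop s f) (Sign.opposite-selfInverse refl)

  IsUnionWith : Plug → Plug → Domino 2 n → Set
  IsUnionWith p₂ p₃ (i , k) = ∃[ j ]
    (IsShift R k i j × i ∉ support p₃ × j ∉ support p₃
    × support p₂ ≡ support p₃ ∪ (⁅ i ⁆ ∪ ⁅ j ⁆))

  -- The disjointness conditions on the four plugs are part of Step.
  data Cell : ∀ {p} → Star Step p p → Set where
    projective    : ∀ ± f → Cell (loop ± f ◅ loop ± f ◅ ε)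
    bigon         : ∀ {p q} .{p≢q : p ≢ q} .{disj : DisjointPlugs p q}
                    (f f′ : Tiling R (complement p q)) → Flip f f′ →
                    Cell (edge p≢q disj f ◅ rev (edge p≢q disj f′) ◅ ε)
    quadrilateral : ∀ {p₁ p₂ p₃ p₄} (δ : Domino 2 n) → IsUnionWith p₂ p₃ δ →
                    (s₁₂ : Step p₁ p₂) (s₂₄ : Step p₂ p₄)
                    (s₄₃ : Step p₄ p₃) (s₃₁ : Step p₃ p₁) →
                    stepDominoes s₄₃ ≡ insert δ (stepDominoes s₂₄) →
                    stepDominoes s₃₁ ≡ insert δ (stepDominoes s₁₂) →
                    Cell (s₁₂ ◅ s₂₄ ◅ s₄₃ ◅ s₃₁ ◅ ε)

  open EdgePath rev rev-involutive Cell public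

  cell-even : ∀ {p} {γ : Path p p} → Cell γ → pathParity γ ≡ 0ℙ
  cell-even (projective _ _)                = refl
  cell-even (bigon _ _ _)                   = refl
  cell-even (quadrilateral _ _ _ _ _ _ _ _) = refl

  dominoGroup : Group 0ℓ 0ℓ
  dominoGroup = π₁ emptyPlug

  evenDominoGroup : Group 0ℓ 0ℓ
  evenDominoGroup =
    kernel dominoGroup ℙ.+-0-group (pathParity-isGroupHomomorphism cell-even emptyPlug)

StronglyIrregular : QuadriculatedDisk → Set
StronglyIrregular 𝓓 = Σ[ φ ∈ (G⁺.Carrier → F.Carrier) ]
  (GroupMorphisms.IsGroupHomomorphism G⁺.rawGroup F.rawGroup φ × Surjective G⁺._≈_ F._≈_ φ)
  where
  open QuadriculatedDisk 𝓓
  module G⁺ = Group (DominoComplex.evenDominoGroup squares)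
  module F  = Group F₂

sides : List Side
sides = inside ∷ outside ∷ []

subsets : ∀ d → List (Subset d)
subsets zero    = [] ∷ []
subsets (suc d) = List.cartesianProductWith _∷_ sides (subsets d)

∈-subsets : (S : Subset d) → S ∈ˡ subsets d
∈-subsets []            = here refl
∈-subsets (inside  ∷ S) = ∈-cartesianProductWith⁺ _∷_ {xs = sides} (here refl) (∈-subsets S)
∈-subsets (outside ∷ S) = ∈-cartesianProductWith⁺ _∷_ {xs = sides} (there (here refl)) (∈-subsets S)

dominoSets : ∀ d n → List (DominoSet d n)
dominoSets d zero    = [] ∷ []
dominoSets d (suc n) = List.cartesianProductWith _∷_ (subsets d) (dominoSets d n)

∈-dominoSets : (t : DominoSet d n) → t ∈ˡ dominoSets d n
∈-dominoSets []      = here refl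
∈-dominoSets (S ∷ t) = ∈-cartesianProductWith⁺ _∷_ (∈-subsets S) (∈-dominoSets t)

isTiling? : (R : Region d n) (S : Subset n) (t : DominoSet d n) → Dec (IsTiling R S t)
isTiling? R S t = contained? ×-dec covering? ×-dec disjoint?
  where
  covers? : ∀ i k j → Dec (Covers R (i , k) j)
  covers? i k j = j Fin.≟ i ⊎-dec isShift? R k i j

  contained? : Dec (Contained R S t)
  contained? = Fin.all? λ i → Fin.all? λ k → (k ∈? lookup t i) →-dec
    (i ∈? S ×-dec Fin.any? λ j → j ∈? S ×-dec isShift? R k i j)

  covering? : Dec (Covering R S t)
  covering? = Fin.all? λ j → (j ∈? S) →-dec
    Fin.any? λ i → Fin.any? λ k → (k ∈? lookup t i) ×-dec covers? i k j

  disjoint? : Dec (PairwiseDisjoint R t)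
  disjoint? = Fin.all? λ i → Fin.all? λ k → Fin.all? λ i′ → Fin.all? λ k′ → Fin.all? λ j →
    (k ∈? lookup t i) →-dec (k′ ∈? lookup t i′) →-dec
    covers? i k j →-dec covers? i′ k′ j →-dec
    Product.≡-dec Fin._≟_ Fin._≟_ (i , k) (i′ , k′)

module _ (R : Region d n) (S : Subset n) where

  toTiling : DominoSet d n → Maybe (Tiling R S)
  toTiling t with isTiling? R S t
  ... | yes t-tiles = just (tiling t t-tiles)
  ... | no  _       = nothing

  tilings : List (Tiling R S)
  tilings = mapMaybe toTiling (dominoSets d n)

  ∈-tilings : (t : Tiling R S) → t ∈ˡ tilings
  ∈-tilings (tiling t t-tiles) = go (∈-dominoSets t)
    where
    go : ∀ {ts} → t ∈ˡ ts → tiling t t-tiles ∈ˡ mapMaybe toTiling ts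
    go (here refl) with isTiling? R S t
    ... | yes _       = here refl
    ... | no ¬tiles = ⊥-elim-irr (¬tiles t-tiles)
    go (there {x = u} t∈ts) with isTiling? R S u
    ... | yes _ = there (go t∈ts)
    ... | no  _ = go t∈ts

-- The Floyd–Warshall algorithm: Via zs x y means that there is a path
-- from x to y all of whose intermediate points are in zs.
module Reachability {A : Set} {_⟶_ : A → A → Set}
  (_≟_ : (x y : A) → Dec (x ≡ y)) (_⟶?_ : (x y : A) → Dec (x ⟶ y))
  (all : List A) (∈-all : ∀ x → x ∈ˡ all) where

  Via : List A → A → A → Set
  Via []       x y = x ≡ y ⊎ x ⟶ y
  Via (z ∷ zs) x y = Via zs x y ⊎ (Via zs x z × Via zs z y)

  via? : ∀ zs x y → Dec (Via zs x y)
  via? []       x y = (x ≟ y) ⊎-dec (x ⟶? y)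
  via? (z ∷ zs) x y = via? zs x y ⊎-dec (via? zs x z ×-dec via? zs z y)

  via⇒star : ∀ zs {x y} → Via zs x y → Star _⟶_ x y
  via⇒star []       (inj₁ refl)    = ε
  via⇒star []       (inj₂ x⟶y)     = x⟶y ◅ ε
  via⇒star (z ∷ zs) (inj₁ p)       = via⇒star zs p
  via⇒star (z ∷ zs) (inj₂ (p , q)) = via⇒star zs p ◅◅ via⇒star zs q

  via-weaken : ∀ zs {x y} → Via [] x y → Via zs x y
  via-weaken []       p = p
  via-weaken (z ∷ zs) p = inj₁ (via-weaken zs p)

  via-trans : ∀ zs {x y z} → z ∈ˡ zs → Via zs x z → Via zs z y → Via zs x y
  via-trans (w ∷ zs) (here refl) p q = inj₂ (into p , out q)
    where
    into : ∀ {x} → Via (w ∷ zs) x w → Via zs x w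
    into (inj₁ p)       = p
    into (inj₂ (p , _)) = p
    out : ∀ {y} → Via (w ∷ zs) w y → Via zs w y
    out (inj₁ q)       = q
    out (inj₂ (_ , q)) = q
  via-trans (w ∷ zs) (there z∈) (inj₁ p)        (inj₁ q)        = inj₁ (via-trans zs z∈ p q)
  via-trans (w ∷ zs) (there z∈) (inj₁ p)        (inj₂ (q , q′)) = inj₂ (via-trans zs z∈ p q , q′)
  via-trans (w ∷ zs) (there z∈) (inj₂ (p , p′)) (inj₁ q)        = inj₂ (p , via-trans zs z∈ p′ q)
  via-trans (w ∷ zs) (there z∈) (inj₂ (p , _))  (inj₂ (_ , q))  = inj₂ (p , q)

  star⇒via : ∀ {x y} → Star _⟶_ x y → Via all x y
  star⇒via ε         = via-weaken all (inj₁ refl)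
  star⇒via (s ◅ γ)   = via-trans all (∈-all _) (via-weaken all (inj₂ s)) (star⇒via γ)

  star? : ∀ x y → Dec (Star _⟶_ x y)
  star? x y = map′ (via⇒star all) star⇒via (via? all x y)

module _ {R : Region d n} {S : Subset n} where

  _≟ᵗ_ : (t u : Tiling R S) → Dec (t ≡ u)
  tiling t _ ≟ᵗ tiling u _ =
    map′ (λ { refl → refl }) (cong dominoes) (Vec.≡-dec (Vec.≡-dec Bool._≟_) t u)

  flip? : (t u : Tiling R S) → Dec (Flip t u)
  flip? (tiling t _) (tiling u _) =
    Fin.any? λ k → Fin.any? λ l → Fin.any? λ a → Fin.any? λ b → Fin.any? λ c →
    ¬? (k Fin.≟ l) ×-dec isShift? R l a b ×-dec isShift? R k a c
    ×-dec (k ∈? lookup t a) ×-dec (k ∈? lookup t b)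
    ×-dec Vec.≡-dec (Vec.≡-dec Bool._≟_) u _

  _≈?_ : (t u : Tiling R S) → Dec (t ≈ u)
  _≈?_ = Reachability.star? _≟ᵗ_ flip? (tilings R S) (∈-tilings R S)

module RandomTilings (𝓓 : QuadriculatedDisk) (N : ℕ) where
  open QuadriculatedDisk 𝓓

  allTilings : List (Tiling (cylinder squares N) full)
  allTilings = tilings (cylinder squares N) full

  #tilings : ℕ
  #tilings = length allTilings

  #equivalentPairs : ℕ
  #equivalentPairs = length (filter (uncurry _≈?_) (cartesianProduct allTilings allTilings))

  -- ℙ(T₁ ≈ T₂) for (T₁ , T₂) uniform on the set of all pairs of tilings.
  prob≈ : .{{_ : NonZero #tilings}} → ℚ
  prob≈ = (+ #equivalentPairs) ℚ./ (#tilings ℕ.* #tilings)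
    where instance _ = ℕ.m*n≢0 #tilings #tilings

{-# OPTIONS --safe #-}
module Submission where

{- Cutting the cylinder at integer heights turns a tiling of 𝓓 × [0 , N] into a closed walk of N floors
at the empty plug, and a flip does not change the homotopy class of this walk in the 2-complex.
Hence it suffices to bound the number of pairs of walks with the same image in F₂, that is, the
squared ℓ²-norm ∥ X ∥² of the multiplicity function of the multiset X of images, by κ ^ N times the
squared number of walks for some κ < 1.

Cut the walks into blocks of a large even length. For any two plugs p and q that are reachable from
the empty plug in an even number of steps, the block walks from p to q include three whose images,
after closing them up with fixed paths to p and q, are 1, a and b. On F₂ the convolution with
{1 , a , b} contracts the ℓ²-norm by a factor bounded away from its trivial value 3 (Kesten), by weighted
AM-GM on the edges of the Cayley tree; all other block walks act by isometries. So each block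
contributes a definite factor, whatever the plugs between the blocks are. -}

open import Defs
open import Data.Nat as ℕ using (ℕ; NonZero)
open import Data.Product using (_×_; ∃-syntax)
open import Data.Rational using (0ℚ; 1ℚ; _<_; _≤_; _*_; +-*-rawSemiring)
open import Algebra.Definitions.RawSemiring +-*-rawSemiring using (_^_)

open import Algebra.Bundles using (Group; CommutativeMonoid)
open import Algebra.Morphism.Structures using (module GroupMorphisms)
open import Data.Bool using (Bool; true; false; not)
import Data.Bool.Properties as Bool
open import Data.Empty using (⊥-elim-irr)
open import Data.Fin as Fin using (Fin; zero; suc; toℕ; inject₁; combine; remQuot)
import Data.Fin.Properties as Fin
open import Data.Fin.Subset
  using (Subset; Side; inside; outside; _∈_; _∉_; _∩_; _∪_; ∁; ⁅_⁆; Empty; ∣_∣)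
  renaming (⊤ to full; ⊥ to empty)
open import Data.Fin.Subset.Properties
  using (_∈?_; nonempty?; drop-∷-Empty; Empty-unique; ∉⊥; ∈⊤; x∈⁅y⁆⇒x≡y; x∈⁅x⁆; x∈∁p⇒x∉p;
         x∉p⇒x∈∁p; x∈p∩q⁺; x∈p∩q⁻; x∈p∪q⁺; x∈p∪q⁻; ⊆-antisym; ∪-comm; ∪-identityˡ;
         ∪-identityʳ; ∪-assoc; ∩-zeroˡ)
open import Data.Integer as ℤ using (+_; -[1+_])
import Data.Integer.Properties as ℤ
open import Data.List as List
  using (List; []; _∷_; _++_; length; map; concatMap; filter; mapMaybe; cartesianProduct; cartesianProductWith)
import Data.List.Membership.DecPropositional as DecMembership
open import Data.List.Membership.Propositional using () renaming (_∈_ to _∈ˡ_; _∉_ to _∉ˡ_)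
open import Data.List.Membership.Propositional.Properties
  using (∈-map⁻; ∈-map⁺; ∈-filter⁻; ∈-∃++; ∈-concatMap⁺; ∈-cartesianProductWith⁺;
         ∈-cartesianProductWith⁻; ∈-cartesianProduct⁺)
open import Data.List.Membership.Propositional.Properties.WithK using (unique∧set⇒bag)
import Data.List.Properties as List
open import Data.List.Relation.Binary.BagAndSetEquality using (∼bag⇒↭)
open import Data.List.Relation.Binary.Permutation.Propositional
  using (_↭_; ↭-sym; ↭-trans; ↭-refl; ↭-prep; ↭-reflexive)
import Data.List.Relation.Binary.Permutation.Propositional as ↭
import Data.List.Relation.Binary.Permutation.Propositional.Properties as ↭
open import Data.List.Relation.Unary.All as All using (All; []; _∷_)
import Data.List.Relation.Unary.All.Properties as All
open import Data.List.Relation.Unary.AllPairs as AllPairs using ([]; _∷_)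
import Data.List.Relation.Unary.AllPairs.Properties as AllPairs
open import Data.List.Relation.Unary.Any as Any using (Any; here; there)
open import Data.List.Relation.Unary.Unique.Propositional using () renaming (Unique to UniqueL)
import Data.List.Relation.Unary.Unique.Propositional.Properties as UniqueL
open import Data.Maybe using (Maybe; just; nothing)
import Data.Maybe.Properties as Maybe
open import Data.Nat using (zero; suc; z≤n; s≤s; parity)
open import Data.Nat.Divisibility using (_∣?_; ∣-refl; ∣m+n∣m⇒∣n; ∣m∣n⇒∣m+n)
import Data.Nat.DivMod as ℕ
open import Data.Nat.ListAction using (sum)
import Data.Nat.Properties as ℕ
open import Data.Nat.Tactic.RingSolver using (solve-∀)
open import Data.Parity as ℙ using (0ℙ)
import Data.Parity.Properties as ℙ
open import Data.Product as Product using (Σ-syntax; _,_; proj₁; proj₂; uncurry)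
import Data.Product.Properties as Product
open import Data.Rational as ℚ using (ℚ; mkℚ; toℚᵘ)
import Data.Rational.Properties as ℚ
open import Data.Rational.Unnormalised as ℚᵘ using (mkℚᵘ; *≡*; *≤*; *<*)
import Data.Rational.Unnormalised.Properties as ℚᵘ
open import Data.Sign as Sign using (Sign; opposite)
import Data.Sign.Properties as Sign
open import Data.Sum using (_⊎_; inj₁; inj₂; [_,_]′)
open import Data.Unit using (⊤; tt)
open import Data.Vec as Vec using (Vec; []; _∷_; lookup; tabulate; _[_]%=_; _[_]≔_; _∷ʳ_)
import Data.Vec.Properties as Vec
open import Data.Vec.Relation.Unary.Unique.Propositional using (Unique)
import Data.Vec.Relation.Unary.Unique.Propositional.Properties as Unique
open import Function using (_∘_; id; mk⇔; Injective)
open import Level using (0ℓ)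
open import Relation.Binary.Construct.Closure.ReflexiveTransitive using (Star; ε; _◅_; _◅◅_)
import Relation.Binary.Construct.Closure.ReflexiveTransitive.Properties as Star
open import Relation.Binary.Definitions using (DecidableEquality)
open import Relation.Binary.PropositionalEquality
  using (_≡_; _≢_; refl; sym; trans; cong; cong₂; subst; subst₂; module ≡-Reasoning)
open import Relation.Nullary using (¬_; Dec; yes; no; does; contradiction; ¬?)
open import Relation.Nullary.Decidable using (map′; recompute; _×-dec_; does-⇔)
open import Relation.Unary using (Pred; Decidable)

-- Collisions of multisets

-- Two features separate tilings from a random walk on a group. The increments are not independent:
-- only between fixed plugs do the walks of a block act as a convolution, and the numbers of walks
-- for different plugs are not controlled. The induction therefore carries the ratio of the ℓ²-norm
-- to the ℓ¹-norm. By the triangle inequality a bound on it passes to sums over the intermediate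
-- plug, however unequal the summands are, provided that the gain has a lower bound common to all
-- pairs of plugs. A block long enough to return home, follow a preimage of 1, a or b, and go out
-- again supplies it. The homomorphism is defined on even paths only. Hence blocks and routes are
-- even, and since N may be odd, walks of N floors are closed up by the inverse of one fixed tiling.
-- Nontriviality enters through homotopy invariance. Bigons join distinct plugs, so a flip in a
-- floor without vertical dominoes has no 2-cell of its own, and a third domino in that floor is
-- needed to fill it. Norms are those of integer multisets, so the estimates are inequalities in ℕ,
-- arranged without subtraction; rationals appear only in the final rate.

module _ {A : Set} where

  ∈⇒↭ : {x : A} {xs : List A} → x ∈ˡ xs → ∃[ ys ] xs ↭ x ∷ ys
  ∈⇒↭ {x} x∈xs with ys , zs , refl ← ∈-∃++ x∈xs = ys ++ zs , ↭.shift x ys zs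

-- The collision form ⟨ X , Z ⟩ is the inner product of the multiplicity functions.
module Collision {Y : Set} (_≟_ : DecidableEquality Y) where
  open DecMembership _≟_ using () renaming (_∈?_ to _∈ˡ?_)

  [_≟_] : Y → Y → ℕ
  [ x ≟ y ] with x ≟ y
  ... | yes _ = 1
  ... | no _  = 0

  ind-yes : ∀ {x y} → x ≡ y → [ x ≟ y ] ≡ 1
  ind-yes {x} {y} x≡y with x ≟ y
  ... | yes _  = refl
  ... | no x≢y = contradiction x≡y x≢y

  ind-no : ∀ {x y} → x ≢ y → [ x ≟ y ] ≡ 0
  ind-no {x} {y} x≢y with x ≟ y
  ... | yes x≡y = contradiction x≡y x≢y
  ... | no _    = refl

  ind-sym : ∀ x y → [ x ≟ y ] ≡ [ y ≟ x ]
  ind-sym x y with x ≟ y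
  ... | yes x≡y = sym (ind-yes (sym x≡y))
  ... | no x≢y  = sym (ind-no (x≢y ∘ sym))

  count : Y → List Y → ℕ
  count x []       = 0
  count x (y ∷ ys) = [ x ≟ y ] ℕ.+ count x ys

  ⟨_,_⟩ : List Y → List Y → ℕ
  ⟨ [] , Z ⟩    = 0
  ⟨ x ∷ X , Z ⟩ = count x Z ℕ.+ ⟨ X , Z ⟩

  count-++ : ∀ x ys zs → count x (ys ++ zs) ≡ count x ys ℕ.+ count x zs
  count-++ x []       zs = refl
  count-++ x (y ∷ ys) zs = trans (cong ([ x ≟ y ] ℕ.+_) (count-++ x ys zs))
                                 (sym (ℕ.+-assoc [ x ≟ y ] _ _))

  ⟨⟩-++ˡ : ∀ X X′ Z → ⟨ X ++ X′ , Z ⟩ ≡ ⟨ X , Z ⟩ ℕ.+ ⟨ X′ , Z ⟩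
  ⟨⟩-++ˡ []      X′ Z = refl
  ⟨⟩-++ˡ (x ∷ X) X′ Z = trans (cong (count x Z ℕ.+_) (⟨⟩-++ˡ X X′ Z)) (sym (ℕ.+-assoc (count x Z) _ _))

  ⟨⟩-[]ʳ : ∀ X → ⟨ X , [] ⟩ ≡ 0
  ⟨⟩-[]ʳ []      = refl
  ⟨⟩-[]ʳ (x ∷ X) = ⟨⟩-[]ʳ X

  ⟨⟩-∷ʳ : ∀ X z Z → ⟨ X , z ∷ Z ⟩ ≡ count z X ℕ.+ ⟨ X , Z ⟩
  ⟨⟩-∷ʳ []      z Z = refl
  ⟨⟩-∷ʳ (x ∷ X) z Z rewrite ⟨⟩-∷ʳ X z Z | ind-sym x z = shuffle [ z ≟ x ] (count x Z) (count z X) ⟨ X , Z ⟩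
    where
    shuffle : ∀ a b c d → (a ℕ.+ b) ℕ.+ (c ℕ.+ d) ≡ (a ℕ.+ c) ℕ.+ (b ℕ.+ d)
    shuffle = solve-∀

  ⟨⟩-sym : ∀ X Z → ⟨ X , Z ⟩ ≡ ⟨ Z , X ⟩
  ⟨⟩-sym []      Z = sym (⟨⟩-[]ʳ Z)
  ⟨⟩-sym (x ∷ X) Z = trans (cong (count x Z ℕ.+_) (⟨⟩-sym X Z)) (sym (⟨⟩-∷ʳ Z x X))

  ⟨⟩-++ʳ : ∀ X Z Z′ → ⟨ X , Z ++ Z′ ⟩ ≡ ⟨ X , Z ⟩ ℕ.+ ⟨ X , Z′ ⟩
  ⟨⟩-++ʳ X Z Z′ = begin
    ⟨ X , Z ++ Z′ ⟩           ≡⟨ ⟨⟩-sym X (Z ++ Z′) ⟩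
    ⟨ Z ++ Z′ , X ⟩           ≡⟨ ⟨⟩-++ˡ Z Z′ X ⟩
    ⟨ Z , X ⟩ ℕ.+ ⟨ Z′ , X ⟩  ≡⟨ cong₂ ℕ._+_ (⟨⟩-sym Z X) (⟨⟩-sym Z′ X) ⟩
    ⟨ X , Z ⟩ ℕ.+ ⟨ X , Z′ ⟩  ∎
    where open ≡-Reasoning

  ⟨⟩-↭ˡ : ∀ {X X′} → X ↭ X′ → ∀ Z → ⟨ X , Z ⟩ ≡ ⟨ X′ , Z ⟩
  ⟨⟩-↭ˡ ↭.refl Z         = refl
  ⟨⟩-↭ˡ (↭.prep x p) Z   = cong (count x Z ℕ.+_) (⟨⟩-↭ˡ p Z)
  ⟨⟩-↭ˡ (↭.swap x y p) Z =
    trans (cong (λ s → count x Z ℕ.+ (count y Z ℕ.+ s)) (⟨⟩-↭ˡ p Z)) (exchange (count x Z) (count y Z) _)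
    where
    exchange : ∀ a b c → a ℕ.+ (b ℕ.+ c) ≡ b ℕ.+ (a ℕ.+ c)
    exchange = solve-∀
  ⟨⟩-↭ˡ (↭.trans p q) Z  = trans (⟨⟩-↭ˡ p Z) (⟨⟩-↭ˡ q Z)

  ⟨⟩-↭ʳ : ∀ X {Z Z′} → Z ↭ Z′ → ⟨ X , Z ⟩ ≡ ⟨ X , Z′ ⟩
  ⟨⟩-↭ʳ X {Z} {Z′} p = trans (⟨⟩-sym X Z) (trans (⟨⟩-↭ˡ p X) (⟨⟩-sym Z′ X))

  ∥_∥² : List Y → ℕ
  ∥ X ∥² = ⟨ X , X ⟩

  ∥∥²-↭ : ∀ {X X′} → X ↭ X′ → ∥ X ∥² ≡ ∥ X′ ∥²
  ∥∥²-↭ {X} {X′} p = trans (⟨⟩-↭ˡ p X) (⟨⟩-↭ʳ X′ p)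

  ∥∥²-++ : ∀ X Z → ∥ X ++ Z ∥² ≡ ∥ X ∥² ℕ.+ 2 ℕ.* ⟨ X , Z ⟩ ℕ.+ ∥ Z ∥²
  ∥∥²-++ X Z = begin
    ⟨ X ++ Z , X ++ Z ⟩ ≡⟨ ⟨⟩-++ˡ X Z (X ++ Z) ⟩
    ⟨ X , X ++ Z ⟩ ℕ.+ ⟨ Z , X ++ Z ⟩ ≡⟨ cong₂ ℕ._+_ (⟨⟩-++ʳ X X Z) (⟨⟩-++ʳ Z X Z) ⟩
    ∥ X ∥² ℕ.+ ⟨ X , Z ⟩ ℕ.+ (⟨ Z , X ⟩ ℕ.+ ∥ Z ∥²) ≡⟨ cong (λ s → ∥ X ∥² ℕ.+ ⟨ X , Z ⟩ ℕ.+ (s ℕ.+ ∥ Z ∥²)) (⟨⟩-sym Z X) ⟩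
    ∥ X ∥² ℕ.+ ⟨ X , Z ⟩ ℕ.+ (⟨ X , Z ⟩ ℕ.+ ∥ Z ∥²) ≡⟨ collect ∥ X ∥² ⟨ X , Z ⟩ ∥ Z ∥² ⟩
    ∥ X ∥² ℕ.+ 2 ℕ.* ⟨ X , Z ⟩ ℕ.+ ∥ Z ∥² ∎
    where
    open ≡-Reasoning
    collect : ∀ a b c → a ℕ.+ b ℕ.+ (b ℕ.+ c) ≡ a ℕ.+ 2 ℕ.* b ℕ.+ c
    collect = solve-∀

  count-∉ : ∀ {x ys} → x ∉ˡ ys → count x ys ≡ 0
  count-∉ {ys = []}     _ = refl
  count-∉ {ys = y ∷ ys} x∉ = cong₂ ℕ._+_ (ind-no (x∉ ∘ here)) (count-∉ (x∉ ∘ there))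

  ⟨⟩-disjoint : ∀ X {Z} → (∀ {x} → x ∈ˡ X → x ∉ˡ Z) → ⟨ X , Z ⟩ ≡ 0
  ⟨⟩-disjoint []      _    = refl
  ⟨⟩-disjoint (x ∷ X) disj = cong₂ ℕ._+_ (count-∉ (disj (here refl))) (⟨⟩-disjoint X (disj ∘ there))

  module _ {f : Y → Y} (f-injective : Injective _≡_ _≡_ f) where

    count-map : ∀ x ys → count (f x) (map f ys) ≡ count x ys
    count-map x []       = refl
    count-map x (y ∷ ys) = cong₂ ℕ._+_ ind (count-map x ys)
      where
      ind : [ f x ≟ f y ] ≡ [ x ≟ y ]
      ind with x ≟ y
      ... | yes x≡y = ind-yes (cong f x≡y)
      ... | no x≢y  = ind-no (x≢y ∘ f-injective)

    ⟨⟩-map : ∀ X Z → ⟨ map f X , map f Z ⟩ ≡ ⟨ X , Z ⟩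
    ⟨⟩-map []      Z = refl
    ⟨⟩-map (x ∷ X) Z = cong₂ ℕ._+_ (count-map x Z) (⟨⟩-map X Z)

  -- Removing a common member from both lists lowers the two sides by the same amount, and a member
  -- of `X` that is missing in `Z` only enlarges the right side. So induction on `X` replaces
  -- squares of differences of multiplicities.
  am-gm : ∀ X Z → 2 ℕ.* ⟨ X , Z ⟩ ℕ.≤ ∥ X ∥² ℕ.+ ∥ Z ∥²
  am-gm []      Z = z≤n
  am-gm (x ∷ X) Z with x ∈ˡ? Z
  ... | no x∉Z = begin
    2 ℕ.* (count x Z ℕ.+ ⟨ X , Z ⟩)  ≡⟨ cong (λ k → 2 ℕ.* (k ℕ.+ ⟨ X , Z ⟩)) (count-∉ x∉Z) ⟩
    2 ℕ.* ⟨ X , Z ⟩                  ≤⟨ am-gm X Z ⟩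
    ∥ X ∥² ℕ.+ ∥ Z ∥²                ≤⟨ ℕ.+-monoˡ-≤ ∥ Z ∥² (ℕ.≤-trans (ℕ.m≤n+m ∥ X ∥² (count x X)) (ℕ.m≤n+m _ (count x (x ∷ X)))) ⟩
    count x (x ∷ X) ℕ.+ (count x X ℕ.+ ∥ X ∥²) ℕ.+ ∥ Z ∥²
                                     ≡⟨ cong (λ s → count x (x ∷ X) ℕ.+ s ℕ.+ ∥ Z ∥²) (⟨⟩-∷ʳ X x X) ⟨
    ∥ x ∷ X ∥² ℕ.+ ∥ Z ∥²            ∎
    where open ℕ.≤-Reasoning
  ... | yes x∈Z with Z′ , Z↭ ← ∈⇒↭ x∈Z = begin
    2 ℕ.* ⟨ x ∷ X , Z ⟩                ≡⟨ cong (2 ℕ.*_) (⟨⟩-↭ʳ (x ∷ X) Z↭) ⟩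
    2 ℕ.* ⟨ x ∷ X , x ∷ Z′ ⟩           ≡⟨ cong (2 ℕ.*_) (expand X Z′) ⟩
    2 ℕ.* (1 ℕ.+ count x Z′ ℕ.+ count x X ℕ.+ ⟨ X , Z′ ⟩)
                                       ≡⟨ distribute (count x X) (count x Z′) ⟨ X , Z′ ⟩ ⟩
    2 ℕ.+ 2 ℕ.* count x X ℕ.+ 2 ℕ.* count x Z′ ℕ.+ 2 ℕ.* ⟨ X , Z′ ⟩
                                       ≤⟨ ℕ.+-monoʳ-≤ (2 ℕ.+ 2 ℕ.* count x X ℕ.+ 2 ℕ.* count x Z′) (am-gm X Z′) ⟩
    2 ℕ.+ 2 ℕ.* count x X ℕ.+ 2 ℕ.* count x Z′ ℕ.+ (∥ X ∥² ℕ.+ ∥ Z′ ∥²)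
                                       ≡⟨ regroup (count x X) (count x Z′) ∥ X ∥² ∥ Z′ ∥² ⟩
    (1 ℕ.+ count x X ℕ.+ count x X ℕ.+ ∥ X ∥²) ℕ.+ (1 ℕ.+ count x Z′ ℕ.+ count x Z′ ℕ.+ ∥ Z′ ∥²)
                                       ≡⟨ cong₂ ℕ._+_ (expand X X) (expand Z′ Z′) ⟨
    ∥ x ∷ X ∥² ℕ.+ ∥ x ∷ Z′ ∥²         ≡⟨ cong (∥ x ∷ X ∥² ℕ.+_) (∥∥²-↭ Z↭) ⟨
    ∥ x ∷ X ∥² ℕ.+ ∥ Z ∥²              ∎
    where
    open ℕ.≤-Reasoning
    expand : ∀ A B → ⟨ x ∷ A , x ∷ B ⟩ ≡ 1 ℕ.+ count x B ℕ.+ count x A ℕ.+ ⟨ A , B ⟩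
    expand A B = trans (cong₂ ℕ._+_ (cong (ℕ._+ count x B) (ind-yes refl)) (⟨⟩-∷ʳ A x B))
                       (sym (ℕ.+-assoc (1 ℕ.+ count x B) (count x A) ⟨ A , B ⟩))
    distribute : ∀ a b c → 2 ℕ.* (1 ℕ.+ b ℕ.+ a ℕ.+ c) ≡ 2 ℕ.+ 2 ℕ.* a ℕ.+ 2 ℕ.* b ℕ.+ 2 ℕ.* c
    distribute = solve-∀
    regroup : ∀ a b c d → 2 ℕ.+ 2 ℕ.* a ℕ.+ 2 ℕ.* b ℕ.+ (c ℕ.+ d) ≡
                          (1 ℕ.+ a ℕ.+ a ℕ.+ c) ℕ.+ (1 ℕ.+ b ℕ.+ b ℕ.+ d)
    regroup = solve-∀

  -- A weight on one side is a repetition of the list: this is `am-gm` for `X ++ X`.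
  am-gm-4 : ∀ X Z → 4 ℕ.* ⟨ X , Z ⟩ ℕ.≤ 4 ℕ.* ∥ X ∥² ℕ.+ ∥ Z ∥²
  am-gm-4 X Z = begin
    4 ℕ.* ⟨ X , Z ⟩                         ≡⟨ double ⟨ X , Z ⟩ ⟩
    2 ℕ.* (⟨ X , Z ⟩ ℕ.+ ⟨ X , Z ⟩)         ≡⟨ cong (2 ℕ.*_) (⟨⟩-++ˡ X X Z) ⟨
    2 ℕ.* ⟨ X ++ X , Z ⟩                    ≤⟨ am-gm (X ++ X) Z ⟩
    ∥ X ++ X ∥² ℕ.+ ∥ Z ∥²                  ≡⟨ cong (ℕ._+ ∥ Z ∥²) (trans (∥∥²-++ X X) (quadruple ∥ X ∥²)) ⟩
    4 ℕ.* ∥ X ∥² ℕ.+ ∥ Z ∥²                 ∎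
    where
    open ℕ.≤-Reasoning
    double : ∀ a → 4 ℕ.* a ≡ 2 ℕ.* (a ℕ.+ a)
    double = solve-∀
    quadruple : ∀ a → a ℕ.+ 2 ℕ.* a ℕ.+ a ≡ 4 ℕ.* a
    quadruple = solve-∀

  repeat : ℕ → List Y → List Y
  repeat zero    X = []
  repeat (suc k) X = X ++ repeat k X

  ⟨⟩-repeatˡ : ∀ k X Z → ⟨ repeat k X , Z ⟩ ≡ k ℕ.* ⟨ X , Z ⟩
  ⟨⟩-repeatˡ zero    X Z = refl
  ⟨⟩-repeatˡ (suc k) X Z = trans (⟨⟩-++ˡ X _ Z) (cong (⟨ X , Z ⟩ ℕ.+_) (⟨⟩-repeatˡ k X Z))

  ⟨⟩-repeat : ∀ k l X Z → ⟨ repeat k X , repeat l Z ⟩ ≡ k ℕ.* (l ℕ.* ⟨ X , Z ⟩)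
  ⟨⟩-repeat k l X Z = trans (⟨⟩-repeatˡ k X _) (cong (k ℕ.*_)
    (trans (⟨⟩-sym X _) (trans (⟨⟩-repeatˡ l Z X) (cong (l ℕ.*_) (⟨⟩-sym Z X)))))

  -- X has ℓ²-norm at most √(p / q) times its ℓ¹-norm.
  Spread : ℕ → ℕ → List Y → Set
  Spread p q X = q ℕ.* ∥ X ∥² ℕ.≤ p ℕ.* (length X ℕ.* length X)

  -- The triangle inequality for the ℓ²-norm, while the ℓ¹-norm is additive. Empty lists are split
  -- off because `cross` divides by both lengths.
  spread-++ : ∀ p q X Z → Spread p q X → Spread p q Z → Spread p q (X ++ Z)
  spread-++ p q []      Z         _  hZ = hZ
  spread-++ p q X       []        hX _  = subst (Spread p q) (sym (List.++-identityʳ X)) hX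
  spread-++ p q X@(_ ∷ X′) Z@(_ ∷ Z′) hX hZ = begin
    q ℕ.* ∥ X ++ Z ∥²                                       ≡⟨ cong (q ℕ.*_) (∥∥²-++ X Z) ⟩
    q ℕ.* (∥ X ∥² ℕ.+ 2 ℕ.* ⟨ X , Z ⟩ ℕ.+ ∥ Z ∥²)           ≡⟨ distribute q ∥ X ∥² ⟨ X , Z ⟩ ∥ Z ∥² ⟩
    q ℕ.* ∥ X ∥² ℕ.+ 2 ℕ.* (q ℕ.* ⟨ X , Z ⟩) ℕ.+ q ℕ.* ∥ Z ∥²
      ≤⟨ ℕ.+-mono-≤ (ℕ.+-mono-≤ hX (ℕ.*-monoʳ-≤ 2 cross)) hZ ⟩
    p ℕ.* (x ℕ.* x) ℕ.+ 2 ℕ.* (p ℕ.* (x ℕ.* z)) ℕ.+ p ℕ.* (z ℕ.* z)  ≡⟨ square p x z ⟩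
    p ℕ.* ((x ℕ.+ z) ℕ.* (x ℕ.+ z))                         ≡⟨ cong (λ l → p ℕ.* (l ℕ.* l)) (List.length-++ X) ⟨
    p ℕ.* (length (X ++ Z) ℕ.* length (X ++ Z))             ∎
    where
    open ℕ.≤-Reasoning
    x = length X
    z = length Z
    distribute : ∀ q a b c → q ℕ.* (a ℕ.+ 2 ℕ.* b ℕ.+ c) ≡ q ℕ.* a ℕ.+ 2 ℕ.* (q ℕ.* b) ℕ.+ q ℕ.* c
    distribute = solve-∀
    square : ∀ p x z → p ℕ.* (x ℕ.* x) ℕ.+ 2 ℕ.* (p ℕ.* (x ℕ.* z)) ℕ.+ p ℕ.* (z ℕ.* z) ≡
                       p ℕ.* ((x ℕ.+ z) ℕ.* (x ℕ.+ z))
    square = solve-∀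
    pull : ∀ q x z c → (2 ℕ.* (x ℕ.* z)) ℕ.* (q ℕ.* c) ≡ q ℕ.* (2 ℕ.* (z ℕ.* (x ℕ.* c)))
    pull = solve-∀
    split : ∀ q x z a b → q ℕ.* (z ℕ.* (z ℕ.* a) ℕ.+ x ℕ.* (x ℕ.* b)) ≡
                          (z ℕ.* z) ℕ.* (q ℕ.* a) ℕ.+ (x ℕ.* x) ℕ.* (q ℕ.* b)
    split = solve-∀
    join : ∀ p x z → (z ℕ.* z) ℕ.* (p ℕ.* (x ℕ.* x)) ℕ.+ (x ℕ.* x) ℕ.* (p ℕ.* (z ℕ.* z)) ≡
                     (2 ℕ.* (x ℕ.* z)) ℕ.* (p ℕ.* (x ℕ.* z))
    join = solve-∀
    -- Cauchy-Schwarz from AM-GM: repeating each list as often as the other is long gives both the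
    -- ℓ¹-norm `x * z`, and at equal size AM-GM loses nothing against the bounds `hX` and `hZ`.
    cross : q ℕ.* ⟨ X , Z ⟩ ℕ.≤ p ℕ.* (x ℕ.* z)
    cross = ℕ.*-cancelˡ-≤ (2 ℕ.* (x ℕ.* z)) (begin
      (2 ℕ.* (x ℕ.* z)) ℕ.* (q ℕ.* ⟨ X , Z ⟩)         ≡⟨ pull q x z ⟨ X , Z ⟩ ⟩
      q ℕ.* (2 ℕ.* (z ℕ.* (x ℕ.* ⟨ X , Z ⟩)))         ≡⟨ cong (λ s → q ℕ.* (2 ℕ.* s)) (⟨⟩-repeat z x X Z) ⟨
      q ℕ.* (2 ℕ.* ⟨ repeat z X , repeat x Z ⟩)        ≤⟨ ℕ.*-monoʳ-≤ q (am-gm (repeat z X) (repeat x Z)) ⟩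
      q ℕ.* (∥ repeat z X ∥² ℕ.+ ∥ repeat x Z ∥²)      ≡⟨ cong (q ℕ.*_) (cong₂ ℕ._+_ (⟨⟩-repeat z z X X) (⟨⟩-repeat x x Z Z)) ⟩
      q ℕ.* (z ℕ.* (z ℕ.* ∥ X ∥²) ℕ.+ x ℕ.* (x ℕ.* ∥ Z ∥²)) ≡⟨ split q x z ∥ X ∥² ∥ Z ∥² ⟩
      (z ℕ.* z) ℕ.* (q ℕ.* ∥ X ∥²) ℕ.+ (x ℕ.* x) ℕ.* (q ℕ.* ∥ Z ∥²)
        ≤⟨ ℕ.+-mono-≤ (ℕ.*-monoʳ-≤ (z ℕ.* z) hX) (ℕ.*-monoʳ-≤ (x ℕ.* x) hZ) ⟩
      (z ℕ.* z) ℕ.* (p ℕ.* (x ℕ.* x)) ℕ.+ (x ℕ.* x) ℕ.* (p ℕ.* (z ℕ.* z)) ≡⟨ join p x z ⟩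
      (2 ℕ.* (x ℕ.* z)) ℕ.* (p ℕ.* (x ℕ.* z)) ∎)

  spread-concatMap : ∀ {A : Set} p q (f : A → List Y) as → (∀ a → Spread p q (f a)) → Spread p q (concatMap f as)
  spread-concatMap p q f []       h rewrite ℕ.*-zeroʳ q = z≤n
  spread-concatMap p q f (a ∷ as) h = spread-++ p q (f a) _ (h a) (spread-concatMap p q f as h)

  -- The convolution of X with the counting measure on Γ.
  spreadBy : List (Y → Y) → List Y → List Y
  spreadBy Γ X = concatMap (λ γ → map γ X) Γ

  length-spreadBy : ∀ Γ X → length (spreadBy Γ X) ≡ length Γ ℕ.* length X
  length-spreadBy []      X = refl
  length-spreadBy (γ ∷ Γ) X = trans (List.length-++ (map γ X))
    (cong₂ ℕ._+_ (List.length-map γ X) (length-spreadBy Γ X))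

  AllInjective : List (Y → Y) → Set
  AllInjective = All (Injective _≡_ _≡_)

  -- Injections are isometries of the ℓ²-norm, so AM-GM bounds each of the `length Γ * length Γ′`
  -- pairs by `∥ X ∥²`.
  ⟨spreadBy⟩ : ∀ {Γ Γ′} X → AllInjective Γ → AllInjective Γ′ →
               ⟨ spreadBy Γ X , spreadBy Γ′ X ⟩ ℕ.≤ length Γ ℕ.* length Γ′ ℕ.* ∥ X ∥²
  ⟨spreadBy⟩ X [] inj′ = z≤n
  ⟨spreadBy⟩ {γ ∷ Γ} {Γ′} X (inj ∷ injs) injs′ = begin
    ⟨ map γ X ++ spreadBy Γ X , spreadBy Γ′ X ⟩ ≡⟨ ⟨⟩-++ˡ (map γ X) _ _ ⟩
    ⟨ map γ X , spreadBy Γ′ X ⟩ ℕ.+ ⟨ spreadBy Γ X , spreadBy Γ′ X ⟩ ≤⟨ ℕ.+-mono-≤ (row injs′) (⟨spreadBy⟩ X injs injs′) ⟩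
    length Γ′ ℕ.* ∥ X ∥² ℕ.+ length Γ ℕ.* length Γ′ ℕ.* ∥ X ∥² ≡⟨ ℕ.*-distribʳ-+ ∥ X ∥² (length Γ′) _ ⟨
    (suc (length Γ) ℕ.* length Γ′) ℕ.* ∥ X ∥² ∎
    where
    open ℕ.≤-Reasoning
    row : ∀ {Δ} → AllInjective Δ → ⟨ map γ X , spreadBy Δ X ⟩ ℕ.≤ length Δ ℕ.* ∥ X ∥²
    row []           = ℕ.≤-reflexive (⟨⟩-[]ʳ (map γ X))
    row {δ ∷ Δ} (injδ ∷ injΔ) = begin
      ⟨ map γ X , map δ X ++ spreadBy Δ X ⟩ ≡⟨ ⟨⟩-++ʳ (map γ X) (map δ X) _ ⟩
      ⟨ map γ X , map δ X ⟩ ℕ.+ ⟨ map γ X , spreadBy Δ X ⟩ ≤⟨ ℕ.+-mono-≤ pair (row injΔ) ⟩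
      ∥ X ∥² ℕ.+ length Δ ℕ.* ∥ X ∥² ∎
      where
      pair : ⟨ map γ X , map δ X ⟩ ℕ.≤ ∥ X ∥²
      pair = ℕ.*-cancelˡ-≤ 2 (begin
        2 ℕ.* ⟨ map γ X , map δ X ⟩        ≤⟨ am-gm (map γ X) (map δ X) ⟩
        ∥ map γ X ∥² ℕ.+ ∥ map δ X ∥²      ≡⟨ cong₂ ℕ._+_ (⟨⟩-map inj X X) (⟨⟩-map injδ X X) ⟩
        ∥ X ∥² ℕ.+ ∥ X ∥²                  ≡⟨ cong (∥ X ∥² ℕ.+_) (ℕ.+-identityʳ ∥ X ∥²) ⟨
        2 ℕ.* ∥ X ∥²                       ∎)

  -- Every further pair of injections contributes at most ∥ X ∥², so the gain of ∥ X ∥² / 2 survives.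
  contraction-extends : ∀ Γ₃ Γ X → length Γ₃ ≡ 3 → AllInjective Γ₃ → AllInjective Γ →
    2 ℕ.* ∥ spreadBy Γ₃ X ∥² ℕ.≤ 17 ℕ.* ∥ X ∥² →
    2 ℕ.* ∥ spreadBy (Γ₃ ++ Γ) X ∥² ℕ.+ ∥ X ∥² ℕ.≤ 2 ℕ.* (length (Γ₃ ++ Γ) ℕ.* length (Γ₃ ++ Γ)) ℕ.* ∥ X ∥²
  contraction-extends Γ₃ Γ X len₃ inj₃ inj h = begin
    2 ℕ.* ∥ spreadBy (Γ₃ ++ Γ) X ∥² ℕ.+ ∥ X ∥²
      ≡⟨ cong (λ Z → 2 ℕ.* ∥ Z ∥² ℕ.+ ∥ X ∥²) (List.concatMap-++ (λ γ → map γ X) Γ₃ Γ) ⟩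
    2 ℕ.* ∥ spreadBy Γ₃ X ++ spreadBy Γ X ∥² ℕ.+ ∥ X ∥²
      ≡⟨ cong (λ s → 2 ℕ.* s ℕ.+ ∥ X ∥²) (∥∥²-++ (spreadBy Γ₃ X) (spreadBy Γ X)) ⟩
    2 ℕ.* (∥ spreadBy Γ₃ X ∥² ℕ.+ 2 ℕ.* ⟨ spreadBy Γ₃ X , spreadBy Γ X ⟩ ℕ.+ ∥ spreadBy Γ X ∥²) ℕ.+ ∥ X ∥²
      ≡⟨ distribute ∥ spreadBy Γ₃ X ∥² ⟨ spreadBy Γ₃ X , spreadBy Γ X ⟩ ∥ spreadBy Γ X ∥² ∥ X ∥² ⟩
    2 ℕ.* ∥ spreadBy Γ₃ X ∥² ℕ.+ (4 ℕ.* ⟨ spreadBy Γ₃ X , spreadBy Γ X ⟩ ℕ.+ 2 ℕ.* ∥ spreadBy Γ X ∥²) ℕ.+ ∥ X ∥²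
      ≤⟨ ℕ.+-monoˡ-≤ ∥ X ∥² (ℕ.+-mono-≤ h (ℕ.+-mono-≤
           (ℕ.*-monoʳ-≤ 4 (subst (λ l → ⟨ spreadBy Γ₃ X , spreadBy Γ X ⟩ ℕ.≤ l ℕ.* length Γ ℕ.* ∥ X ∥²) len₃ (⟨spreadBy⟩ X inj₃ inj)))
           (ℕ.*-monoʳ-≤ 2 (⟨spreadBy⟩ X inj inj)))) ⟩
    17 ℕ.* ∥ X ∥² ℕ.+ (4 ℕ.* (3 ℕ.* length Γ ℕ.* ∥ X ∥²) ℕ.+ 2 ℕ.* (length Γ ℕ.* length Γ ℕ.* ∥ X ∥²)) ℕ.+ ∥ X ∥²
      ≡⟨ collect (length Γ) ∥ X ∥² ⟩
    2 ℕ.* ((3 ℕ.+ length Γ) ℕ.* (3 ℕ.+ length Γ)) ℕ.* ∥ X ∥²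
      ≡⟨ cong (λ l → 2 ℕ.* (l ℕ.* l) ℕ.* ∥ X ∥²) (trans (List.length-++ Γ₃) (cong (ℕ._+ length Γ) len₃)) ⟨
    2 ℕ.* (length (Γ₃ ++ Γ) ℕ.* length (Γ₃ ++ Γ)) ℕ.* ∥ X ∥² ∎
    where
    open ℕ.≤-Reasoning
    distribute : ∀ a b c d → 2 ℕ.* (a ℕ.+ 2 ℕ.* b ℕ.+ c) ℕ.+ d ≡ 2 ℕ.* a ℕ.+ (4 ℕ.* b ℕ.+ 2 ℕ.* c) ℕ.+ d
    distribute = solve-∀
    collect : ∀ l n → 17 ℕ.* n ℕ.+ (4 ℕ.* (3 ℕ.* l ℕ.* n) ℕ.+ 2 ℕ.* (l ℕ.* l ℕ.* n)) ℕ.+ n ≡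
                      2 ℕ.* ((3 ℕ.+ l) ℕ.* (3 ℕ.+ l)) ℕ.* n
    collect = solve-∀

module _ {A : Set} {P Q : Pred A 0ℓ} (P? : Decidable P) (Q? : Decidable Q) where

  filter-filter-¬ : (∀ {x} → P x → ¬ Q x) → ∀ xs → filter P? (filter (¬? ∘ Q?) xs) ≡ filter P? xs
  filter-filter-¬ P⇒¬Q []       = refl
  filter-filter-¬ P⇒¬Q (x ∷ xs) with Q? x
  filter-filter-¬ P⇒¬Q (x ∷ xs) | no _  with P? x
  ... | yes _ = cong (x ∷_) (filter-filter-¬ P⇒¬Q xs)
  ... | no _  = filter-filter-¬ P⇒¬Q xs
  filter-filter-¬ P⇒¬Q (x ∷ xs) | yes q with P? x
  ... | yes p = contradiction q (P⇒¬Q p)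
  ... | no _  = filter-filter-¬ P⇒¬Q xs

module _ {A : Set} {P : Pred A 0ℓ} (P? : Decidable P) where

  partition-↭ : ∀ xs → xs ↭ filter P? xs ++ filter (¬? ∘ P?) xs
  partition-↭ []       = ↭-refl
  partition-↭ (x ∷ xs) with P? x
  ... | yes _ = ↭-prep x (partition-↭ xs)
  ... | no _  = ↭-trans (↭-prep x (partition-↭ xs)) (↭-sym (↭.shift x (filter P? xs) _))

-- The Cayley tree of F₂

Letter : Set
Letter = Fin 2 × Sign

inv : Letter → Letter
inv (x , ±) = x , opposite ±

inv-involutive : ∀ s → inv (inv s) ≡ s
inv-involutive (x , ±) = cong (x ,_) (Sign.opposite-selfInverse refl)

_≟ˢ_ : DecidableEquality Letter
_≟ˢ_ = Product.≡-dec Fin._≟_ Sign._≟_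

Reduced : List Letter → Set
Reduced []          = ⊤
Reduced (s ∷ [])    = ⊤
Reduced (s ∷ t ∷ w) = t ≢ inv s × Reduced (t ∷ w)

reduced? : ∀ w → Dec (Reduced w)
reduced? []          = yes tt
reduced? (s ∷ [])    = yes tt
reduced? (s ∷ t ∷ w) = ¬? (t ≟ˢ inv s) ×-dec reduced? (t ∷ w)

reduced-tail : ∀ s w → Reduced (s ∷ w) → Reduced w
reduced-tail s []      _       = tt
reduced-tail s (t ∷ w) (_ , r) = r

push : Letter → List Letter → List Letter
push s []      = s ∷ []
push s (t ∷ w) with t ≟ˢ inv s
... | yes _ = w
... | no _  = s ∷ t ∷ w

push-cancels : ∀ s {t} w → t ≡ inv s → push s (t ∷ w) ≡ w
push-cancels s {t} w eq with t ≟ˢ inv s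
... | yes _ = refl
... | no ≢  = contradiction eq ≢

push-extends : ∀ s {t} w → t ≢ inv s → push s (t ∷ w) ≡ s ∷ t ∷ w
push-extends s {t} w ≢ with t ≟ˢ inv s
... | yes eq = contradiction eq ≢
... | no _   = refl

push-reduced : ∀ s w → Reduced w → Reduced (push s w)
push-reduced s []      _ = tt
push-reduced s (t ∷ w) r with t ≟ˢ inv s
... | yes _ = reduced-tail t w r
... | no ≢  = ≢ , r

push-inv : ∀ s w → Reduced w → push (inv s) (push s w) ≡ w
push-inv s []      _ = push-cancels (inv s) [] (sym (inv-involutive s))
push-inv s (t ∷ w) r with t ≟ˢ inv s
... | no _ = push-cancels (inv s) (t ∷ w) (sym (inv-involutive s))
push-inv s (t ∷ [])    r       | yes refl = refl
-- Here `t` is `inv s`; reducedness of the original word keeps `u` from cancelling against the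
-- returning letter.
push-inv s (t ∷ u ∷ w) (≢ , _) | yes refl = push-extends (inv s) w ≢

-- With the proof irrelevant, words are equal as soon as their letters are. This gives the decidable
-- equality that `Collision` requires.
record ReducedWord : Set where
  constructor reducedWord
  field
    letters  : List Letter
    .reduced : Reduced letters

open ReducedWord

reducedWord-≡ : ∀ {y z} → letters y ≡ letters z → y ≡ z
reducedWord-≡ refl = refl

_≟ʷ_ : DecidableEquality ReducedWord
y ≟ʷ z = map′ reducedWord-≡ (cong letters) (List.≡-dec _≟ˢ_ (letters y) (letters z))

step : Letter → ReducedWord → ReducedWord
step s (reducedWord w r) = reducedWord (push s w) (push-reduced s w r)

step-inv : ∀ s y → step (inv s) (step s y) ≡ y
step-inv s (reducedWord w r) = reducedWord-≡ (push-inv s w (recompute (reduced? w) r))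

step-injective : ∀ s → Injective _≡_ _≡_ (step s)
step-injective s {y} {z} eq = trans (sym (step-inv s y)) (trans (cong (step (inv s)) eq) (step-inv s z))

module F = Group F₂

-- Equality in `F₂` is homotopy of edge paths, with no normal form at hand. Left multiplication on
-- reduced words (van der Waerden's trick) provides an invariant with decidable equality, the value
-- at `origin`; `act-cong` is its well-definedness.
act : F.Carrier → ReducedWord → ReducedWord
act ε       y = y
act (s ◅ γ) y = step s (act γ y)

act-◅◅ : ∀ γ δ y → act (γ ◅◅ δ) y ≡ act γ (act δ y)
act-◅◅ ε       δ y = refl
act-◅◅ (s ◅ γ) δ y = cong (step s) (act-◅◅ γ δ y)

act-cong : ∀ {γ δ} → γ F.≈ δ → ∀ y → act γ y ≡ act δ y
act-cong EdgePath.≃-refl        y = refl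
act-cong (EdgePath.≃-sym e)     y = sym (act-cong e y)
act-cong (EdgePath.≃-trans e f) y = trans (act-cong e y) (act-cong f y)
act-cong (EdgePath.≃-cong {γ = γ} {γ′} {δ} {δ′} e f) y = begin
  act (γ ◅◅ δ) y     ≡⟨ act-◅◅ γ δ y ⟩
  act γ (act δ y)    ≡⟨ act-cong e (act δ y) ⟩
  act γ′ (act δ y)   ≡⟨ cong (act γ′) (act-cong f y) ⟩
  act γ′ (act δ′ y)  ≡⟨ act-◅◅ γ′ δ′ y ⟨
  act (γ′ ◅◅ δ′) y   ∎
  where open ≡-Reasoning
act-cong (EdgePath.cancel s)    y =
  trans (cong (λ t → step t (step (inv s) y)) (sym (inv-involutive s))) (step-inv (inv s) y)

act-injective : ∀ γ → Injective _≡_ _≡_ (act γ)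
act-injective ε       eq = eq
act-injective (s ◅ γ) eq = act-injective γ (step-injective s eq)

open Collision _≟ʷ_

first : ReducedWord → Maybe Letter
first y = List.head (letters y)

_≟ᶠ_ : DecidableEquality (Maybe Letter)
_≟ᶠ_ = Maybe.≡-dec _≟ˢ_

first? : ∀ s → Decidable (λ y → first y ≡ just s)
first? s y = first y ≟ᶠ just s

startingWith avoiding : Letter → List ReducedWord → List ReducedWord
startingWith s = filter (first? s)
avoiding s     = filter (¬? ∘ first? s)

first-step-extends : ∀ s y → first y ≢ just (inv s) → first (step s y) ≡ just s
first-step-extends s (reducedWord []      _) _ = refl
first-step-extends s (reducedWord (t ∷ w) _) ≢ = cong List.head (push-extends s w (≢ ∘ cong just))

-- In a reduced word the letter after `inv s` is not `s`, so cancellation cannot expose an `s`. This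
-- and the preceding lemma decide which endpoint of an edge is farther from the root.
first-step-cancels : ∀ s y → first y ≡ just (inv s) → first (step s y) ≢ just s
first-step-cancels s (reducedWord (t ∷ w) r) refl eq
  with w | recompute (reduced? (t ∷ w)) r | trans (sym (cong List.head (push-cancels s w refl))) eq
... | u ∷ _ | ≢ , _ | refl = ≢ (sym (inv-involutive s))

∥startingWith∥² : ∀ s X → ⟨ startingWith s X , X ⟩ ≡ ∥ startingWith s X ∥²
∥startingWith∥² s X = begin
  ⟨ startingWith s X , X ⟩ ≡⟨ ⟨⟩-↭ʳ (startingWith s X) (partition-↭ (first? s) X) ⟩
  ⟨ startingWith s X , startingWith s X ++ avoiding s X ⟩ ≡⟨ ⟨⟩-++ʳ (startingWith s X) (startingWith s X) (avoiding s X) ⟩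
  ∥ startingWith s X ∥² ℕ.+ ⟨ startingWith s X , avoiding s X ⟩
    ≡⟨ cong (∥ startingWith s X ∥² ℕ.+_) (⟨⟩-disjoint (startingWith s X) λ x∈ x∈′ →
         proj₂ (∈-filter⁻ (¬? ∘ first? s) {xs = X} x∈′) (proj₂ (∈-filter⁻ (first? s) {xs = X} x∈))) ⟩
  ∥ startingWith s X ∥² ℕ.+ 0 ≡⟨ ℕ.+-identityʳ _ ⟩
  ∥ startingWith s X ∥² ∎
  where open ≡-Reasoning

∥∥²-split : ∀ s X → ∥ X ∥² ≡ ∥ startingWith s X ∥² ℕ.+ ∥ avoiding s X ∥²
∥∥²-split s X = begin
  ∥ X ∥²                                               ≡⟨ ∥∥²-↭ (partition-↭ (first? s) X) ⟩
  ∥ startingWith s X ++ avoiding s X ∥²                ≡⟨ ∥∥²-++ (startingWith s X) (avoiding s X) ⟩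
  ∥ startingWith s X ∥² ℕ.+ 2 ℕ.* ⟨ startingWith s X , avoiding s X ⟩ ℕ.+ ∥ avoiding s X ∥²
    ≡⟨ cong (λ k → ∥ startingWith s X ∥² ℕ.+ 2 ℕ.* k ℕ.+ ∥ avoiding s X ∥²) (⟨⟩-disjoint (startingWith s X) λ x∈ x∈′ →
         proj₂ (∈-filter⁻ (¬? ∘ first? s) {xs = X} x∈′) (proj₂ (∈-filter⁻ (first? s) {xs = X} x∈))) ⟩
  ∥ startingWith s X ∥² ℕ.+ 0 ℕ.+ ∥ avoiding s X ∥²
    ≡⟨ cong (ℕ._+ ∥ avoiding s X ∥²) (ℕ.+-identityʳ ∥ startingWith s X ∥²) ⟩
  ∥ startingWith s X ∥² ℕ.+ ∥ avoiding s X ∥²          ∎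
  where open ≡-Reasoning

sum-startingWith : List Letter → List ReducedWord → List ReducedWord → ℕ
sum-startingWith []       X Z = 0
sum-startingWith (s ∷ ss) X Z = ⟨ startingWith s X , Z ⟩ ℕ.+ sum-startingWith ss X Z

-- The classes of words by first letter are disjoint: deleting one class leaves the others intact.
sum-startingWith-≤ : ∀ {ss} → UniqueL ss → ∀ X Z → sum-startingWith ss X Z ℕ.≤ ⟨ X , Z ⟩
sum-startingWith-≤ []           X Z = z≤n
sum-startingWith-≤ {s ∷ ss} (s∉ss ∷ uniq) X Z = begin
  ⟨ startingWith s X , Z ⟩ ℕ.+ sum-startingWith ss X Z
    ≡⟨ cong (⟨ startingWith s X , Z ⟩ ℕ.+_) (restrict s∉ss) ⟨
  ⟨ startingWith s X , Z ⟩ ℕ.+ sum-startingWith ss (avoiding s X) Z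
    ≤⟨ ℕ.+-monoʳ-≤ ⟨ startingWith s X , Z ⟩ (sum-startingWith-≤ uniq (avoiding s X) Z) ⟩
  ⟨ startingWith s X , Z ⟩ ℕ.+ ⟨ avoiding s X , Z ⟩
    ≡⟨ ⟨⟩-++ˡ (startingWith s X) (avoiding s X) Z ⟨
  ⟨ startingWith s X ++ avoiding s X , Z ⟩
    ≡⟨ ⟨⟩-↭ˡ (partition-↭ (first? s) X) Z ⟨
  ⟨ X , Z ⟩ ∎
  where
  open ℕ.≤-Reasoning
  restrict : ∀ {ts} → All (s ≢_) ts → sum-startingWith ts (avoiding s X) Z ≡ sum-startingWith ts X Z
  restrict []                   = refl
  restrict {t ∷ ts} (s≢t ∷ s∉ts) = cong₂ ℕ._+_
    (cong ⟨_, Z ⟩ (filter-filter-¬ (first? t) (first? s)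
      (λ y-t y-s → s≢t (Maybe.just-injective (trans (sym y-s) y-t))) X))
    (restrict s∉ts)

-- Weighted AM-GM along the edges between y and step s y, the endpoint
-- farther from the root having the weight 4.
edge-bound : ∀ s X → 4 ℕ.* ⟨ X , map (step s) X ⟩ ℕ.≤
             2 ℕ.* ∥ X ∥² ℕ.+ 3 ℕ.* (∥ startingWith s X ∥² ℕ.+ ∥ startingWith (inv s) X ∥²)
-- Adding the two norms `n s` and `n s̄` to both sides completes the `avoiding` terms to `∥ X ∥²`,
-- in place of a subtraction.
edge-bound s X = ℕ.+-cancelʳ-≤ (n s ℕ.+ n s̄) _ _ (begin
  4 ℕ.* ⟨ X , map (step s) X ⟩ ℕ.+ (n s ℕ.+ n s̄)
    ≡⟨ cong (λ k → 4 ℕ.* k ℕ.+ (n s ℕ.+ n s̄)) split-edges ⟩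
  4 ℕ.* (⟨ startingWith s X , outward ⟩ ℕ.+ ⟨ inward , avoiding s X ⟩) ℕ.+ (n s ℕ.+ n s̄)
    ≡⟨ distribute ⟨ startingWith s X , outward ⟩ ⟨ inward , avoiding s X ⟩ (n s ℕ.+ n s̄) ⟩
  4 ℕ.* ⟨ startingWith s X , outward ⟩ ℕ.+ 4 ℕ.* ⟨ inward , avoiding s X ⟩ ℕ.+ (n s ℕ.+ n s̄)
    ≤⟨ ℕ.+-monoˡ-≤ (n s ℕ.+ n s̄) (ℕ.+-mono-≤ (am-gm-4 (startingWith s X) outward) (am-gm-4 inward (avoiding s X))) ⟩
  4 ℕ.* n s ℕ.+ ∥ outward ∥² ℕ.+ (4 ℕ.* ∥ inward ∥² ℕ.+ ∥ avoiding s X ∥²) ℕ.+ (n s ℕ.+ n s̄)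
    ≡⟨ cong₂ (λ k l → 4 ℕ.* n s ℕ.+ k ℕ.+ (4 ℕ.* l ℕ.+ ∥ avoiding s X ∥²) ℕ.+ (n s ℕ.+ n s̄))
         (⟨⟩-map (step-injective s) (avoiding s̄ X) (avoiding s̄ X))
         (⟨⟩-map (step-injective s) (startingWith s̄ X) (startingWith s̄ X)) ⟩
  4 ℕ.* n s ℕ.+ ∥ avoiding s̄ X ∥² ℕ.+ (4 ℕ.* n s̄ ℕ.+ ∥ avoiding s X ∥²) ℕ.+ (n s ℕ.+ n s̄)
    ≡⟨ regroup (n s) (n s̄) ∥ avoiding s X ∥² ∥ avoiding s̄ X ∥² ⟩
  (n s ℕ.+ ∥ avoiding s X ∥²) ℕ.+ (n s̄ ℕ.+ ∥ avoiding s̄ X ∥²) ℕ.+ 3 ℕ.* (n s ℕ.+ n s̄) ℕ.+ (n s ℕ.+ n s̄)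
    ≡⟨ cong₂ (λ k l → k ℕ.+ l ℕ.+ 3 ℕ.* (n s ℕ.+ n s̄) ℕ.+ (n s ℕ.+ n s̄)) (∥∥²-split s X) (∥∥²-split s̄ X) ⟨
  ∥ X ∥² ℕ.+ ∥ X ∥² ℕ.+ 3 ℕ.* (n s ℕ.+ n s̄) ℕ.+ (n s ℕ.+ n s̄)
    ≡⟨ cong (λ k → ∥ X ∥² ℕ.+ k ℕ.+ 3 ℕ.* (n s ℕ.+ n s̄) ℕ.+ (n s ℕ.+ n s̄)) (ℕ.+-identityʳ ∥ X ∥²) ⟨
  2 ℕ.* ∥ X ∥² ℕ.+ 3 ℕ.* (n s ℕ.+ n s̄) ℕ.+ (n s ℕ.+ n s̄) ∎)
  where
  open ℕ.≤-Reasoning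
  s̄ = inv s
  n : Letter → ℕ
  n t = ∥ startingWith t X ∥²
  outward inward : List ReducedWord
  outward = map (step s) (avoiding s̄ X)
  inward  = map (step s) (startingWith s̄ X)
  distribute : ∀ a b c → 4 ℕ.* (a ℕ.+ b) ℕ.+ c ≡ 4 ℕ.* a ℕ.+ 4 ℕ.* b ℕ.+ c
  distribute = solve-∀
  regroup : ∀ a b c d → 4 ℕ.* a ℕ.+ d ℕ.+ (4 ℕ.* b ℕ.+ c) ℕ.+ (a ℕ.+ b) ≡
                        (a ℕ.+ c) ℕ.+ (b ℕ.+ d) ℕ.+ 3 ℕ.* (a ℕ.+ b) ℕ.+ (a ℕ.+ b)
  regroup = solve-∀

  outward-first : ∀ {y} → y ∈ˡ outward → first y ≡ just s
  outward-first y∈ with z , z∈ , refl ← ∈-map⁻ (step s) y∈ =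
    first-step-extends s z (proj₂ (∈-filter⁻ (¬? ∘ first? s̄) {xs = X} z∈))

  inward-first : ∀ {y} → y ∈ˡ inward → first y ≢ just s
  inward-first y∈ with z , z∈ , refl ← ∈-map⁻ (step s) y∈ =
    first-step-cancels s z (proj₂ (∈-filter⁻ (first? s̄) {xs = X} z∈))

  split-edges : ⟨ X , map (step s) X ⟩ ≡ ⟨ startingWith s X , outward ⟩ ℕ.+ ⟨ inward , avoiding s X ⟩
  split-edges = begin-equality
    ⟨ X , map (step s) X ⟩
      ≡⟨ ⟨⟩-↭ʳ X (↭.map⁺ (step s) (partition-↭ (first? s̄) X)) ⟩
    ⟨ X , map (step s) (startingWith s̄ X ++ avoiding s̄ X) ⟩
      ≡⟨ cong ⟨ X ,_⟩ (List.map-++ (step s) (startingWith s̄ X) (avoiding s̄ X)) ⟩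
    ⟨ X , inward ++ outward ⟩
      ≡⟨ ⟨⟩-↭ˡ (partition-↭ (first? s) X) (inward ++ outward) ⟩
    ⟨ startingWith s X ++ avoiding s X , inward ++ outward ⟩
      ≡⟨ ⟨⟩-++ˡ (startingWith s X) (avoiding s X) (inward ++ outward) ⟩
    ⟨ startingWith s X , inward ++ outward ⟩ ℕ.+ ⟨ avoiding s X , inward ++ outward ⟩
      ≡⟨ cong₂ ℕ._+_ (⟨⟩-++ʳ (startingWith s X) inward outward) (⟨⟩-++ʳ (avoiding s X) inward outward) ⟩
    ⟨ startingWith s X , inward ⟩ ℕ.+ ⟨ startingWith s X , outward ⟩ ℕ.+
      (⟨ avoiding s X , inward ⟩ ℕ.+ ⟨ avoiding s X , outward ⟩)
      ≡⟨ cong₂ (λ k l → k ℕ.+ ⟨ startingWith s X , outward ⟩ ℕ.+ (⟨ avoiding s X , inward ⟩ ℕ.+ l))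
           (⟨⟩-disjoint (startingWith s X) λ x∈ x∈′ → inward-first x∈′ (proj₂ (∈-filter⁻ (first? s) {xs = X} x∈)))
           (⟨⟩-disjoint (avoiding s X) λ x∈ x∈′ → proj₂ (∈-filter⁻ (¬? ∘ first? s) {xs = X} x∈) (outward-first x∈′)) ⟩
    ⟨ startingWith s X , outward ⟩ ℕ.+ (⟨ avoiding s X , inward ⟩ ℕ.+ 0)
      ≡⟨ cong (⟨ startingWith s X , outward ⟩ ℕ.+_)
           (trans (ℕ.+-identityʳ _) (⟨⟩-sym (avoiding s X) inward)) ⟩
    ⟨ startingWith s X , outward ⟩ ℕ.+ ⟨ inward , avoiding s X ⟩ ∎

a b : Letter
a = Fin.zero , Sign.+
b = Fin.suc Fin.zero , Sign.+

-- The trivial bound is 18 = 2 · 3². A nonempty word is the farther end of one edge and the nearer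
-- end of three, so it receives the total weight 4 + 3 = 7 where unweighted AM-GM would give 8; the
-- root receives only 4. The pair `aX`, `bX` is estimated trivially. The weights 4 and 1 approximate
-- the optimal ratio 3 of Kesten's bound by one with an integral square root.
spectral-gap : ∀ X → 2 ℕ.* ∥ spreadBy (id ∷ step a ∷ step b ∷ []) X ∥² ℕ.≤ 17 ℕ.* ∥ X ∥²
spectral-gap X = begin
  2 ℕ.* ∥ spreadBy (id ∷ step a ∷ step b ∷ []) X ∥²
    ≡⟨ cong (λ Z → 2 ℕ.* ∥ Z ∥²) (cong₂ _++_ (List.map-id X) (cong (map (step a) X ++_) (List.++-identityʳ _))) ⟩
  2 ℕ.* ∥ X ++ (aX ++ bX) ∥²
    ≡⟨ cong (2 ℕ.*_) (∥∥²-++ X (aX ++ bX)) ⟩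
  2 ℕ.* (∥ X ∥² ℕ.+ 2 ℕ.* ⟨ X , aX ++ bX ⟩ ℕ.+ ∥ aX ++ bX ∥²)
    ≡⟨ cong₂ (λ k l → 2 ℕ.* (∥ X ∥² ℕ.+ 2 ℕ.* k ℕ.+ l)) (⟨⟩-++ʳ X aX bX) (∥∥²-++ aX bX) ⟩
  2 ℕ.* (∥ X ∥² ℕ.+ 2 ℕ.* (⟨ X , aX ⟩ ℕ.+ ⟨ X , bX ⟩) ℕ.+ (∥ aX ∥² ℕ.+ 2 ℕ.* ⟨ aX , bX ⟩ ℕ.+ ∥ bX ∥²))
    ≤⟨ ℕ.*-monoʳ-≤ 2 (ℕ.+-monoʳ-≤ (∥ X ∥² ℕ.+ 2 ℕ.* (⟨ X , aX ⟩ ℕ.+ ⟨ X , bX ⟩))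
         (ℕ.+-monoˡ-≤ ∥ bX ∥² (ℕ.+-monoʳ-≤ ∥ aX ∥² (am-gm aX bX)))) ⟩
  2 ℕ.* (∥ X ∥² ℕ.+ 2 ℕ.* (⟨ X , aX ⟩ ℕ.+ ⟨ X , bX ⟩) ℕ.+ (∥ aX ∥² ℕ.+ (∥ aX ∥² ℕ.+ ∥ bX ∥²) ℕ.+ ∥ bX ∥²))
    ≡⟨ cong₂ (λ k l → 2 ℕ.* (∥ X ∥² ℕ.+ 2 ℕ.* (⟨ X , aX ⟩ ℕ.+ ⟨ X , bX ⟩) ℕ.+ (k ℕ.+ (k ℕ.+ l) ℕ.+ l)))
         (⟨⟩-map (step-injective a) X X) (⟨⟩-map (step-injective b) X X) ⟩
  2 ℕ.* (∥ X ∥² ℕ.+ 2 ℕ.* (⟨ X , aX ⟩ ℕ.+ ⟨ X , bX ⟩) ℕ.+ (∥ X ∥² ℕ.+ (∥ X ∥² ℕ.+ ∥ X ∥²) ℕ.+ ∥ X ∥²))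
    ≡⟨ collect ∥ X ∥² ⟨ X , aX ⟩ ⟨ X , bX ⟩ ⟩
  10 ℕ.* ∥ X ∥² ℕ.+ (4 ℕ.* ⟨ X , aX ⟩ ℕ.+ 4 ℕ.* ⟨ X , bX ⟩)
    ≤⟨ ℕ.+-monoʳ-≤ (10 ℕ.* ∥ X ∥²) (ℕ.+-mono-≤ (edge-bound a X) (edge-bound b X)) ⟩
  10 ℕ.* ∥ X ∥² ℕ.+ (2 ℕ.* ∥ X ∥² ℕ.+ 3 ℕ.* (n a ℕ.+ n (inv a)) ℕ.+ (2 ℕ.* ∥ X ∥² ℕ.+ 3 ℕ.* (n b ℕ.+ n (inv b))))
    ≡⟨ collect′ ∥ X ∥² (n a) (n (inv a)) (n b) (n (inv b)) ⟩
  14 ℕ.* ∥ X ∥² ℕ.+ 3 ℕ.* (n a ℕ.+ (n (inv a) ℕ.+ (n b ℕ.+ (n (inv b) ℕ.+ 0))))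
    ≤⟨ ℕ.+-monoʳ-≤ (14 ℕ.* ∥ X ∥²) (ℕ.*-monoʳ-≤ 3 disjoint) ⟩
  14 ℕ.* ∥ X ∥² ℕ.+ 3 ℕ.* ∥ X ∥²
    ≡⟨ ℕ.*-distribʳ-+ ∥ X ∥² 14 3 ⟨
  17 ℕ.* ∥ X ∥² ∎
  where
  open ℕ.≤-Reasoning
  aX = map (step a) X
  bX = map (step b) X
  n : Letter → ℕ
  n t = ∥ startingWith t X ∥²
  collect : ∀ n α β → 2 ℕ.* (n ℕ.+ 2 ℕ.* (α ℕ.+ β) ℕ.+ (n ℕ.+ (n ℕ.+ n) ℕ.+ n)) ≡
                      10 ℕ.* n ℕ.+ (4 ℕ.* α ℕ.+ 4 ℕ.* β)
  collect = solve-∀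
  collect′ : ∀ n p q r s → 10 ℕ.* n ℕ.+ (2 ℕ.* n ℕ.+ 3 ℕ.* (p ℕ.+ q) ℕ.+ (2 ℕ.* n ℕ.+ 3 ℕ.* (r ℕ.+ s))) ≡
                           14 ℕ.* n ℕ.+ 3 ℕ.* (p ℕ.+ (q ℕ.+ (r ℕ.+ (s ℕ.+ 0))))
  collect′ = solve-∀
  letters-unique : UniqueL (a ∷ inv a ∷ b ∷ inv b ∷ [])
  letters-unique =
    ((λ ()) ∷ (λ ()) ∷ (λ ()) ∷ []) ∷ ((λ ()) ∷ (λ ()) ∷ []) ∷ ((λ ()) ∷ []) ∷ [] ∷ []
  disjoint : n a ℕ.+ (n (inv a) ℕ.+ (n b ℕ.+ (n (inv b) ℕ.+ 0))) ℕ.≤ ∥ X ∥²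
  disjoint rewrite sym (∥startingWith∥² a X) | sym (∥startingWith∥² (inv a) X)
                 | sym (∥startingWith∥² b X) | sym (∥startingWith∥² (inv b) X) =
    sum-startingWith-≤ letters-unique X X

spreadBy-↭ : ∀ {Γ Γ′} X → Γ ↭ Γ′ → spreadBy Γ X ↭ spreadBy Γ′ X
spreadBy-↭ X ↭.refl = ↭-refl
spreadBy-↭ X (↭.prep γ p)   = ↭.++⁺ˡ (map γ X) (spreadBy-↭ X p)
spreadBy-↭ X (↭.swap γ δ p) = ↭-trans (↭.++⁺ˡ (map γ X) (↭.++⁺ˡ (map δ X) (spreadBy-↭ X p)))
                                     (↭.shifts (map γ X) (map δ X))
spreadBy-↭ X (↭.trans p q)  = ↭-trans (spreadBy-↭ X p) (spreadBy-↭ X q)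

spread-↭ : ∀ {p q X Z} → X ↭ Z → Spread p q Z → Spread p q X
spread-↭ {p} {q} X↭Z h = subst₂ (λ n l → q ℕ.* n ℕ.≤ p ℕ.* (l ℕ.* l))
  (∥∥²-↭ (↭-sym X↭Z)) (↭.↭-length (↭-sym X↭Z)) h

count≤length : ∀ x Z → count x Z ℕ.≤ length Z
count≤length x []      = z≤n
count≤length x (z ∷ Z) with x ≟ʷ z
... | yes _ = s≤s (count≤length x Z)
... | no _  = ℕ.m≤n⇒m≤1+n (count≤length x Z)

⟨⟩≤length : ∀ X Z → ⟨ X , Z ⟩ ℕ.≤ length X ℕ.* length Z
⟨⟩≤length []      Z = z≤n
⟨⟩≤length (x ∷ X) Z = ℕ.+-mono-≤ (count≤length x Z) (⟨⟩≤length X Z)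

origin : ReducedWord
origin = reducedWord [] tt

step-a≢id : step a origin ≢ origin
step-a≢id eq with () ← cong ReducedWord.letters eq

step-b≢id : step b origin ≢ origin
step-b≢id eq with () ← cong ReducedWord.letters eq

step-b≢step-a : step b origin ≢ step a origin
step-b≢step-a eq with () ← cong ReducedWord.letters eq

module _ {V : Set} (g : V → ReducedWord → ReducedWord) (g-injective : ∀ w → Injective _≡_ _≡_ (g w))
  {w₀ wₐ w_b : V} (g₀ : ∀ y → g w₀ y ≡ y) (gₐ : ∀ y → g wₐ y ≡ step a y) (g_b : ∀ y → g w_b y ≡ step b y) where

  private
    still : ∀ {w v} {L L′ : List V} → L ↭ w ∷ L′ → v ∈ˡ L → v ≢ w → v ∈ˡ L′
    still p v∈ v≢w with ↭.∈-resp-↭ p v∈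
    ... | here v≡w = contradiction v≡w v≢w
    ... | there v∈′ = v∈′
    wₐ≢w₀ : wₐ ≢ w₀
    wₐ≢w₀ eq = step-a≢id (trans (sym (gₐ origin)) (trans (cong (λ w → g w origin) eq) (g₀ origin)))
    w_b≢w₀ : w_b ≢ w₀
    w_b≢w₀ eq = step-b≢id (trans (sym (g_b origin)) (trans (cong (λ w → g w origin) eq) (g₀ origin)))
    w_b≢wₐ : w_b ≢ wₐ
    w_b≢wₐ eq = step-b≢step-a (trans (sym (g_b origin)) (trans (cong (λ w → g w origin) eq) (gₐ origin)))

  -- The three members are different entries of `L`, since their maps send `origin` to different
  -- words.
  three-members : ∀ {L : List V} → w₀ ∈ˡ L → wₐ ∈ˡ L → w_b ∈ˡ L → ∃[ L′ ] L ↭ w₀ ∷ wₐ ∷ w_b ∷ L′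
  three-members {L} w₀∈ wₐ∈ w_b∈
    with L₁ , L↭ ← ∈⇒↭ w₀∈
    with L₂ , L₁↭ ← ∈⇒↭ (still L↭ wₐ∈ wₐ≢w₀)
    with L₃ , L₂↭ ← ∈⇒↭ (still L₁↭ (still L↭ w_b∈ w_b≢w₀) w_b≢wₐ) =
    L₃ , ↭-trans L↭ (↭-prep w₀ (↭-trans L₁↭ (↭-prep wₐ L₂↭)))

  block-contraction : ∀ {L} X → w₀ ∈ˡ L → wₐ ∈ˡ L → w_b ∈ˡ L →
    2 ℕ.* ∥ spreadBy (map g L) X ∥² ℕ.+ ∥ X ∥² ℕ.≤ 2 ℕ.* (length L ℕ.* length L) ℕ.* ∥ X ∥²
  block-contraction {L} X w₀∈ wₐ∈ w_b∈ with L′ , L↭ ← three-members w₀∈ wₐ∈ w_b∈ =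
    subst₂ (λ n l → 2 ℕ.* n ℕ.+ ∥ X ∥² ℕ.≤ 2 ℕ.* (l ℕ.* l) ℕ.* ∥ X ∥²)
      (sym (trans (∥∥²-↭ (spreadBy-↭ X (↭.map⁺ g L↭))) (cong ∥_∥² replace)))
      (trans (cong (3 ℕ.+_) (List.length-map g L′)) (sym (↭.↭-length L↭)))
      (contraction-extends Γ₃ (map g L′) X refl
        (id ∷ step-injective a ∷ step-injective b ∷ []) (All.map⁺ (All.tabulate λ {w} _ → g-injective w)) (spectral-gap X))
    where
    Γ₃ : List (ReducedWord → ReducedWord)
    Γ₃ = id ∷ step a ∷ step b ∷ []
    replace : spreadBy (g w₀ ∷ g wₐ ∷ g w_b ∷ map g L′) X ≡ spreadBy (Γ₃ ++ map g L′) X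
    replace = cong₂ _++_ (List.map-cong g₀ X) (cong₂ _++_ (List.map-cong gₐ X) (cong₂ _++_ (List.map-cong g_b X) refl))

  -- The saving `∥ X ∥² / 2` is the proportion 1 / (2 W²) of the trivial bound W² `∥ X ∥²`, with W
  -- the length of `L`. As W is at most `B`, the factor is at most E / (E + 1) for E = 2 B²,
  -- independently of `L`.
  block-spread : ∀ {L X} m B → w₀ ∈ˡ L → wₐ ∈ˡ L → w_b ∈ˡ L → length L ℕ.≤ B →
    Spread ((2 ℕ.* (B ℕ.* B)) ℕ.^ m) (suc (2 ℕ.* (B ℕ.* B)) ℕ.^ m) X →
    Spread ((2 ℕ.* (B ℕ.* B)) ℕ.^ suc m) (suc (2 ℕ.* (B ℕ.* B)) ℕ.^ suc m) (spreadBy (map g L) X)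
  block-spread {L} {X} m B w₀∈ wₐ∈ w_b∈ L≤B h = begin
    (D ℕ.* D ℕ.^ m) ℕ.* C          ≡⟨ rearrange D (D ℕ.^ m) C ⟩
    D ℕ.^ m ℕ.* (D ℕ.* C)          ≤⟨ ℕ.*-monoʳ-≤ (D ℕ.^ m) one-block ⟩
    D ℕ.^ m ℕ.* (E ℕ.* (W ℕ.* W) ℕ.* ∥ X ∥²)  ≡⟨ rearrange′ (D ℕ.^ m) (E ℕ.* (W ℕ.* W)) ∥ X ∥² ⟩
    E ℕ.* (W ℕ.* W) ℕ.* (D ℕ.^ m ℕ.* ∥ X ∥²)  ≤⟨ ℕ.*-monoʳ-≤ (E ℕ.* (W ℕ.* W)) h ⟩
    E ℕ.* (W ℕ.* W) ℕ.* (E ℕ.^ m ℕ.* (length X ℕ.* length X)) ≡⟨ collect E W (E ℕ.^ m) (length X) ⟩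
    (E ℕ.* E ℕ.^ m) ℕ.* ((W ℕ.* length X) ℕ.* (W ℕ.* length X))
      ≡⟨ cong (λ l → (E ℕ.* E ℕ.^ m) ℕ.* (l ℕ.* l))
           (trans (length-spreadBy (map g L) X) (cong (ℕ._* length X) (List.length-map g L))) ⟨
    (E ℕ.* E ℕ.^ m) ℕ.* (length (spreadBy (map g L) X) ℕ.* length (spreadBy (map g L) X)) ∎
    where
    open ℕ.≤-Reasoning
    E = 2 ℕ.* (B ℕ.* B)
    D = suc E
    W = length L
    C = ∥ spreadBy (map g L) X ∥²
    rearrange : ∀ d e c → (d ℕ.* e) ℕ.* c ≡ e ℕ.* (d ℕ.* c)
    rearrange = solve-∀
    rearrange′ : ∀ d e c → d ℕ.* (e ℕ.* c) ≡ e ℕ.* (d ℕ.* c)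
    rearrange′ = solve-∀
    collect : ∀ e w f x → e ℕ.* (w ℕ.* w) ℕ.* (f ℕ.* (x ℕ.* x)) ≡ (e ℕ.* f) ℕ.* ((w ℕ.* x) ℕ.* (w ℕ.* x))
    collect = solve-∀
    expand : ∀ d c n → 2 ℕ.* (d ℕ.* c) ℕ.+ d ℕ.* n ≡ d ℕ.* (2 ℕ.* c ℕ.+ n)
    expand = solve-∀
    expand′ : ∀ e w n → suc e ℕ.* (2 ℕ.* w ℕ.* n) ≡ 2 ℕ.* (e ℕ.* w ℕ.* n) ℕ.+ 2 ℕ.* w ℕ.* n
    expand′ = solve-∀
    one-block : D ℕ.* C ℕ.≤ E ℕ.* (W ℕ.* W) ℕ.* ∥ X ∥²
    one-block = ℕ.*-cancelˡ-≤ 2 (ℕ.+-cancelʳ-≤ (D ℕ.* ∥ X ∥²) _ _ (begin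
      2 ℕ.* (D ℕ.* C) ℕ.+ D ℕ.* ∥ X ∥²   ≡⟨ expand D C ∥ X ∥² ⟩
      D ℕ.* (2 ℕ.* C ℕ.+ ∥ X ∥²)         ≤⟨ ℕ.*-monoʳ-≤ D (block-contraction X w₀∈ wₐ∈ w_b∈) ⟩
      D ℕ.* (2 ℕ.* (W ℕ.* W) ℕ.* ∥ X ∥²) ≡⟨ expand′ E (W ℕ.* W) ∥ X ∥² ⟩
      2 ℕ.* (E ℕ.* (W ℕ.* W) ℕ.* ∥ X ∥²) ℕ.+ 2 ℕ.* (W ℕ.* W) ℕ.* ∥ X ∥²
        ≤⟨ ℕ.+-monoʳ-≤ (2 ℕ.* (E ℕ.* (W ℕ.* W) ℕ.* ∥ X ∥²)) (ℕ.*-monoˡ-≤ ∥ X ∥²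
             (ℕ.≤-trans (ℕ.*-monoʳ-≤ 2 (ℕ.*-mono-≤ L≤B L≤B)) (ℕ.n≤1+n E))) ⟩
      2 ℕ.* (E ℕ.* (W ℕ.* W) ℕ.* ∥ X ∥²) ℕ.+ D ℕ.* ∥ X ∥² ∎))

-- This is where concatenation of walks becomes convolution: `f` sees the first factor only through
-- the map `g u` applied to the image of the second.
map-cartesianProductWith : ∀ {A B C : Set} (f : C → ReducedWord) (_·_ : A → B → C)
  (g : A → ReducedWord → ReducedWord) (h : B → ReducedWord) → (∀ u v → f (u · v) ≡ g u (h v)) →
  ∀ us vs → map f (cartesianProductWith _·_ us vs) ≡ spreadBy (map g us) (map h vs)
map-cartesianProductWith f _·_ g h eq []       vs = refl
map-cartesianProductWith f _·_ g h eq (u ∷ us) vs =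
  trans (List.map-++ f (map (u ·_) vs) _)
    (cong₂ _++_ (trans (sym (List.map-∘ vs)) (trans (List.map-cong (eq u) vs) (List.map-∘ vs)))
      (map-cartesianProductWith f _·_ g h eq us vs))

module _ {A : Set} {_~_ : A → A → Set} (_~?_ : ∀ x y → Dec (x ~ y)) (f : A → ReducedWord)
  (f-cong : ∀ {x y} → x ~ y → f x ≡ f y) where

  -- Equivalent pairs have equal images under the invariant `f`, so they are among the collisions
  -- counted by the form.
  equivalent-pairs : ∀ xs ys → length (filter (uncurry _~?_) (cartesianProduct xs ys)) ℕ.≤ ⟨ map f xs , map f ys ⟩
  equivalent-pairs []       ys = z≤n
  equivalent-pairs (x ∷ xs) ys = begin
    length (filter (uncurry _~?_) (map (x ,_) ys ++ cartesianProduct xs ys))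
      ≡⟨ cong length (List.filter-++ (uncurry _~?_) (map (x ,_) ys) _) ⟩
    length (filter (uncurry _~?_) (map (x ,_) ys) ++ filter (uncurry _~?_) (cartesianProduct xs ys))
      ≡⟨ List.length-++ (filter (uncurry _~?_) (map (x ,_) ys)) ⟩
    length (filter (uncurry _~?_) (map (x ,_) ys)) ℕ.+ length (filter (uncurry _~?_) (cartesianProduct xs ys))
      ≤⟨ ℕ.+-mono-≤ (row ys) (equivalent-pairs xs ys) ⟩
    count (f x) (map f ys) ℕ.+ ⟨ map f xs , map f ys ⟩ ∎
    where
    open ℕ.≤-Reasoning
    row : ∀ ys → length (filter (uncurry _~?_) (map (x ,_) ys)) ℕ.≤ count (f x) (map f ys)
    row []       = z≤n
    row (y ∷ ys) with x ~? y | f x ≟ʷ f y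
    ... | yes _   | yes _ = s≤s (row ys)
    ... | yes x~y | no ≢  = contradiction (f-cong x~y) ≢
    ... | no _    | yes _ = ℕ.m≤n⇒m≤1+n (row ys)
    ... | no _    | no _  = row ys

-- Exponential decay

-- Bernoulli's inequality for the K-th power of 1 - 1 / (M + 1), with denominators cleared and the
-- negative term moved to the right.
bernoulli : ∀ M K → suc M ℕ.^ K ℕ.* suc M ℕ.≤ M ℕ.^ K ℕ.* suc M ℕ.+ K ℕ.* suc M ℕ.^ K
bernoulli M zero    = ℕ.m≤m+n _ 0
bernoulli M (suc K) = begin
  (suc M ℕ.* S) ℕ.* suc M                        ≡⟨ ℕ.*-assoc (suc M) S (suc M) ⟩
  suc M ℕ.* (S ℕ.* suc M)                        ≤⟨ ℕ.*-monoʳ-≤ (suc M) (bernoulli M K) ⟩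
  suc M ℕ.* (P ℕ.* suc M ℕ.+ K ℕ.* S)            ≡⟨ expand M P K S ⟩
  (M ℕ.* P) ℕ.* suc M ℕ.+ (suc M ℕ.* P ℕ.+ K ℕ.* (suc M ℕ.* S))
    ≤⟨ ℕ.+-monoʳ-≤ ((M ℕ.* P) ℕ.* suc M) (ℕ.+-monoˡ-≤ (K ℕ.* (suc M ℕ.* S))
         (ℕ.*-monoʳ-≤ (suc M) (ℕ.^-monoˡ-≤ K (ℕ.n≤1+n M)))) ⟩
  (M ℕ.* P) ℕ.* suc M ℕ.+ (suc M ℕ.* S ℕ.+ K ℕ.* (suc M ℕ.* S)) ∎
  where
  open ℕ.≤-Reasoning
  S = suc M ℕ.^ K
  P = M ℕ.^ K
  expand : ∀ M P K S → suc M ℕ.* (P ℕ.* suc M ℕ.+ K ℕ.* S) ≡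
           (M ℕ.* P) ℕ.* suc M ℕ.+ (suc M ℕ.* P ℕ.+ K ℕ.* (suc M ℕ.* S))
  expand = solve-∀

-- Bernoulli's inequality for the m-th power of 1 + 1 / X, multiplied by X ^ (m + 1).
bernoulli′ : ∀ X m → X ℕ.^ m ℕ.* (X ℕ.+ m) ℕ.≤ X ℕ.* suc X ℕ.^ m
bernoulli′ X zero    = ℕ.≤-reflexive (trans (ℕ.*-identityˡ _) (trans (ℕ.+-identityʳ X) (sym (ℕ.*-identityʳ X))))
bernoulli′ X (suc m) = begin
  (X ℕ.* P) ℕ.* (X ℕ.+ suc m)                ≡⟨ expand X P m ⟩
  X ℕ.* (P ℕ.* (X ℕ.+ m)) ℕ.+ X ℕ.* P        ≤⟨ ℕ.+-mono-≤ (ℕ.*-monoʳ-≤ X (bernoulli′ X m)) (ℕ.*-monoʳ-≤ X (ℕ.^-monoˡ-≤ m (ℕ.n≤1+n X))) ⟩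
  X ℕ.* (X ℕ.* S) ℕ.+ X ℕ.* S                ≡⟨ collect X S ⟩
  X ℕ.* (suc X ℕ.* S)                        ∎
  where
  open ℕ.≤-Reasoning
  S = suc X ℕ.^ m
  P = X ℕ.^ m
  expand : ∀ X P m → (X ℕ.* P) ℕ.* (X ℕ.+ suc m) ≡ X ℕ.* (P ℕ.* (X ℕ.+ m)) ℕ.+ X ℕ.* P
  expand = solve-∀
  collect : ∀ X S → X ℕ.* (X ℕ.* S) ℕ.+ X ℕ.* S ≡ X ℕ.* (suc X ℕ.* S)
  collect = solve-∀

exponential-beats-constant : ∀ X a m → a ℕ.* X ℕ.< m → a ℕ.* X ℕ.^ m ℕ.≤ suc X ℕ.^ m
-- The factor `X` cannot be cancelled here, but the exponent is positive, so the left side vanishes.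
exponential-beats-constant zero    a (suc m) _  = subst (ℕ._≤ 1 ℕ.^ suc m) (sym (ℕ.*-zeroʳ a)) z≤n
exponential-beats-constant X@(suc _) a m aX<m = ℕ.*-cancelˡ-≤ X (begin
  X ℕ.* (a ℕ.* X ℕ.^ m)    ≡⟨ rearrange X a (X ℕ.^ m) ⟩
  X ℕ.^ m ℕ.* (a ℕ.* X)    ≤⟨ ℕ.*-monoʳ-≤ (X ℕ.^ m) (ℕ.≤-trans (ℕ.<⇒≤ aX<m) (ℕ.m≤n+m m X)) ⟩
  X ℕ.^ m ℕ.* (X ℕ.+ m)    ≤⟨ bernoulli′ X m ⟩
  X ℕ.* suc X ℕ.^ m        ∎)
  where
  open ℕ.≤-Reasoning
  rearrange : ∀ X a P → X ℕ.* (a ℕ.* P) ≡ P ℕ.* (a ℕ.* X)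
  rearrange = solve-∀

-- With suc M = 2 K (E + 1), the K-th power of M / suc M is at least (2 E + 1) / (2 E + 2).
ratio-of-block : ∀ K E M .{{_ : NonZero K}} → suc M ≡ K ℕ.* (2 ℕ.* suc E) →
                 suc M ℕ.^ K ℕ.* suc (2 ℕ.* E) ℕ.≤ M ℕ.^ K ℕ.* (2 ℕ.* suc E)
ratio-of-block K E M eq = ℕ.*-cancelˡ-≤ K (ℕ.+-cancelʳ-≤ (K ℕ.* S) _ _ (begin
  K ℕ.* (S ℕ.* suc (2 ℕ.* E)) ℕ.+ K ℕ.* S   ≡⟨ collect K S E ⟩
  S ℕ.* (K ℕ.* (2 ℕ.* suc E))               ≡⟨ cong (S ℕ.*_) eq ⟨
  S ℕ.* suc M                               ≤⟨ bernoulli M K ⟩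
  M ℕ.^ K ℕ.* suc M ℕ.+ K ℕ.* S             ≡⟨ cong (λ s → M ℕ.^ K ℕ.* s ℕ.+ K ℕ.* S) eq ⟩
  M ℕ.^ K ℕ.* (K ℕ.* (2 ℕ.* suc E)) ℕ.+ K ℕ.* S ≡⟨ cong (ℕ._+ K ℕ.* S) (exchange (M ℕ.^ K) K (2 ℕ.* suc E)) ⟩
  K ℕ.* (M ℕ.^ K ℕ.* (2 ℕ.* suc E)) ℕ.+ K ℕ.* S ∎))
  where
  open ℕ.≤-Reasoning
  S = suc M ℕ.^ K
  collect : ∀ K S E → K ℕ.* (S ℕ.* suc (2 ℕ.* E)) ℕ.+ K ℕ.* S ≡ S ℕ.* (K ℕ.* (2 ℕ.* suc E))
  collect = solve-∀
  exchange : ∀ a b c → a ℕ.* (b ℕ.* c) ≡ b ℕ.* (a ℕ.* c)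
  exchange = solve-∀

^-distribʳ-* : ∀ a b m → (a ℕ.* b) ℕ.^ m ≡ a ℕ.^ m ℕ.* b ℕ.^ m
^-distribʳ-* a b zero    = refl
^-distribʳ-* a b (suc m) = trans (cong (a ℕ.* b ℕ.*_) (^-distribʳ-* a b m)) (exchange a b (a ℕ.^ m) (b ℕ.^ m))
  where
  exchange : ∀ a b c d → a ℕ.* b ℕ.* (c ℕ.* d) ≡ (a ℕ.* c) ℕ.* (b ℕ.* d)
  exchange = solve-∀

-- The block estimate is raised to the power `m`; the `rest` floors completing `N` to `K * m`
-- contribute a factor M / (M + 1) each, which is at most 1.
ratio-of-power : ∀ K E M m N → suc M ℕ.^ K ℕ.* suc (2 ℕ.* E) ℕ.≤ M ℕ.^ K ℕ.* (2 ℕ.* suc E) → N ℕ.≤ K ℕ.* m →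
                 suc M ℕ.^ N ℕ.* suc (2 ℕ.* E) ℕ.^ m ℕ.≤ M ℕ.^ N ℕ.* (2 ℕ.* suc E) ℕ.^ m
ratio-of-power K E M m N h N≤ = ℕ.*-cancelˡ-≤ (suc M ℕ.^ rest) {{ℕ.m^n≢0 (suc M) rest}} (begin
  suc M ℕ.^ rest ℕ.* (suc M ℕ.^ N ℕ.* u ℕ.^ m)  ≡⟨ gather (suc M) u ⟩
  (suc M ℕ.^ K ℕ.* u) ℕ.^ m                     ≤⟨ ℕ.^-monoˡ-≤ m h ⟩
  (M ℕ.^ K ℕ.* v) ℕ.^ m                         ≡⟨ gather M v ⟨
  M ℕ.^ rest ℕ.* (M ℕ.^ N ℕ.* v ℕ.^ m)          ≤⟨ ℕ.*-monoˡ-≤ (M ℕ.^ N ℕ.* v ℕ.^ m) (ℕ.^-monoˡ-≤ rest (ℕ.n≤1+n M)) ⟩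
  suc M ℕ.^ rest ℕ.* (M ℕ.^ N ℕ.* v ℕ.^ m)      ∎)
  where
  open ℕ.≤-Reasoning
  rest = K ℕ.* m ℕ.∸ N
  u = suc (2 ℕ.* E)
  v = 2 ℕ.* suc E
  gather : ∀ M u → M ℕ.^ rest ℕ.* (M ℕ.^ N ℕ.* u ℕ.^ m) ≡ (M ℕ.^ K ℕ.* u) ℕ.^ m
  gather M u = begin-equality
    M ℕ.^ rest ℕ.* (M ℕ.^ N ℕ.* u ℕ.^ m)   ≡⟨ ℕ.*-assoc (M ℕ.^ rest) (M ℕ.^ N) (u ℕ.^ m) ⟨
    M ℕ.^ rest ℕ.* M ℕ.^ N ℕ.* u ℕ.^ m     ≡⟨ cong (ℕ._* u ℕ.^ m) (ℕ.^-distribˡ-+-* M rest N) ⟨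
    M ℕ.^ (rest ℕ.+ N) ℕ.* u ℕ.^ m         ≡⟨ cong (λ k → M ℕ.^ k ℕ.* u ℕ.^ m) (ℕ.m∸n+n≡m N≤) ⟩
    M ℕ.^ (K ℕ.* m) ℕ.* u ℕ.^ m            ≡⟨ cong (ℕ._* u ℕ.^ m) (ℕ.^-*-assoc M K m) ⟨
    (M ℕ.^ K) ℕ.^ m ℕ.* u ℕ.^ m            ≡⟨ ^-distribʳ-* (M ℕ.^ K) u m ⟨
    (M ℕ.^ K ℕ.* u) ℕ.^ m                  ∎

-- From a decay by E / (E + 1) per block of length K to a decay by o((M / suc M) ^ N).
block-decay : ∀ K E M .{{_ : NonZero K}} → suc M ≡ K ℕ.* (2 ℕ.* suc E) →
  ∀ b m N e t → N ℕ.≤ K ℕ.* suc m → (b ℕ.* (2 ℕ.* suc E)) ℕ.* (2 ℕ.* E) ℕ.< m →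
  suc E ℕ.^ m ℕ.* e ℕ.≤ E ℕ.^ m ℕ.* t → e ℕ.* b ℕ.* suc M ℕ.^ N ℕ.≤ t ℕ.* M ℕ.^ N
block-decay K E M eq b m N e t N≤ b<m h = ℕ.*-cancelʳ-≤ _ _ (u ℕ.^ suc m) {{ℕ.m^n≢0 u (suc m)}} (begin
  e ℕ.* b ℕ.* suc M ℕ.^ N ℕ.* u ℕ.^ suc m       ≡⟨ ℕ.*-assoc (e ℕ.* b) (suc M ℕ.^ N) (u ℕ.^ suc m) ⟩
  e ℕ.* b ℕ.* (suc M ℕ.^ N ℕ.* u ℕ.^ suc m)
    ≤⟨ ℕ.*-monoʳ-≤ (e ℕ.* b) (ratio-of-power K E M (suc m) N (ratio-of-block K E M eq) N≤) ⟩
  e ℕ.* b ℕ.* (M ℕ.^ N ℕ.* (v ℕ.* v ℕ.^ m))     ≡⟨ rearrange e b (M ℕ.^ N) v (v ℕ.^ m) ⟩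
  b ℕ.* M ℕ.^ N ℕ.* v ℕ.* (v ℕ.^ m ℕ.* e)       ≤⟨ ℕ.*-monoʳ-≤ (b ℕ.* M ℕ.^ N ℕ.* v) doubled ⟩
  b ℕ.* M ℕ.^ N ℕ.* v ℕ.* (w ℕ.^ m ℕ.* t)       ≡⟨ rearrange′ b (M ℕ.^ N) v (w ℕ.^ m) t ⟩
  -- Doubling turns E / (E + 1) into 2 E / (2 E + 2), while the target rate costs (2 E + 1) / (2 E +
  -- 2) per block. The quotient (2 E + 1) / (2 E), taken `m` times, outgrows the constant `b * v`:
  -- `b` carries the prescribed precision, and `v` pays for the incomplete last block.
  t ℕ.* M ℕ.^ N ℕ.* (b ℕ.* v ℕ.* w ℕ.^ m)
    ≤⟨ ℕ.*-monoʳ-≤ (t ℕ.* M ℕ.^ N) (exponential-beats-constant w (b ℕ.* v) m b<m) ⟩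
  t ℕ.* M ℕ.^ N ℕ.* u ℕ.^ m                     ≤⟨ ℕ.*-monoʳ-≤ (t ℕ.* M ℕ.^ N) (ℕ.m≤n*m (u ℕ.^ m) u) ⟩
  t ℕ.* M ℕ.^ N ℕ.* u ℕ.^ suc m                 ∎)
  where
  open ℕ.≤-Reasoning
  u = suc (2 ℕ.* E)
  v = 2 ℕ.* suc E
  w = 2 ℕ.* E
  rearrange : ∀ e b p v x → e ℕ.* b ℕ.* (p ℕ.* (v ℕ.* x)) ≡ b ℕ.* p ℕ.* v ℕ.* (x ℕ.* e)
  rearrange = solve-∀
  rearrange′ : ∀ b p v x t → b ℕ.* p ℕ.* v ℕ.* (x ℕ.* t) ≡ t ℕ.* p ℕ.* (b ℕ.* v ℕ.* x)
  rearrange′ = solve-∀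
  doubled : v ℕ.^ m ℕ.* e ℕ.≤ w ℕ.^ m ℕ.* t
  doubled = begin
    v ℕ.^ m ℕ.* e                     ≡⟨ trans (cong (ℕ._* e) (^-distribʳ-* 2 (suc E) m)) (ℕ.*-assoc (2 ℕ.^ m) _ e) ⟩
    2 ℕ.^ m ℕ.* (suc E ℕ.^ m ℕ.* e)   ≤⟨ ℕ.*-monoʳ-≤ (2 ℕ.^ m) h ⟩
    2 ℕ.^ m ℕ.* (E ℕ.^ m ℕ.* t)       ≡⟨ trans (cong (ℕ._* t) (^-distribʳ-* 2 E m)) (ℕ.*-assoc (2 ℕ.^ m) _ t) ⟨
    w ℕ.^ m ℕ.* t                     ∎

fromℕ : ℕ → ℚ
fromℕ n = + n ℚ./ 1

fromℕ-* : ∀ m n → fromℕ (m ℕ.* n) ≡ fromℕ m ℚ.* fromℕ n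
fromℕ-* m n = ℚ.toℚᵘ-injective (begin
  toℚᵘ (fromℕ (m ℕ.* n))               ≈⟨ ℚ.toℚᵘ-fromℚᵘ (mkℚᵘ (+ (m ℕ.* n)) 0) ⟩
  mkℚᵘ (+ (m ℕ.* n)) 0                 ≈⟨ *≡* (cong (ℤ._* + 1) (ℤ.pos-* m n)) ⟩
  mkℚᵘ (+ m) 0 ℚᵘ.* mkℚᵘ (+ n) 0       ≈⟨ ℚᵘ.*-cong (ℚ.toℚᵘ-fromℚᵘ (mkℚᵘ (+ m) 0)) (ℚ.toℚᵘ-fromℚᵘ (mkℚᵘ (+ n) 0)) ⟨
  toℚᵘ (fromℕ m) ℚᵘ.* toℚᵘ (fromℕ n)   ≈⟨ ℚ.toℚᵘ-homo-* (fromℕ m) (fromℕ n) ⟨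
  toℚᵘ (fromℕ m ℚ.* fromℕ n)           ∎)
  where open ℚᵘ.≃-Reasoning

fromℕ-mono-≤ : ∀ {m n} → m ℕ.≤ n → fromℕ m ℚ.≤ fromℕ n
fromℕ-mono-≤ {m} {n} m≤n = ℚ.toℚᵘ-cancel-≤ (begin
  toℚᵘ (fromℕ m)   ≃⟨ ℚ.toℚᵘ-fromℚᵘ (mkℚᵘ (+ m) 0) ⟩
  mkℚᵘ (+ m) 0     ≤⟨ *≤* (ℤ.*-monoʳ-≤-nonNeg (+ 1) (ℤ.+≤+ m≤n)) ⟩
  mkℚᵘ (+ n) 0     ≃⟨ ℚ.toℚᵘ-fromℚᵘ (mkℚᵘ (+ n) 0) ⟨
  toℚᵘ (fromℕ n)   ∎)
  where open ℚᵘ.≤-Reasoning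

/-cancel : ∀ m n .{{_ : NonZero n}} → (+ m ℚ./ n) ℚ.* fromℕ n ≡ fromℕ m
/-cancel m (suc n) = ℚ.toℚᵘ-injective (begin
  toℚᵘ ((+ m ℚ./ suc n) ℚ.* fromℕ (suc n))           ≈⟨ ℚ.toℚᵘ-homo-* (+ m ℚ./ suc n) (fromℕ (suc n)) ⟩
  toℚᵘ (+ m ℚ./ suc n) ℚᵘ.* toℚᵘ (fromℕ (suc n))     ≈⟨ ℚᵘ.*-cong (ℚ.toℚᵘ-fromℚᵘ (mkℚᵘ (+ m) n)) (ℚ.toℚᵘ-fromℚᵘ (mkℚᵘ (+ suc n) 0)) ⟩
  mkℚᵘ (+ m) n ℚᵘ.* mkℚᵘ (+ suc n) 0                 ≈⟨ *≡* (trans (ℤ.*-identityʳ _) (cong (λ k → + m ℤ.* + k) (sym (ℕ.*-identityʳ (suc n))))) ⟩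
  mkℚᵘ (+ m) 0                                       ≈⟨ ℚ.toℚᵘ-fromℚᵘ (mkℚᵘ (+ m) 0) ⟨
  toℚᵘ (fromℕ m)                                     ∎)
  where open ℚᵘ.≃-Reasoning

^-/-cancel : ∀ M S N .{{_ : NonZero S}} → (+ M ℚ./ S) ^ N ℚ.* fromℕ (S ℕ.^ N) ≡ fromℕ (M ℕ.^ N)
^-/-cancel M S zero    = refl
^-/-cancel M S (suc N) = begin
  (c ℚ.* c ^ N) ℚ.* fromℕ (S ℕ.* S ℕ.^ N)           ≡⟨ cong ((c ℚ.* c ^ N) ℚ.*_) (fromℕ-* S (S ℕ.^ N)) ⟩
  (c ℚ.* c ^ N) ℚ.* (fromℕ S ℚ.* fromℕ (S ℕ.^ N))   ≡⟨ interchange c (c ^ N) (fromℕ S) (fromℕ (S ℕ.^ N)) ⟩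
  (c ℚ.* fromℕ S) ℚ.* (c ^ N ℚ.* fromℕ (S ℕ.^ N))   ≡⟨ cong₂ ℚ._*_ (/-cancel M S) (^-/-cancel M S N) ⟩
  fromℕ M ℚ.* fromℕ (M ℕ.^ N)                       ≡⟨ fromℕ-* M (M ℕ.^ N) ⟨
  fromℕ (M ℕ.* M ℕ.^ N)                             ∎
  where
  open ≡-Reasoning
  open import Algebra.Properties.CommutativeSemigroup (CommutativeMonoid.commutativeSemigroup ℚ.*-1-commutativeMonoid) using (interchange)
  c = + M ℚ./ S

fromℕ-positive : ∀ n .{{_ : NonZero n}} → ℚ.Positive (fromℕ n)
fromℕ-positive (suc n) = ℚ.normalize-pos (suc n) 1

-- A positive rational is at least the inverse of its denominator, so `η` enters the natural-number
-- estimate through `↧ₙ η` alone.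
/-≤ : ∀ e t .{{_ : NonZero t}} M S .{{_ : NonZero S}} N η → 0ℚ ℚ.< η →
      e ℕ.* ℚ.↧ₙ η ℕ.* S ℕ.^ N ℕ.≤ t ℕ.* M ℕ.^ N → + e ℚ./ t ℚ.≤ η ℚ.* (+ M ℚ./ S) ^ N
/-≤ e t M S N η@(mkℚ (+ suc a) d-1 _) _ h =
  ℚ.*-cancelʳ-≤-pos (fromℕ (t ℕ.* (d ℕ.* S ℕ.^ N))) {{fromℕ-positive _ {{nonZero}}}} (begin
    (+ e ℚ./ t) ℚ.* fromℕ (t ℕ.* (d ℕ.* S ℕ.^ N))            ≡⟨ cong ((+ e ℚ./ t) ℚ.*_) (fromℕ-* t (d ℕ.* S ℕ.^ N)) ⟩
    (+ e ℚ./ t) ℚ.* (fromℕ t ℚ.* fromℕ (d ℕ.* S ℕ.^ N))      ≡⟨ ℚ.*-assoc (+ e ℚ./ t) (fromℕ t) _ ⟨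
    ((+ e ℚ./ t) ℚ.* fromℕ t) ℚ.* fromℕ (d ℕ.* S ℕ.^ N)      ≡⟨ cong (ℚ._* fromℕ (d ℕ.* S ℕ.^ N)) (/-cancel e t) ⟩
    fromℕ e ℚ.* fromℕ (d ℕ.* S ℕ.^ N)                        ≡⟨ fromℕ-* e (d ℕ.* S ℕ.^ N) ⟨
    fromℕ (e ℕ.* (d ℕ.* S ℕ.^ N))                            ≤⟨ fromℕ-mono-≤ bound ⟩
    fromℕ (t ℕ.* (suc a ℕ.* M ℕ.^ N))                        ≡⟨ fromℕ-* t (suc a ℕ.* M ℕ.^ N) ⟩
    fromℕ t ℚ.* fromℕ (suc a ℕ.* M ℕ.^ N)                    ≡⟨ cong (fromℕ t ℚ.*_) (fromℕ-* (suc a) (M ℕ.^ N)) ⟩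
    fromℕ t ℚ.* (fromℕ (suc a) ℚ.* fromℕ (M ℕ.^ N))          ≡⟨ cong₂ (λ x y → fromℕ t ℚ.* (x ℚ.* y)) η-cancel (^-/-cancel M S N) ⟨
    fromℕ t ℚ.* ((η ℚ.* fromℕ d) ℚ.* (c ^ N ℚ.* fromℕ (S ℕ.^ N))) ≡⟨ cong (fromℕ t ℚ.*_) (interchange η (fromℕ d) (c ^ N) (fromℕ (S ℕ.^ N))) ⟩
    fromℕ t ℚ.* ((η ℚ.* c ^ N) ℚ.* (fromℕ d ℚ.* fromℕ (S ℕ.^ N))) ≡⟨ x∙yz≈y∙xz (fromℕ t) (η ℚ.* c ^ N) _ ⟩
    (η ℚ.* c ^ N) ℚ.* (fromℕ t ℚ.* (fromℕ d ℚ.* fromℕ (S ℕ.^ N))) ≡⟨ cong (λ x → (η ℚ.* c ^ N) ℚ.* (fromℕ t ℚ.* x)) (fromℕ-* d (S ℕ.^ N)) ⟨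
    (η ℚ.* c ^ N) ℚ.* (fromℕ t ℚ.* fromℕ (d ℕ.* S ℕ.^ N))    ≡⟨ cong ((η ℚ.* c ^ N) ℚ.*_) (fromℕ-* t (d ℕ.* S ℕ.^ N)) ⟨
    (η ℚ.* c ^ N) ℚ.* fromℕ (t ℕ.* (d ℕ.* S ℕ.^ N))          ∎)
  where
  open ℚ.≤-Reasoning
  open import Algebra.Properties.CommutativeSemigroup (CommutativeMonoid.commutativeSemigroup ℚ.*-1-commutativeMonoid) using (interchange; x∙yz≈y∙xz)
  d = suc d-1
  c = + M ℚ./ S
  nonZero : NonZero (t ℕ.* (d ℕ.* S ℕ.^ N))
  nonZero = ℕ.m*n≢0 t (d ℕ.* S ℕ.^ N)
    where
    instance
      S^N≢0 : NonZero (S ℕ.^ N)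
      S^N≢0 = ℕ.m^n≢0 S N
      dS^N≢0 : NonZero (d ℕ.* S ℕ.^ N)
      dS^N≢0 = ℕ.m*n≢0 d (S ℕ.^ N)
  η-cancel : η ℚ.* fromℕ d ≡ fromℕ (suc a)
  η-cancel = trans (cong (ℚ._* fromℕ d) (sym (ℚ.↥p/↧p≡p η))) (/-cancel (suc a) d)
  bound : e ℕ.* (d ℕ.* S ℕ.^ N) ℕ.≤ t ℕ.* (suc a ℕ.* M ℕ.^ N)
  bound = ℕ.≤-trans (ℕ.≤-reflexive (sym (ℕ.*-assoc e d (S ℕ.^ N)))) (ℕ.≤-trans h (ℕ.*-monoʳ-≤ t (ℕ.m≤n*m (M ℕ.^ N) (suc a))))
/-≤ e t M S N (mkℚ (+ zero) _ _)  (ℚ.*<* (ℤ.+<+ ())) h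
/-≤ e t M S N (mkℚ -[1+ _ ] _ _) (ℚ.*<* ()) h

private variable d n : ℕ

-- Counting squares

length-≤ : ∀ {A B : Set} (M : A → B → Set) {xs : List A} {ys : List B} → UniqueL xs →
           (∀ {x} → x ∈ˡ xs → ∃[ y ] (y ∈ˡ ys × M x y)) →
           (∀ {x x′ y} → x ∈ˡ xs → x′ ∈ˡ xs → M x y → M x′ y → x ≡ x′) →
           length xs ℕ.≤ length ys
length-≤ M [] _ _ = z≤n
length-≤ M {x ∷ xs} {ys} (x∉xs ∷ uniq) total inj with total (here refl)
... | y , y∈ys , Mxy with ys′ , ys↭ ← ∈⇒↭ y∈ys =
  subst (suc (length xs) ℕ.≤_) (sym (↭.↭-length ys↭))
    (s≤s (length-≤ M uniq total′ (λ p q → inj (there p) (there q))))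
  where
  total′ : ∀ {x′} → x′ ∈ˡ xs → ∃[ y′ ] (y′ ∈ˡ ys′ × M x′ y′)
  total′ x′∈xs with total (there x′∈xs)
  ... | y′ , y′∈ys , Mx′y′ with ↭.∈-resp-↭ ys↭ y′∈ys
  ... | here refl    = contradiction (inj (here refl) (there x′∈xs) Mxy Mx′y′) (All.lookup x∉xs x′∈xs)
  ... | there y′∈ys′ = y′ , y′∈ys′ , Mx′y′

elements : Subset n → List (Fin n)
elements []            = []
elements (inside  ∷ S) = zero ∷ map suc (elements S)
elements (outside ∷ S) = map suc (elements S)

length-elements : (S : Subset n) → length (elements S) ≡ ∣ S ∣
length-elements []            = refl
length-elements (inside  ∷ S) = cong suc (trans (List.length-map suc (elements S)) (length-elements S))
length-elements (outside ∷ S) = trans (List.length-map suc (elements S)) (length-elements S)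

∈-elements⁺ : {i : Fin n} {S : Subset n} → i ∈ S → i ∈ˡ elements S
∈-elements⁺ {S = inside  ∷ S} Vec.here      = here refl
∈-elements⁺ {S = inside  ∷ S} (Vec.there p) = there (∈-map⁺ suc (∈-elements⁺ p))
∈-elements⁺ {S = outside ∷ S} (Vec.there p) = ∈-map⁺ suc (∈-elements⁺ p)

∈-elements⁻ : {i : Fin n} {S : Subset n} → i ∈ˡ elements S → i ∈ S
∈-elements⁻ {S = inside ∷ S} (here refl) = Vec.here
∈-elements⁻ {S = inside ∷ S} (there p) with j , j∈ , refl ← ∈-map⁻ suc p = Vec.there (∈-elements⁻ j∈)
∈-elements⁻ {S = outside ∷ S} p with j , j∈ , refl ← ∈-map⁻ suc p = Vec.there (∈-elements⁻ j∈)

elements-unique : (S : Subset n) → UniqueL (elements S)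
elements-unique []            = []
elements-unique (inside  ∷ S) =
  All.map⁺ (All.tabulate λ _ ()) ∷ UniqueL.map⁺ Fin.suc-injective (elements-unique S)
elements-unique (outside ∷ S) = UniqueL.map⁺ Fin.suc-injective (elements-unique S)

∣∣-≤ : (M : Fin n → Fin n → Set) {S T : Subset n} →
       (∀ {i} → i ∈ S → ∃[ j ] (j ∈ T × M i j)) →
       (∀ {i i′ j} → i ∈ S → i′ ∈ S → M i j → M i′ j → i ≡ i′) → ∣ S ∣ ℕ.≤ ∣ T ∣
∣∣-≤ M {S} {T} total inj = subst₂ ℕ._≤_ (length-elements S) (length-elements T)
  (length-≤ M (elements-unique S)
    (λ i∈ → let j , j∈ , Mij = total (∈-elements⁻ i∈) in j , ∈-elements⁺ j∈ , Mij)
    (λ p q → inj (∈-elements⁻ p) (∈-elements⁻ q)))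

∣∣-three-parts : (p q T : Subset n) → Empty (p ∩ q) →
  ∣ full ∩ T ∣ ≡ ∣ p ∩ T ∣ ℕ.+ ∣ q ∩ T ∣ ℕ.+ ∣ ∁ (p ∪ q) ∩ T ∣
∣∣-three-parts []      []      []      _    = refl
∣∣-three-parts (s ∷ p) (t ∷ q) (u ∷ T) disj with ∣∣-three-parts p q T (drop-∷-Empty disj)
∣∣-three-parts (true  ∷ p) (true  ∷ q) (u     ∷ T) disj | ih = contradiction (zero , Vec.here) disj
∣∣-three-parts (true  ∷ p) (false ∷ q) (true  ∷ T) disj | ih = cong suc ih
∣∣-three-parts (true  ∷ p) (false ∷ q) (false ∷ T) disj | ih = ih
∣∣-three-parts (false ∷ p) (true  ∷ q) (true  ∷ T) disj | ih =
  trans (cong suc ih) (cong (ℕ._+ ∣ ∁ (p ∪ q) ∩ T ∣) (sym (ℕ.+-suc ∣ p ∩ T ∣ ∣ q ∩ T ∣)))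
∣∣-three-parts (false ∷ p) (true  ∷ q) (false ∷ T) disj | ih = ih
∣∣-three-parts (false ∷ p) (false ∷ q) (true  ∷ T) disj | ih =
  trans (cong suc ih) (sym (ℕ.+-suc (∣ p ∩ T ∣ ℕ.+ ∣ q ∩ T ∣) _))
∣∣-three-parts (false ∷ p) (false ∷ q) (false ∷ T) disj | ih = ih

∈⇒lookup : {i : Fin n} {S : Subset n} → i ∈ S → lookup S i ≡ true
∈⇒lookup = Vec.[]=⇒lookup

lookup⇒∈ : {i : Fin n} {S : Subset n} → lookup S i ≡ true → i ∈ S
lookup⇒∈ {i = i} {S} = Vec.lookup⇒[]= i S

∉⇒lookup : {i : Fin n} {S : Subset n} → i ∉ S → lookup S i ≡ false
∉⇒lookup {i = i} {S} i∉S with lookup S i in eq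
... | true  = contradiction (lookup⇒∈ eq) i∉S
... | false = refl

lookup⇒∉ : {i : Fin n} {S : Subset n} → lookup S i ≡ false → i ∉ S
lookup⇒∉ eq i∈S with () ← trans (sym eq) (∈⇒lookup i∈S)

-- Colours

evenᵇ : ℕ → Bool
evenᵇ n = does (2 ∣? n)

evenᵇ-2+ : ∀ n → evenᵇ (2 ℕ.+ n) ≡ evenᵇ n
evenᵇ-2+ n = does-⇔ (mk⇔ (λ h → ∣m+n∣m⇒∣n {m = 2} h ∣-refl) (∣m∣n⇒∣m+n ∣-refl)) (2 ∣? _) (2 ∣? n)

evenᵇ-suc : ∀ n → evenᵇ (suc n) ≡ not (evenᵇ n)
evenᵇ-suc zero    = refl
evenᵇ-suc (suc n) = begin
  evenᵇ (2 ℕ.+ n)      ≡⟨ evenᵇ-2+ n ⟩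
  evenᵇ n              ≡⟨ Bool.not-involutive (evenᵇ n) ⟨
  not (not (evenᵇ n))  ≡⟨ cong not (evenᵇ-suc n) ⟨
  not (evenᵇ (suc n))  ∎
  where open ≡-Reasoning

evenᵇ-ℤsuc : ∀ z → evenᵇ ℤ.∣ ℤ.suc z ∣ ≡ not (evenᵇ ℤ.∣ z ∣)
evenᵇ-ℤsuc (+ n)          = evenᵇ-suc n
evenᵇ-ℤsuc -[1+ zero ]    = refl
-- On negative integers the successor lowers the absolute value, so `evenᵇ-suc` is read backwards.
evenᵇ-ℤsuc -[1+ suc n ]   = trans (sym (Bool.not-involutive _)) (cong not (sym (evenᵇ-suc (suc n))))

isWhite-shift : ∀ k c → isWhite (shift k c) ≡ not (isWhite c)
isWhite-shift zero       (x ∷ y ∷ []) =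
  trans (cong (evenᵇ ∘ ℤ.∣_∣) (ℤ.+-assoc (+ 1) x y)) (evenᵇ-ℤsuc (x ℤ.+ y))
isWhite-shift (suc zero) (x ∷ y ∷ []) =
  trans (cong (evenᵇ ∘ ℤ.∣_∣) (exchange x y)) (evenᵇ-ℤsuc (x ℤ.+ y))
  where
  exchange : ∀ x y → x ℤ.+ ℤ.suc y ≡ ℤ.suc (x ℤ.+ y)
  exchange x y = trans (sym (ℤ.+-assoc x (+ 1) y)) (trans (cong (ℤ._+ y) (ℤ.+-comm x (+ 1))) (ℤ.+-assoc (+ 1) x y))

module _ {R : Region d n} (distinct : Unique R) where

  lookup-region-injective : ∀ {i j} → lookup R i ≡ lookup R j → i ≡ j
  lookup-region-injective = Unique.lookup-injective distinct _ _

  isShift-functional : ∀ {k i j j′} → IsShift R k i j → IsShift R k i j′ → j ≡ j′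
  isShift-functional p q = lookup-region-injective (trans p (sym q))

module Colours {R : Region 2 n} where

  colour : Fin n → Bool
  colour i = lookup (white R) i

  isShift-colour : ∀ {k i j} → IsShift R k i j → colour j ≡ not (colour i)
  isShift-colour {k} {i} {j} p = begin
    lookup (white R) j           ≡⟨ Vec.lookup-map j isWhite R ⟩
    isWhite (lookup R j)         ≡⟨ cong isWhite p ⟩
    isWhite (shift k (lookup R i)) ≡⟨ isWhite-shift k (lookup R i) ⟩
    not (isWhite (lookup R i))   ≡⟨ cong not (Vec.lookup-map i isWhite R) ⟨
    not (lookup (white R) i)     ∎
    where open ≡-Reasoning

  isShift-≢ : ∀ {k i} → ¬ IsShift R k i i
  isShift-≢ p = Bool.not-¬ refl (isShift-colour p)

  adjacent-colour : ∀ {i j} → Adjacent R i j → colour j ≡ not (colour i)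
  adjacent-colour (k , inj₁ p) = isShift-colour p
  adjacent-colour (k , inj₂ p) = trans (sym (Bool.not-involutive _)) (cong not (sym (isShift-colour p)))

module _ {R : Region 2 n} (distinct : Unique R) where
  open Colours {R = R}

  private
    Matched : DominoSet 2 n → Fin n → Fin n → Set
    Matched t i j = ∃[ δ ] (δ ∈ᵈ t × Covers R δ i × Covers R δ j × colour j ≡ not (colour i))

    matched-injective : ∀ {t i i′ j c} → PairwiseDisjoint R t → colour i ≡ c → colour i′ ≡ c →
                        Matched t i j → Matched t i′ j → i ≡ i′
    matched-injective disj ci ci′ ((_ , _) , δ∈ , ci-δ , cj-δ , cij) (_ , δ′∈ , ci′-δ′ , cj-δ′ , ci′j)
      with refl ← disj _ _ _ _ _ δ∈ δ′∈ cj-δ cj-δ′ with ci-δ | ci′-δ′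
    ... | inj₁ refl | inj₁ refl = refl
    ... | inj₂ p    | inj₂ q    = isShift-functional distinct p q
    ... | inj₁ refl | inj₂ q    = contradiction (trans (trans ci (sym ci′)) (isShift-colour q)) (Bool.not-¬ refl)
    ... | inj₂ p    | inj₁ refl = contradiction (trans (trans ci′ (sym ci)) (isShift-colour p)) (Bool.not-¬ refl)

    matched-total : ∀ {S t i} → IsTiling R S t → i ∈ S → ∃[ j ] (j ∈ S × Matched t i j)
    matched-total {i = i} (contained , covering , _) i∈S with covering i i∈S
    ... | i , k , δ∈ , inj₁ refl with j , j∈S , p ← proj₂ (contained i k δ∈) =
      j , j∈S , (i , k) , δ∈ , inj₁ refl , inj₂ p , isShift-colour p
    ... | i′ , k , δ∈ , inj₂ p = i′ , proj₁ (contained i′ k δ∈) , (i′ , k) , δ∈ , inj₂ p , inj₁ refl ,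
      trans (sym (Bool.not-involutive _)) (cong not (sym (isShift-colour p)))

  -- Every domino pairs a white square with a black one; the pairing is injective from white to
  -- black and from black to white.
  tiling-balanced : ∀ {S t} → IsTiling R S t → BalancedSet R S
  tiling-balanced {S} {t} tiles@(_ , _ , disj) = ℕ.≤-antisym
    (∣∣-≤ (Matched t) {S ∩ W} {S ∩ ∁ W}
      (λ i∈ → let i∈S , i∈W = x∈p∩q⁻ S _ i∈ ; j , j∈S , m = matched-total {S} {t} tiles i∈S in
         j , x∈p∩q⁺ (j∈S , x∉p⇒x∈∁p {p = W} (lookup⇒∉ {S = W} (trans (opposite-colour m) (cong not (∈⇒lookup i∈W))))) , m)
      (λ i∈ i′∈ → matched-injective {t} disj (∈⇒lookup (proj₂ (x∈p∩q⁻ S _ i∈))) (∈⇒lookup (proj₂ (x∈p∩q⁻ S _ i′∈)))))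
    (∣∣-≤ (Matched t) {S ∩ ∁ W} {S ∩ W}
      (λ i∈ → let i∈S , i∈B = x∈p∩q⁻ S _ i∈ ; j , j∈S , m = matched-total {S} {t} tiles i∈S in
         j , x∈p∩q⁺ (j∈S , lookup⇒∈ {S = W} (trans (opposite-colour m) (cong not (black i∈B)))) , m)
      (λ i∈ i′∈ → matched-injective {t} disj (black (proj₂ (x∈p∩q⁻ S _ i∈))) (black (proj₂ (x∈p∩q⁻ S _ i′∈)))))
    where
    W = white R
    opposite-colour : ∀ {i j} → Matched t i j → colour j ≡ not (colour i)
    opposite-colour (_ , _ , _ , _ , c) = c
    black : ∀ {i} → i ∈ ∁ (white R) → colour i ≡ false
    black i∈ = ∉⇒lookup (x∈∁p⇒x∉p i∈)

-- This is how balance climbs from floor to floor: the disk, the plug below and the tiled part are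
-- balanced, hence so is the plug above.
balanced-remainder : {R : Region 2 n} {p q : Subset n} → Empty (p ∩ q) → BalancedSet R full →
  BalancedSet R p → BalancedSet R (∁ (p ∪ q)) → BalancedSet R q
balanced-remainder {R = R} {p} {q} disj bal-full bal-p bal-r =
  ℕ.+-cancelˡ-≡ ∣ p ∩ W ∣ _ _ (ℕ.+-cancelʳ-≡ ∣ ∁ (p ∪ q) ∩ W ∣ _ _ (begin
    ∣ p ∩ W ∣ ℕ.+ ∣ q ∩ W ∣ ℕ.+ ∣ ∁ (p ∪ q) ∩ W ∣        ≡⟨ ∣∣-three-parts p q W disj ⟨
    ∣ full ∩ W ∣                                         ≡⟨ bal-full ⟩
    ∣ full ∩ ∁ W ∣                                       ≡⟨ ∣∣-three-parts p q (∁ W) disj ⟩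
    ∣ p ∩ ∁ W ∣ ℕ.+ ∣ q ∩ ∁ W ∣ ℕ.+ ∣ ∁ (p ∪ q) ∩ ∁ W ∣  ≡⟨ cong₂ (λ k l → k ℕ.+ ∣ q ∩ ∁ W ∣ ℕ.+ l) bal-p bal-r ⟨
    ∣ p ∩ W ∣ ℕ.+ ∣ q ∩ ∁ W ∣ ℕ.+ ∣ ∁ (p ∪ q) ∩ W ∣      ∎))
  where
  open ≡-Reasoning
  W = white R

-- Insertion and deletion of dominoes

put : Side → Domino d n → DominoSet d n → DominoSet d n
put s (i , k) t = t [ i ]%= (_[ k ]≔ s)

lookup-put : ∀ s (δ : Domino d n) t → lookup (lookup (put s δ t) (proj₁ δ)) (proj₂ δ) ≡ s
lookup-put s (i , k) t = trans (cong (λ S → lookup S k) (Vec.lookup∘updateAt i t)) (Vec.lookup∘updateAt k (lookup t i))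

lookup-put-other : ∀ s (δ δ′ : Domino d n) t → δ′ ≢ δ →
  lookup (lookup (put s δ t) (proj₁ δ′)) (proj₂ δ′) ≡ lookup (lookup t (proj₁ δ′)) (proj₂ δ′)
lookup-put-other s (i , k) (i′ , k′) t ≢ with i′ Fin.≟ i
... | no i′≢i  = cong (λ S → lookup S k′) (Vec.lookup∘updateAt′ i′ i i′≢i t)
... | yes refl = trans (cong (λ S → lookup S k′) (Vec.lookup∘updateAt i t))
                       (Vec.lookup∘updateAt′ k′ k (≢ ∘ cong (i ,_)) (lookup t i))

∉-delete : (δ : Domino d n) (t : DominoSet d n) → ¬ δ ∈ᵈ delete δ t
∉-delete δ t = lookup⇒∉ (lookup-put outside δ t)

∈-put⁻ : ∀ s {δ δ′ : Domino d n} {t} → δ′ ≢ δ → δ′ ∈ᵈ put s δ t → δ′ ∈ᵈ t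
∈-put⁻ s {δ} {δ′} {t} ≢ p = lookup⇒∈ (trans (sym (lookup-put-other s δ δ′ t ≢)) (∈⇒lookup p))

∈-put⁺ : ∀ s {δ δ′ : Domino d n} {t} → δ′ ≢ δ → δ′ ∈ᵈ t → δ′ ∈ᵈ put s δ t
∈-put⁺ s {δ} {δ′} {t} ≢ p = lookup⇒∈ (trans (lookup-put-other s δ δ′ t ≢) (∈⇒lookup p))

_≟ᵈ_ : DecidableEquality (Domino d n)
_≟ᵈ_ = Product.≡-dec Fin._≟_ Fin._≟_

∈-delete⁻ : {δ δ′ : Domino d n} {t : DominoSet d n} → δ′ ∈ᵈ delete δ t → δ′ ≢ δ × δ′ ∈ᵈ t
∈-delete⁻ {δ = δ} {δ′} {t} p = ≢ , ∈-put⁻ outside {t = t} ≢ p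
  where
  ≢ : δ′ ≢ δ
  ≢ refl = ∉-delete δ t p

insert-delete : (δ : Domino d n) (t : DominoSet d n) → δ ∈ᵈ t → insert δ (delete δ t) ≡ t
insert-delete (i , k) t δ∈ = begin
  (t [ i ]%= (_[ k ]≔ outside)) [ i ]%= (_[ k ]≔ inside) ≡⟨ Vec.updateAt-updateAt i t ⟩
  t [ i ]%= (λ S → (S [ k ]≔ outside) [ k ]≔ inside)   ≡⟨ Vec.updateAt-id-local i t (trans (Vec.[]≔-idempotent (lookup t i) k) (trans
      (cong (lookup t i [ k ]≔_) (sym (∈⇒lookup δ∈))) (Vec.[]≔-lookup (lookup t i) k))) ⟩
  t ∎
  where open ≡-Reasoning

put-commutes : ∀ s s′ (δ δ′ : Domino d n) t → δ ≢ δ′ → put s δ (put s′ δ′ t) ≡ put s′ δ′ (put s δ t)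
put-commutes s s′ (i , k) (i′ , k′) t ≢ with i Fin.≟ i′
... | no i≢i′  = Vec.updateAt-commutes i i′ i≢i′ t
... | yes refl = begin
  (t [ i ]%= (_[ k′ ]≔ s′)) [ i ]%= (_[ k ]≔ s)  ≡⟨ Vec.updateAt-updateAt i t ⟩
  t [ i ]%= (λ S → (S [ k′ ]≔ s′) [ k ]≔ s)    ≡⟨ Vec.updateAt-cong i (λ S → Vec.[]≔-commutes S k′ k (λ { refl → ≢ refl })) t ⟩
  t [ i ]%= (λ S → (S [ k ]≔ s) [ k′ ]≔ s′)    ≡⟨ Vec.updateAt-updateAt i t ⟨
  (t [ i ]%= (_[ k ]≔ s)) [ i ]%= (_[ k′ ]≔ s′)  ∎
  where open ≡-Reasoning

module _ {R : Region d n} (distinct : Unique R) where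

  covers-ends : ∀ {i k j m} → IsShift R k i j → Covers R (i , k) m → m ≡ i ⊎ m ≡ j
  covers-ends p (inj₁ m≡i) = inj₁ m≡i
  covers-ends p (inj₂ q)   = inj₂ (isShift-functional distinct q p)

  -- Disjointness keeps every other domino off `i` and `j`. The smaller region `S′` is characterised
  -- by its members, so that it may have the form of the complement of two plugs.
  delete-tiling : ∀ {S S′ t i k j} → IsTiling R S t → (i , k) ∈ᵈ t → IsShift R k i j →
    (∀ {m} → m ∈ S → m ≢ i → m ≢ j → m ∈ S′) → (∀ {m} → m ∈ S′ → m ∈ S × m ≢ i × m ≢ j) →
    IsTiling R S′ (delete (i , k) t)
  delete-tiling {S} {S′} {t} {i} {k} {j} (contained , covering , disj) δ∈ p into out =
    contained′ , covering′ ,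
    λ i₁ k₁ i₂ k₂ m q₁ q₂ → disj i₁ k₁ i₂ k₂ m (proj₂ (∈-delete⁻ {t = t} q₁)) (proj₂ (∈-delete⁻ {t = t} q₂))
    where
    remaining : ∀ {δ m} → δ ∈ᵈ delete (i , k) t → Covers R δ m → m ∈ S → m ∈ S′
    remaining {δ} q c m∈S with ≢ , q′ ← ∈-delete⁻ {t = t} q =
      into m∈S (λ { refl → ≢ (disj _ _ _ _ _ q′ δ∈ c (inj₁ refl)) })
               (λ { refl → ≢ (disj _ _ _ _ _ q′ δ∈ c (inj₂ p)) })
    contained′ : Contained R S′ (delete (i , k) t)
    contained′ i₁ k₁ q with contained i₁ k₁ (proj₂ (∈-delete⁻ {t = t} q))
    ... | i₁∈S , j₁ , j₁∈S , p₁ =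
      remaining q (inj₁ refl) i₁∈S , j₁ , remaining q (inj₂ p₁) j₁∈S , p₁
    covering′ : Covering R S′ (delete (i , k) t)
    covering′ m m∈S′ with m∈S , m≢i , m≢j ← out m∈S′ with covering m m∈S
    ... | i₁ , k₁ , q , c = i₁ , k₁ , ∈-put⁺ outside {t = t} (λ { refl → [ m≢i , m≢j ]′ (covers-ends p c) }) q , c

-- Coordinates of the cylinder and pairs of squares

does⇒ : ∀ {A : Set} (A? : Dec A) → does A? ≡ true → A
does⇒ (yes a) _ = a

lookup-ext : ∀ {A : Set} {n} {xs ys : Vec A n} → (∀ i → lookup xs i ≡ lookup ys i) → xs ≡ ys
lookup-ext {xs = xs} {ys} eq = trans (sym (Vec.tabulate∘lookup xs)) (trans (Vec.tabulate-cong eq) (Vec.tabulate∘lookup ys))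

shift-∷ʳ : ∀ (k : Fin d) (c : Cube d) z → shift (inject₁ k) (c ∷ʳ z) ≡ shift k c ∷ʳ z
shift-∷ʳ zero    (x ∷ c) z = refl
shift-∷ʳ (suc k) (x ∷ c) z = cong (x ∷_) (shift-∷ʳ k c z)

shift-∷ʳ-last : ∀ (c : Cube d) z → shift (Fin.fromℕ d) (c ∷ʳ z) ≡ c ∷ʳ ℤ.suc z
shift-∷ʳ-last []      z = refl
shift-∷ʳ-last (x ∷ c) z = cong (x ∷_) (shift-∷ʳ-last c z)

up : Fin 3
up = Fin.fromℕ 2

data DirectionView : Fin 3 → Set where
  horizontal : ∀ l → DirectionView (inject₁ l)
  upward     : DirectionView up

directionView : ∀ k → DirectionView k
directionView zero             = horizontal zero
directionView (suc zero)       = horizontal (suc zero)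
directionView (suc (suc zero)) = upward

inject₁≢up : ∀ {l : Fin 2} → inject₁ l ≢ up
inject₁≢up {zero}     ()
inject₁≢up {suc zero} ()

data IndexView {n N} : Fin (n ℕ.* N) → Set where
  combined : ∀ i k → IndexView {n} {N} (combine {n} {N} i k)

indexView : ∀ {n N} (m : Fin (n ℕ.* N)) → IndexView {n} {N} m
indexView {n} {N} m with i , k , refl ← Fin.combine-surjective {n} {N} m = combined i k

insert-∪ : ∀ {n} (S : Subset n) i → S [ i ]≔ inside ≡ S ∪ ⁅ i ⁆
insert-∪ (s ∷ S) zero    = cong₂ _∷_ (sym (Bool.∨-zeroʳ s)) (sym (∪-identityʳ S))
insert-∪ (s ∷ S) (suc i) = cong₂ _∷_ (sym (Bool.∨-identityʳ s)) (insert-∪ S i)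

insert-pair : ∀ {n} (S : Subset n) i j → (S [ j ]≔ inside) [ i ]≔ inside ≡ S ∪ (⁅ i ⁆ ∪ ⁅ j ⁆)
insert-pair S i j = begin
  (S [ j ]≔ inside) [ i ]≔ inside ≡⟨ insert-∪ (S [ j ]≔ inside) i ⟩
  (S [ j ]≔ inside) ∪ ⁅ i ⁆       ≡⟨ cong (_∪ ⁅ i ⁆) (insert-∪ S j) ⟩
  (S ∪ ⁅ j ⁆) ∪ ⁅ i ⁆             ≡⟨ ∪-assoc S ⁅ j ⁆ ⁅ i ⁆ ⟩
  S ∪ (⁅ j ⁆ ∪ ⁅ i ⁆)             ≡⟨ cong (S ∪_) (∪-comm ⁅ j ⁆ ⁅ i ⁆) ⟩
  S ∪ (⁅ i ⁆ ∪ ⁅ j ⁆)             ∎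
  where open ≡-Reasoning

remove-∉ : ∀ {n} (S : Subset n) i → i ∉ S [ i ]≔ outside
remove-∉ S i = lookup⇒∉ (Vec.lookup∘updateAt i S)

reinsert : ∀ {n} (S : Subset n) i → i ∈ S → (S [ i ]≔ outside) [ i ]≔ inside ≡ S
reinsert S i i∈S = trans (Vec.[]≔-idempotent S i)
  (trans (cong (S [ i ]≔_) (sym (∈⇒lookup i∈S))) (Vec.[]≔-lookup S i))

remove-∉′ : ∀ {n} (S : Subset n) {i j} → j ≢ i → j ∉ S → j ∉ S [ i ]≔ outside
remove-∉′ S {i} {j} j≢i j∉S = lookup⇒∉ (trans (Vec.lookup∘updateAt′ j i j≢i S) (∉⇒lookup j∉S))

reinsert-pair : ∀ {n} (S : Subset n) {i j} → i ≢ j → i ∈ S → j ∈ S →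
  S ≡ ((S [ j ]≔ outside) [ i ]≔ outside) ∪ (⁅ i ⁆ ∪ ⁅ j ⁆)
reinsert-pair S {i} {j} i≢j i∈S j∈S = sym (begin
  ((S [ j ]≔ outside) [ i ]≔ outside) ∪ (⁅ i ⁆ ∪ ⁅ j ⁆)
    ≡⟨ insert-pair ((S [ j ]≔ outside) [ i ]≔ outside) i j ⟨
  (((S [ j ]≔ outside) [ i ]≔ outside) [ j ]≔ inside) [ i ]≔ inside
    ≡⟨ cong (_[ i ]≔ inside) (Vec.[]≔-commutes (S [ j ]≔ outside) i j i≢j) ⟩
  (((S [ j ]≔ outside) [ j ]≔ inside) [ i ]≔ outside) [ i ]≔ inside
    ≡⟨ cong (λ T → (T [ i ]≔ outside) [ i ]≔ inside) (reinsert S j j∈S) ⟩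
  (S [ i ]≔ outside) [ i ]≔ inside
    ≡⟨ reinsert S i i∈S ⟩
  S ∎)
  where open ≡-Reasoning

module _ {n : ℕ} (R : Region 2 n) (distinct : Unique R) (N : ℕ) where

  private C = cylinder R N

  lookup-cylinder : ∀ i k → lookup C (combine i k) ≡ lookup R i ∷ʳ (+ toℕ k)
  lookup-cylinder i k = trans (Vec.lookup-map (combine i k) _ (Vec.allPairs R (Vec.allFin N)))
    (cong (λ (c , k) → c ∷ʳ (+ toℕ k)) (trans (Vec.lookup-⊛* (Vec.map _,_ R) (Vec.allFin N) i k)
      (cong₂ (λ f x → f x) (Vec.lookup-map i _,_ R) (Vec.lookup-allFin k))))

  shift-horizontal⁺ : ∀ {l i j} k → IsShift R l i j → IsShift C (inject₁ l) (combine i k) (combine j k)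
  shift-horizontal⁺ {l} {i} {j} k p = begin
    lookup C (combine j k)                     ≡⟨ lookup-cylinder j k ⟩
    lookup R j ∷ʳ (+ toℕ k)                    ≡⟨ cong (_∷ʳ (+ toℕ k)) p ⟩
    shift l (lookup R i) ∷ʳ (+ toℕ k)          ≡⟨ shift-∷ʳ l (lookup R i) (+ toℕ k) ⟨
    shift (inject₁ l) (lookup R i ∷ʳ (+ toℕ k)) ≡⟨ cong (shift (inject₁ l)) (lookup-cylinder i k) ⟨
    shift (inject₁ l) (lookup C (combine i k)) ∎
    where open ≡-Reasoning

  shift-horizontal⁻ : ∀ {l i j k m} → IsShift C (inject₁ l) (combine i k) (combine j m) → IsShift R l i j × m ≡ k
  shift-horizontal⁻ {l} {i} {j} {k} {m} p = 
    Product.map id (Fin.toℕ-injective ∘ ℤ.+-injective) (Vec.∷ʳ-injective (lookup R j) (shift l (lookup R i)) eq)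
    where
    eq : lookup R j ∷ʳ (+ toℕ m) ≡ shift l (lookup R i) ∷ʳ (+ toℕ k)
    eq = begin
      lookup R j ∷ʳ (+ toℕ m)                     ≡⟨ lookup-cylinder j m ⟨
      lookup C (combine j m)                      ≡⟨ p ⟩
      shift (inject₁ l) (lookup C (combine i k))  ≡⟨ cong (shift (inject₁ l)) (lookup-cylinder i k) ⟩
      shift (inject₁ l) (lookup R i ∷ʳ (+ toℕ k)) ≡⟨ shift-∷ʳ l (lookup R i) (+ toℕ k) ⟩
      shift l (lookup R i) ∷ʳ (+ toℕ k)           ∎
      where open ≡-Reasoning

  shift-up⁺ : ∀ {k m} i → toℕ m ≡ suc (toℕ k) → IsShift C up (combine i k) (combine i m)
  shift-up⁺ {k} {m} i p = begin
    lookup C (combine i m)             ≡⟨ lookup-cylinder i m ⟩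
    lookup R i ∷ʳ (+ toℕ m)            ≡⟨ cong (λ z → lookup R i ∷ʳ (+ z)) p ⟩
    lookup R i ∷ʳ ℤ.suc (+ toℕ k)      ≡⟨ shift-∷ʳ-last (lookup R i) (+ toℕ k) ⟨
    shift up (lookup R i ∷ʳ (+ toℕ k)) ≡⟨ cong (shift up) (lookup-cylinder i k) ⟨
    shift up (lookup C (combine i k))  ∎
    where open ≡-Reasoning

  shift-up⁻ : ∀ {i j k m} → IsShift C up (combine i k) (combine j m) → j ≡ i × toℕ m ≡ suc (toℕ k)
  shift-up⁻ {i} {j} {k} {m} p =
    Product.map (lookup-region-injective distinct) ℤ.+-injective (Vec.∷ʳ-injective (lookup R j) (lookup R i) eq)
    where
    eq : lookup R j ∷ʳ (+ toℕ m) ≡ lookup R i ∷ʳ ℤ.suc (+ toℕ k)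
    eq = begin
      lookup R j ∷ʳ (+ toℕ m)            ≡⟨ lookup-cylinder j m ⟨
      lookup C (combine j m)             ≡⟨ p ⟩
      shift up (lookup C (combine i k))  ≡⟨ cong (shift up) (lookup-cylinder i k) ⟩
      shift up (lookup R i ∷ʳ (+ toℕ k)) ≡⟨ shift-∷ʳ-last (lookup R i) (+ toℕ k) ⟩
      lookup R i ∷ʳ ℤ.suc (+ toℕ k)      ∎
      where open ≡-Reasoning

-- Enumerations without repetition and parity

module _ {A : Set} where

  -- Lengths and collision forms depend on lists only up to permutation, so it suffices to compare
  -- enumerations as sets.
  unique-↭ : {xs ys : List A} → UniqueL xs → UniqueL ys →
             (∀ {z} → z ∈ˡ xs → z ∈ˡ ys) → (∀ {z} → z ∈ˡ ys → z ∈ˡ xs) → xs ↭ ys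
  unique-↭ uniq uniq′ ⊆ ⊇ = ∼bag⇒↭ (unique∧set⇒bag uniq uniq′ (mk⇔ ⊆ ⊇))

module _ {A B : Set} (f : A → Maybe B) where

  ∈-mapMaybe⁻ : ∀ xs {y} → y ∈ˡ mapMaybe f xs → ∃[ x ] (x ∈ˡ xs × f x ≡ just y)
  ∈-mapMaybe⁻ (x ∷ xs) y∈ with f x in eq
  ... | nothing = let x′ , x′∈ , e = ∈-mapMaybe⁻ xs y∈ in x′ , there x′∈ , e
  ∈-mapMaybe⁻ (x ∷ xs) (here refl) | just _ = x , here refl , eq
  ∈-mapMaybe⁻ (x ∷ xs) (there y∈)  | just _ = let x′ , x′∈ , e = ∈-mapMaybe⁻ xs y∈ in x′ , there x′∈ , e

  mapMaybe-unique : (∀ {x x′ y} → f x ≡ just y → f x′ ≡ just y → x ≡ x′) →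
                    ∀ {xs} → UniqueL xs → UniqueL (mapMaybe f xs)
  mapMaybe-unique inj {[]}     []            = []
  mapMaybe-unique inj {x ∷ xs} (x∉xs ∷ uniq) with f x in eq
  ... | nothing = mapMaybe-unique inj uniq
  ... | just y  = All.tabulate (λ y′∈ y≡y′ → let x′ , x′∈ , e = ∈-mapMaybe⁻ xs y′∈ in
                    All.lookup x∉xs x′∈ (inj eq (trans e (cong just (sym y≡y′)))))
                  ∷ mapMaybe-unique inj uniq

  ∈-mapMaybe⁺ : ∀ {xs x y} → x ∈ˡ xs → f x ≡ just y → y ∈ˡ mapMaybe f xs
  ∈-mapMaybe⁺ {x ∷ xs} (here refl) e with f x
  ∈-mapMaybe⁺ {x ∷ xs} (here refl) refl | just _ = here refl
  ∈-mapMaybe⁺ {x ∷ xs} (there x∈) e with f x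
  ... | just _  = there (∈-mapMaybe⁺ x∈ e)
  ... | nothing = ∈-mapMaybe⁺ x∈ e

sides-unique : UniqueL sides
sides-unique = ((λ ()) ∷ []) ∷ [] ∷ []

∷-cartesian-unique : ∀ {A : Set} {n} {xs : List A} {ys : List (Vec A n)} →
  UniqueL xs → UniqueL ys → UniqueL (cartesianProductWith Vec._∷_ xs ys)
∷-cartesian-unique = UniqueL.cartesianProductWith⁺ Vec._∷_ Vec.∷-injective

subsets-unique : ∀ d → UniqueL (subsets d)
subsets-unique zero    = [] ∷ []
subsets-unique (suc d) = ∷-cartesian-unique sides-unique (subsets-unique d)

dominoSets-unique : ∀ d n → UniqueL (dominoSets d n)
dominoSets-unique d zero    = [] ∷ []
dominoSets-unique d (suc n) = ∷-cartesian-unique (subsets-unique d) (dominoSets-unique d n)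

tiling-≡ : ∀ {R : Region d n} {S} {t u : Tiling R S} → dominoes t ≡ dominoes u → t ≡ u
tiling-≡ refl = refl

toTiling-just : ∀ (R : Region d n) S {t u} → toTiling R S t ≡ just u → dominoes u ≡ t
toTiling-just R S {t} eq with isTiling? R S t
toTiling-just R S refl | yes _ = refl

tilings-unique : ∀ (R : Region d n) S → UniqueL (tilings R S)
tilings-unique R S = mapMaybe-unique (toTiling R S)
  (λ {t} {t′} e e′ → trans (sym (toTiling-just R S {t} e)) (toTiling-just R S {t′} e′)) (dominoSets-unique _ _)

parity-*2 : ∀ h → parity (h ℕ.* 2) ≡ 0ℙ
parity-*2 zero    = refl
parity-*2 (suc h) = parity-*2 h

half-of-even : ∀ n → parity n ≡ 0ℙ → ∃[ h ] n ≡ h ℕ.* 2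
half-of-even zero          _ = 0 , refl
half-of-even (suc (suc n)) e with h , refl ← half-of-even n e = suc h , refl

even-+ : ∀ m {n} → parity m ≡ 0ℙ → parity n ≡ 0ℙ → parity (m ℕ.+ n) ≡ 0ℙ
even-+ m {n} e e′ = trans (ℙ.+-homo-+ m n) (cong₂ ℙ._+_ e e′)

even-+⁻ : ∀ m {n} → parity m ≡ 0ℙ → parity (m ℕ.+ n) ≡ 0ℙ → parity n ≡ 0ℙ
even-+⁻ m {n} e e′ = trans (sym (cong (ℙ._+ parity n) e)) (trans (sym (ℙ.+-homo-+ m n)) e′)

∈⇒≤sum : ∀ {ns n} → n ∈ˡ ns → n ℕ.≤ sum ns
∈⇒≤sum {n ∷ ns} (here refl) = ℕ.m≤m+n n (sum ns)
∈⇒≤sum {m ∷ ns} (there n∈)  = ℕ.≤-trans (∈⇒≤sum n∈) (ℕ.m≤n+m (sum ns) m)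

uninhabited⇒[] : ∀ {A : Set} → ¬ A → (xs : List A) → xs ≡ []
uninhabited⇒[] ¬A []      = refl
uninhabited⇒[] ¬A (x ∷ _) = contradiction x ¬A

-- Abstract, so that conversion checking does not unfold the decision procedure for ≈.
abstract
  equivalentPairs : ∀ {d n} {R : Region d n} {S : Subset n} → List (Tiling R S) → ℕ
  equivalentPairs T = length (filter (uncurry _≈?_) (cartesianProduct T T))

  equivalentPairs-≡ : ∀ {d n} {R : Region d n} {S : Subset n} (T : List (Tiling R S)) →
    equivalentPairs T ≡ length (filter (uncurry _≈?_) (cartesianProduct T T))
  equivalentPairs-≡ T = refl

empty-or-inhabited : ∀ {A : Set} (xs : List A) → xs ≡ [] ⊎ A
empty-or-inhabited []      = inj₁ refl
empty-or-inhabited (x ∷ _) = inj₂ x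

-- Paths and walks in the 2-complex

module Disk {n : ℕ} (R : Region 2 n) (distinct : Unique R) (balanced-full : BalancedSet R full)
  (nontrivial : ¬ (∀ i → ∣ tabulate (λ j → does (adjacent? R i j)) ∣ ℕ.≤ 2)) where

  open DominoComplex R public

  ◅◅-identityʳ : ∀ {p q} (γ : Path p q) → γ ◅◅ ε ≡ γ
  ◅◅-identityʳ ε       = refl
  ◅◅-identityʳ (s ◅ γ) = cong (s ◅_) (◅◅-identityʳ γ)

  ≡⇒≃ : ∀ {p q} {γ δ : Path p q} → γ ≡ δ → γ ≃ δ
  ≡⇒≃ refl = ≃-refl

  ◅-cong : ∀ {p q r} {s s′ : Step p q} {γ γ′ : Path q r} → s ◅ ε ≃ s′ ◅ ε → γ ≃ γ′ → s ◅ γ ≃ s′ ◅ γ′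
  ◅-cong = ≃-cong

  ◅-congʳ : ∀ {p q r} {s : Step p q} {γ γ′ : Path q r} → γ ≃ γ′ → s ◅ γ ≃ s ◅ γ′
  ◅-congʳ = ◅-cong ≃-refl

  ◅◅-congˡ : ∀ {p q r} {γ γ′ : Path p q} {δ : Path q r} → γ ≃ γ′ → γ ◅◅ δ ≃ γ′ ◅◅ δ
  ◅◅-congˡ e = ≃-cong e ≃-refl

  ◅◅-congʳ : ∀ {p q r} {γ : Path p q} {δ δ′ : Path q r} → δ ≃ δ′ → γ ◅◅ δ ≃ γ ◅◅ δ′
  ◅◅-congʳ {γ = γ} e = ≃-cong {γ = γ} ≃-refl e

  cancel′ : ∀ {p q} (s : Step p q) → rev s ◅ s ◅ ε ≃ ε
  cancel′ s = subst (λ s′ → rev s ◅ s′ ◅ ε ≃ ε) (rev-involutive s) (cancel (rev s))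

  inverseʳ : ∀ {p q} (γ : Path p q) → γ ◅◅ inverse γ ≃ ε
  inverseʳ ε       = ≃-refl
  inverseʳ (s ◅ γ) = ≃-trans
    (◅-congʳ (≃-trans (≡⇒≃ (sym (Star.◅◅-assoc γ (inverse γ) _))) (◅◅-congˡ (inverseʳ γ))))
    (cancel s)

  inverseˡ : ∀ {p q} (γ : Path p q) → inverse γ ◅◅ γ ≃ ε
  inverseˡ ε       = ≃-refl
  inverseˡ (s ◅ γ) = ≃-trans (≡⇒≃ (Star.◅◅-assoc (inverse γ) (rev s ◅ ε) (s ◅ γ)))
    (≃-trans (◅◅-congʳ {γ = inverse γ} (◅◅-congˡ (cancel′ s))) (inverseˡ γ))

  pathLength-inverse : ∀ {p q} (γ : Path p q) → pathLength (inverse γ) ≡ pathLength γ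
  pathLength-inverse ε       = refl
  pathLength-inverse (s ◅ γ) = trans (pathLength-◅◅ (inverse γ) (rev s ◅ ε))
    (trans (ℕ.+-comm _ 1) (cong suc (pathLength-inverse γ)))

  trivial-quotient : ∀ {p q} (γ δ : Path p q) → γ ◅◅ inverse δ ≃ ε → γ ≃ δ
  trivial-quotient γ δ e = ≃-trans (≡⇒≃ (sym (◅◅-identityʳ γ)))
    (≃-trans (◅◅-congʳ {γ = γ} (≃-sym (inverseˡ δ)))
      (≃-trans (≡⇒≃ (sym (Star.◅◅-assoc γ (inverse δ) δ))) (◅◅-congˡ e)))

  stepDominoes-rev : ∀ {p q} (s : Step p q) → stepDominoes (rev s) ≡ stepDominoes s
  stepDominoes-rev (edge _ _ _) = refl
  stepDominoes-rev (loop _ _)   = refl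

  -- The projective plane attached along `f * f` makes the loop its own inverse, so its orientation
  -- is immaterial.
  loop-sign : ∀ ± f → loop ± f ◅ ε ≃ loop (opposite ±) f ◅ ε
  loop-sign ± f = trivial-quotient (loop ± f ◅ ε) (loop (opposite ±) f ◅ ε)
    (subst (λ s → loop ± f ◅ s ◅ ε ≃ ε) (sym (rev-involutive (loop ± f))) (fill (projective ± f)))

  loop-unsigned : ∀ ± ±′ f → loop ± f ◅ ε ≃ loop ±′ f ◅ ε
  loop-unsigned Sign.+ Sign.+ f = ≃-refl
  loop-unsigned Sign.+ Sign.- f = loop-sign Sign.+ f
  loop-unsigned Sign.- Sign.+ f = loop-sign Sign.- f
  loop-unsigned Sign.- Sign.- f = ≃-refl

  -- An edge differs from another at most in irrelevant proofs, a loop also in its sign. An edge and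
  -- a loop never compete, as an edge joins distinct plugs.
  step-≃ : ∀ {p q} (s s′ : Step p q) → stepDominoes s ≡ stepDominoes s′ → s ◅ ε ≃ s′ ◅ ε
  step-≃ (edge _ _ (tiling t _)) (edge _ _ (tiling .t _)) refl = ≃-refl
  step-≃ (loop ± (tiling t _))   (loop ±′ (tiling .t _))  refl = loop-unsigned ± ±′ (tiling t _)
  step-≃ (edge p≢q _ _)          (loop _ _)               _    = ⊥-elim-irr (p≢q refl)
  step-≃ (loop _ _)              (edge p≢q _ _)           _    = ⊥-elim-irr (p≢q refl)

  -- The quadrilateral cut into its two sides from `p₁` to `p₄`. Passing from one to the other is a
  -- vertical flip: the domino `δ` of the plug `p₂` stands for two vertical dominoes, which become
  -- two copies of `δ` in adjacent floors.
  quadrilateral-≃ : ∀ {p₁ p₂ p₃ p₄} (δ : Domino 2 n) → IsUnionWith p₂ p₃ δ →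
    (s₁₂ : Step p₁ p₂) (s₂₄ : Step p₂ p₄) (s₁₃ : Step p₁ p₃) (s₃₄ : Step p₃ p₄) →
    stepDominoes s₁₃ ≡ insert δ (stepDominoes s₁₂) → stepDominoes s₃₄ ≡ insert δ (stepDominoes s₂₄) →
    s₁₂ ◅ s₂₄ ◅ ε ≃ s₁₃ ◅ s₃₄ ◅ ε
  quadrilateral-≃ δ union s₁₂ s₂₄ s₁₃ s₃₄ eq eq′ =
    trivial-quotient (s₁₂ ◅ s₂₄ ◅ ε) (s₁₃ ◅ s₃₄ ◅ ε)
      (fill (quadrilateral δ union s₁₂ s₂₄ (rev s₃₄) (rev s₁₃)
        (trans (stepDominoes-rev s₃₄) eq′) (trans (stepDominoes-rev s₁₃) eq)))

  open Colours {R = R}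

  -- If the two dominoes of a flip tile the whole disk, the disk is a 2 × 2 square and hence trivial.
  other-domino : ∀ {t k l i j c} → IsTiling R full t → k ≢ l → IsShift R l i j → IsShift R k i c →
    (i , k) ∈ᵈ t → (j , k) ∈ᵈ t → ∃[ δ ] (δ ∈ᵈ t × δ ≢ (i , k) × δ ≢ (j , k))
  other-domino {t} {k} {l} {i} {j} {c} (contained , covering , _) k≢l pj pc i∈ j∈
    with Fin.any? (λ i′ → Fin.any? λ k′ → (k′ ∈? lookup t i′) ×-dec ¬? ((i′ , k′) ≟ᵈ (i , k)) ×-dec ¬? ((i′ , k′) ≟ᵈ (j , k)))
  ... | yes (i′ , k′ , found) = (i′ , k′) , found
  ... | no none with e , _ , pe ← proj₂ (contained j k j∈) = contradiction small nontrivial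
    where
    other : ∀ {i′ k′} → (i′ , k′) ∈ᵈ t → (i′ , k′) ≡ (i , k) ⊎ (i′ , k′) ≡ (j , k)
    other {i′} {k′} δ∈ with (i′ , k′) ≟ᵈ (i , k) | (i′ , k′) ≟ᵈ (j , k)
    ... | yes eq | _      = inj₁ eq
    ... | no _   | yes eq = inj₂ eq
    ... | no ≢i  | no ≢j  = contradiction (i′ , k′ , δ∈ , ≢i , ≢j) none

    corner : ∀ m → (m ≡ i ⊎ m ≡ c) ⊎ (m ≡ j ⊎ m ≡ e)
    corner m with i′ , k′ , δ∈ , cov ← covering m ∈⊤ with other δ∈
    ... | inj₁ refl = inj₁ (covers-ends distinct pc cov)
    ... | inj₂ refl = inj₂ (covers-ends distinct pe cov)

    colour-e : colour e ≡ colour i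
    colour-e = trans (isShift-colour pe) (trans (cong not (isShift-colour pj)) (Bool.not-involutive _))

    at-most-two : ∀ {S x y} → (∀ {m} → m ∈ S → m ≡ x ⊎ m ≡ y) → ∣ S ∣ ℕ.≤ 2
    at-most-two {S} {x} {y} h = subst (ℕ._≤ 2) (length-elements S)
      (length-≤ _≡_ {ys = x ∷ y ∷ []} (elements-unique S)
        (λ {m} m∈ → m , [ here , there ∘ here ]′ (h (∈-elements⁻ m∈)) , refl)
        (λ _ _ eq eq′ → trans eq (sym eq′)))

    neighbour : ∀ {m m′} → m′ ∈ tabulate (λ m′ → does (adjacent? R m m′)) → colour m′ ≡ not (colour m)
    neighbour {m} {m′} m′∈ = adjacent-colour (does⇒ (adjacent? R m m′)
      (trans (sym (Vec.lookup∘tabulate (λ m′ → does (adjacent? R m m′)) m′)) (∈⇒lookup m′∈)))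

    -- The four corners of the square carry each colour twice, and neighbours have opposite colours.
    small : ∀ m → ∣ tabulate (λ m′ → does (adjacent? R m m′)) ∣ ℕ.≤ 2
    small m with colour m Bool.≟ colour i
    ... | yes eq = at-most-two {x = c} {j} λ {m′} m′∈ → classify m′ (trans (neighbour m′∈) (cong not eq))
      where
      classify : ∀ m′ → colour m′ ≡ not (colour i) → m′ ≡ c ⊎ m′ ≡ j
      classify m′ col with corner m′
      ... | inj₁ (inj₂ eq) = inj₁ eq
      ... | inj₂ (inj₁ eq) = inj₂ eq
      ... | inj₁ (inj₁ refl) = contradiction col (Bool.not-¬ refl)
      ... | inj₂ (inj₂ refl) = contradiction (trans (sym colour-e) col) (Bool.not-¬ refl)
    ... | no neq = at-most-two {x = i} {e} λ {m′} m′∈ → classify m′ (trans (neighbour m′∈) (trans (cong not (Bool.¬-not neq)) (Bool.not-involutive _)))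
      where
      classify : ∀ m′ → colour m′ ≡ colour i → m′ ≡ i ⊎ m′ ≡ e
      classify m′ col with corner m′
      ... | inj₁ (inj₁ eq) = inj₁ eq
      ... | inj₂ (inj₂ eq) = inj₂ eq
      ... | inj₁ (inj₂ refl) = contradiction (trans (sym col) (isShift-colour pc)) (Bool.not-¬ refl)
      ... | inj₂ (inj₁ refl) = contradiction (trans (sym col) (isShift-colour pj)) (Bool.not-¬ refl)

  ∉-pair : ∀ {x i j : Fin n} → x ≢ i → x ≢ j → x ∉ ⁅ i ⁆ ∪ ⁅ j ⁆
  ∉-pair {i = i} {j} x≢i x≢j x∈ with x∈p∪q⁻ ⁅ i ⁆ ⁅ j ⁆ x∈
  ... | inj₁ x∈i = x≢i (x∈⁅y⁆⇒x≡y i x∈i)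
  ... | inj₂ x∈j = x≢j (x∈⁅y⁆⇒x≡y j x∈j)

  ∉-pair⁻ : ∀ {x i j : Fin n} → x ∉ ⁅ i ⁆ ∪ ⁅ j ⁆ → x ≢ i × x ≢ j
  ∉-pair⁻ {i = i} {j} x∉ = (λ { refl → x∉ (x∈p∪q⁺ (inj₁ (x∈⁅x⁆ i))) }) , (λ { refl → x∉ (x∈p∪q⁺ (inj₂ (x∈⁅x⁆ j))) })

  disjoint-empty : (p : Subset n) → Empty (empty ∩ p)
  disjoint-empty p (x , x∈) = ∉⊥ (proj₁ (x∈p∩q⁻ empty p x∈))

  balanced-empty : BalancedSet R empty
  balanced-empty = cong ∣_∣ (trans (∩-zeroˡ (white R)) (sym (∩-zeroˡ (∁ (white R)))))

  module _ t {i k j} (tiles : IsTiling R full t) (δ∈ : (i , k) ∈ᵈ t) (p : IsShift R k i j) where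

    remove-domino : IsTiling R (∁ (empty ∪ (⁅ i ⁆ ∪ ⁅ j ⁆))) (delete (i , k) t)
    remove-domino = delete-tiling distinct {t = t} tiles δ∈ p
      (λ _ m≢i m≢j → x∉p⇒x∈∁p (λ m∈ → ∉-pair m≢i m≢j (subst (_ ∈_) (∪-identityˡ _) m∈)))
      (λ m∈ → ∈⊤ , ∉-pair⁻ (λ m∈′ → x∈∁p⇒x∉p m∈ (x∈p∪q⁺ (inj₂ m∈′))))

    pair-balanced : BalancedSet R (⁅ i ⁆ ∪ ⁅ j ⁆)
    pair-balanced = balanced-remainder {p = empty} (disjoint-empty _) balanced-full
      balanced-empty (tiling-balanced distinct {t = delete (i , k) t} remove-domino)

  -- No bigon is attached at loops. A third domino `δ` is therefore made into a plug: without `δ`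
  -- the two tilings become edges from the empty plug to this plug that differ by a flip, and those
  -- bound a bigon. A quadrilateral with three corners at the empty plug transfers the homotopy to
  -- the loops.
  flip-loop-≃ : ∀ (f f′ : Tiling R full) → IsTiling R full (dominoes f) → IsTiling R full (dominoes f′) →
    Flip f f′ → loop Sign.+ f ◅ ε ≃ loop Sign.+ f′ ◅ ε
  flip-loop-≃ f@(tiling t _) f′@(tiling t′ _) tiles tiles′ (k , l , x , y , z , k≢l , py , pz , x∈ , y∈ , refl)
    with (i , m) , δ∈ , δ≢x , δ≢y ← other-domino {t} tiles k≢l py pz x∈ y∈
    with j , _ , pj ← proj₂ (proj₁ tiles i m δ∈) =
    ≃-sym (≃-trans (trivial-quotient (loop Sign.+ f′ ◅ ε) (loop Sign.- f ◅ ε) loops) (loop-sign Sign.- f))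
    where
    δ = i , m
    -- A new domino of the flip overlaps an old one, so it cannot be the domino `δ` of `t`. Hence
    -- deletion of `δ` commutes with the flip.
    δ≢xl : δ ≢ (x , l)
    δ≢xl refl = k≢l (cong proj₂ (proj₂ (proj₂ tiles) _ _ _ _ x x∈ δ∈ (inj₁ refl) (inj₁ refl)))
    δ≢zl : δ ≢ (z , l)
    δ≢zl refl = k≢l (cong proj₂ (proj₂ (proj₂ tiles) _ _ _ _ z x∈ δ∈ (inj₂ pz) (inj₁ refl)))
    δ∈′ : δ ∈ᵈ t′
    δ∈′ = ∈-put⁺ inside {t = insert (z , l) (delete (x , k) (delete (y , k) t))} δ≢xl
         (∈-put⁺ inside {t = delete (x , k) (delete (y , k) t)} δ≢zl
         (∈-put⁺ outside {t = delete (y , k) t} δ≢x (∈-put⁺ outside {t = t} δ≢y δ∈)))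
    pair : Plug
    pair = plug (⁅ i ⁆ ∪ ⁅ j ⁆) (pair-balanced t tiles δ∈ pj)
    pair≢ : emptyPlug ≢ pair
    pair≢ eq = ∉⊥ (subst (i ∈_) (sym (cong support eq)) (x∈p∪q⁺ (inj₁ (x∈⁅x⁆ i))))
    g g′ : Tiling R (complement emptyPlug pair)
    g  = tiling (delete δ t) (remove-domino t tiles δ∈ pj)
    g′ = tiling (delete δ t′) (remove-domino t′ tiles′ δ∈′ pj)
    e e′ : Step emptyPlug pair
    e  = edge pair≢ (disjoint-empty _) g
    e′ = edge pair≢ (disjoint-empty _) g′
    g-flip : Flip g g′
    g-flip = k , l , x , y , z , k≢l , py , pz ,
      ∈-put⁺ outside {t = t} (δ≢x ∘ sym) x∈ , ∈-put⁺ outside {t = t} (δ≢y ∘ sym) y∈ ,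
      (begin
        delete δ (insert (x , l) (insert (z , l) (delete (x , k) (delete (y , k) t))))
          ≡⟨ put-commutes outside inside δ (x , l) (insert (z , l) (delete (x , k) (delete (y , k) t))) δ≢xl ⟩
        insert (x , l) (delete δ (insert (z , l) (delete (x , k) (delete (y , k) t))))
          ≡⟨ cong (insert (x , l)) (put-commutes outside inside δ (z , l) (delete (x , k) (delete (y , k) t)) δ≢zl) ⟩
        insert (x , l) (insert (z , l) (delete δ (delete (x , k) (delete (y , k) t))))
          ≡⟨ cong (insert (x , l) ∘ insert (z , l)) (put-commutes outside outside δ (x , k) (delete (y , k) t) δ≢x) ⟩
        insert (x , l) (insert (z , l) (delete (x , k) (delete δ (delete (y , k) t))))
          ≡⟨ cong (insert (x , l) ∘ insert (z , l) ∘ delete (x , k)) (put-commutes outside outside δ (y , k) t δ≢y) ⟩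
        insert (x , l) (insert (z , l) (delete (x , k) (delete (y , k) (delete δ t)))) ∎)
      where open ≡-Reasoning
    -- In the quadrilateral, `p₂` is the pair and `p₁`, `p₃`, `p₄` are empty. The bigon kills its
    -- first two edges, which leaves the two loops.
    loops : loop Sign.+ f′ ◅ loop Sign.+ f ◅ ε ≃ ε
    loops = ≃-trans (≃-sym (◅◅-congˡ {γ = e ◅ rev e′ ◅ ε} (fill (bigon g g′ g-flip))))
      (fill (quadrilateral δ (j , pj , ∉⊥ , ∉⊥ , sym (∪-identityˡ _)) e (rev e′) (loop Sign.+ f′) (loop Sign.+ f)
        (sym (insert-delete δ t′ δ∈′)) (sym (insert-delete δ t δ∈))))

  flip-≃ : ∀ {p q} (s s′ : Step p q) → FlipSet R (stepDominoes s) (stepDominoes s′) → s ◅ ε ≃ s′ ◅ ε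
  flip-≃ s@(edge _ _ f) s′@(edge _ _ f′) fl = trivial-quotient (s ◅ ε) (s′ ◅ ε) (fill (bigon f f′ fl))
  flip-≃ (loop ± f@(tiling t r)) (loop ±′ f′@(tiling t′ r′)) fl =
    ≃-trans (loop-unsigned ± Sign.+ f)
      (≃-trans (flip-loop-≃ f f′ (recompute (isTiling? R full t) r) (recompute (isTiling? R full t′) r′) fl)
        (loop-unsigned Sign.+ ±′ f′))
  flip-≃ (edge p≢q _ _) (loop _ _)     _ = ⊥-elim-irr (p≢q refl)
  flip-≃ (loop _ _)     (edge p≢q _ _) _ = ⊥-elim-irr (p≢q refl)

  -- Walks of floors and their paths

  _≟ˢᵘᵇ_ : DecidableEquality (Subset n)
  _≟ˢᵘᵇ_ = Vec.≡-dec Bool._≟_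

  -- p and q are the squares of a floor that belong to vertical dominoes from below and to above.
  record IsFloor (p : Subset n) (h : DominoSet 2 n) (q : Subset n) : Set where
    constructor isFloorOf
    field
      disjoint : Empty (p ∩ q)
      tiles    : IsTiling R (∁ (p ∪ q)) h

  open IsFloor

  isFloor? : ∀ p h q → Dec (IsFloor p h q)
  isFloor? p h q = map′ (λ (disj , tiles) → isFloorOf disj tiles) (λ ok → disjoint ok , tiles ok)
    (¬? (nonempty? (p ∩ q)) ×-dec isTiling? R (∁ (p ∪ q)) h)

  -- Raw data without proofs, hence enumerable and with decidable equality. A floor stores only the
  -- plug above it; the plug below is that of the preceding floor.
  Floors : ℕ → Set
  Floors = Vec (DominoSet 2 n × Subset n)

  IsWalk : ∀ {N} → Subset n → Floors N → Subset n → Set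
  IsWalk p []            q = p ≡ q
  IsWalk p ((h , r) ∷ x) q = IsFloor p h r × IsWalk r x q

  isWalk? : ∀ {N} p (x : Floors N) q → Dec (IsWalk p x q)
  isWalk? p []            q = p ≟ˢᵘᵇ q
  isWalk? p ((h , r) ∷ x) q = isFloor? p h r ×-dec isWalk? r x q

  floor-balanced : ∀ {p h q} → IsFloor p h q → BalancedSet R p → BalancedSet R q
  floor-balanced {p} {h} {q} (isFloorOf disj tiles) bal-p =
    balanced-remainder {p = p} {q} disj balanced-full bal-p (tiling-balanced distinct {∁ (p ∪ q)} {h} tiles)

  full≡ : full {n} ≡ ∁ (empty ∪ empty)
  full≡ = ⊆-antisym (λ {m} _ → x∉p⇒x∈∁p (λ m∈ → ∉⊥ (subst (m ∈_) (∪-identityˡ empty) m∈))) (λ _ → ∈⊤)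

  -- A floor between empty plugs is a loop, with an arbitrary sign. In every other case the plugs
  -- are distinct, because a plug disjoint from itself is empty.
  floorStep : (p q : Plug) (h : DominoSet 2 n) → .(IsFloor (support p) h (support q)) → Step p q
  floorStep p q h ok with support p ≟ˢᵘᵇ empty ×-dec support q ≟ˢᵘᵇ empty
  floorStep (plug p _) (plug q _) h ok | yes (refl , refl) =
    loop Sign.+ (tiling h (subst (λ S → IsTiling R S h) (sym full≡) (tiles ok)))
  floorStep (plug p _) (plug q _) h ok | no ¬both =
    edge (λ { refl → ¬both (self-disjoint (disjoint ok) , self-disjoint (disjoint ok)) })
      (disjoint ok) (tiling h (tiles ok))
    where
    self-disjoint : ∀ {S : Subset n} → Empty (S ∩ S) → S ≡ empty
    self-disjoint disj = Empty-unique λ (x , x∈) → disj (x , x∈p∩q⁺ (x∈ , x∈))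

  stepDominoes-floorStep : ∀ p q h .ok → stepDominoes (floorStep p q h ok) ≡ h
  stepDominoes-floorStep p q h ok with support p ≟ˢᵘᵇ empty ×-dec support q ≟ˢᵘᵇ empty
  stepDominoes-floorStep (plug p _) (plug q _) h ok | yes (refl , refl) = refl
  stepDominoes-floorStep (plug p _) (plug q _) h ok | no ¬both = refl

  walkPath : ∀ {N} (p q : Plug) (x : Floors N) → IsWalk (support p) x (support q) → Path p q
  walkPath (plug p _) (plug .p _) []            refl     = ε
  walkPath P@(plug p bal) q        ((h , r) ∷ x) (ok , v) =
    floorStep P (plug r (floor-balanced ok bal)) h ok ◅ walkPath (plug r _) q x v

  pathLength-walkPath : ∀ {N} p q (x : Floors N) v → pathLength (walkPath p q x v) ≡ N
  pathLength-walkPath (plug p _) (plug .p _) []      refl     = refl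
  pathLength-walkPath p          q           (_ ∷ x) (ok , v) = cong suc (pathLength-walkPath _ q x v)

  isFloor : ∀ {p q} (s : Step p q) → IsFloor (support p) (stepDominoes s) (support q)
  isFloor {p} {q} (edge _ disj (tiling h tiles)) =
    recompute (isFloor? (support p) h (support q)) (isFloorOf disj tiles)
  isFloor (loop _ (tiling h tiles)) =
    recompute (isFloor? empty h empty) (isFloorOf (disjoint-empty empty) (subst (λ S → IsTiling R S h) full≡ tiles))

  pathFloors : ∀ {p q} (γ : Path p q) → Floors (pathLength γ)
  pathFloors ε               = []
  pathFloors (_◅_ {j = r} s γ) = (stepDominoes s , support r) ∷ pathFloors γ

  isWalk-pathFloors : ∀ {p q} (γ : Path p q) → IsWalk (support p) (pathFloors γ) (support q)
  isWalk-pathFloors ε       = refl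
  isWalk-pathFloors (s ◅ γ) = isFloor s , isWalk-pathFloors γ

  -- Only a homotopy, since the floors forget the signs of loops.
  walkPath-pathFloors : ∀ {p q} (γ : Path p q) v → walkPath p q (pathFloors γ) v ≃ γ
  walkPath-pathFloors ε refl = ≃-refl
  walkPath-pathFloors {p} (_◅_ {j = r} s γ) (ok , v) =
    ◅-cong (step-≃ _ s (stepDominoes-floorStep p r (stepDominoes s) ok)) (walkPath-pathFloors γ v)

  walkPath-irrelevant : ∀ {N} p q (x : Floors N) v v′ → walkPath p q x v ≡ walkPath p q x v′
  walkPath-irrelevant (plug p _) (plug .p _) []            refl    refl     = refl
  walkPath-irrelevant p@(plug _ bal) q       ((h , r) ∷ x) (ok , v) (_ , v′) =
    cong (floorStep p P h ok ◅_) (walkPath-irrelevant P q x v v′)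
    where
    P : Plug
    P = plug r (floor-balanced ok bal)

  isWalk-balanced : ∀ {N p q} (x : Floors N) → IsWalk p x q → BalancedSet R p → BalancedSet R q
  isWalk-balanced []      refl     bal = bal
  isWalk-balanced (_ ∷ x) (ok , v) bal = isWalk-balanced x v (floor-balanced ok bal)

  isWalk-end : ∀ {N p q q′} (x : Floors N) → IsWalk p x q → IsWalk p x q′ → q ≡ q′
  isWalk-end []      refl    refl     = refl
  isWalk-end (_ ∷ x) (_ , v) (_ , v′) = isWalk-end x v v′

  isWalk-++ : ∀ {M N p q r} (x : Floors M) (y : Floors N) → IsWalk p x q → IsWalk q y r → IsWalk p (x Vec.++ y) r
  isWalk-++ []      y refl     w = w
  isWalk-++ (_ ∷ x) y (ok , v) w = ok , isWalk-++ x y v w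

  isWalk-split : ∀ {M N p r} (x : Floors M) (y : Floors N) → IsWalk p (x Vec.++ y) r →
                 ∃[ q ] (IsWalk p x q × IsWalk q y r)
  isWalk-split []      y w        = _ , refl , w
  isWalk-split (_ ∷ x) y (ok , w) with q , v , w′ ← isWalk-split x y w = q , (ok , v) , w′

  walkPath-++ : ∀ {M N} p q r (x : Floors M) (y : Floors N) u v w →
    walkPath p r (x Vec.++ y) u ≡ walkPath p q x v ◅◅ walkPath q r y w
  walkPath-++ (plug p _) (plug .p _) r []      y u        refl    w = walkPath-irrelevant _ r y u w
  walkPath-++ p@(plug _ bal) q       r ((h , s) ∷ x) y (ok , u) (_ , v)  w =
    cong (floorStep p P h ok ◅_) (walkPath-++ P q r x y u v w)
    where
    P : Plug
    P = plug s (floor-balanced ok bal)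

  -- The effect of a flip on the sequence of floors, up to reversal.
  data _⇝_ : ∀ {N} → Floors N → Floors N → Set where
    planar   : ∀ {N h h′ r} {x : Floors N} → FlipSet R h h′ → ((h , r) ∷ x) ⇝ ((h′ , r) ∷ x)
    vertical : ∀ {N h₁ h₁′ h₂ h₂′ r r′ q} {x : Floors N} i j k → IsShift R k i j → i ∉ r′ → j ∉ r′ →
               r ≡ r′ ∪ (⁅ i ⁆ ∪ ⁅ j ⁆) → h₁′ ≡ insert (i , k) h₁ → h₂′ ≡ insert (i , k) h₂ →
               ((h₁ , r) ∷ (h₂ , q) ∷ x) ⇝ ((h₁′ , r′) ∷ (h₂′ , q) ∷ x)
    later    : ∀ {N h r} {x x′ : Floors N} → x ⇝ x′ → ((h , r) ∷ x) ⇝ ((h , r) ∷ x′)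

  -- A flip within a floor replaces one edge and is filled by `flip-≃`; a flip across two floors
  -- replaces two consecutive edges and is filled by a quadrilateral.
  ⇝⇒≃ : ∀ {N} {x x′ : Floors N} → x ⇝ x′ → ∀ p q v v′ → walkPath p q x v ≃ walkPath p q x′ v′
  ⇝⇒≃ (planar {h = h} {h′} {r} {x} fl) p@(plug _ bal) q (ok , v) (ok′ , v′) =
    ◅-cong (flip-≃ (floorStep p (plug r _) h ok) (floorStep p (plug r _) h′ ok′)
             (subst₂ (FlipSet R) (sym (stepDominoes-floorStep p (plug r (floor-balanced ok bal)) h ok))
               (sym (stepDominoes-floorStep p (plug r (floor-balanced ok bal)) h′ ok′)) fl))
           (≡⇒≃ (walkPath-irrelevant _ q x v v′))
  ⇝⇒≃ (vertical {h₁ = h₁} {h₁′} {h₂} {h₂′} {r} {r′} {s} {x} i j k sh i∉ j∉ r≡ refl refl)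
      p@(plug _ bal) q (ok₁ , ok₂ , v) (ok₁′ , ok₂′ , v′) =
    ≃-cong {γ = floorStep p P₂ h₁ ok₁ ◅ floorStep P₂ P₄ h₂ ok₂ ◅ ε}
           {γ′ = floorStep p P₃ h₁′ ok₁′ ◅ floorStep P₃ P₄ h₂′ ok₂′ ◅ ε}
      (quadrilateral-≃ (i , k) (j , sh , i∉ , j∉ , r≡) _ _ _ _
        (trans (stepDominoes-floorStep p P₃ h₁′ ok₁′) (cong (insert (i , k)) (sym (stepDominoes-floorStep p P₂ h₁ ok₁))))
        (trans (stepDominoes-floorStep P₃ P₄ h₂′ ok₂′) (cong (insert (i , k)) (sym (stepDominoes-floorStep P₂ P₄ h₂ ok₂)))))
      (≡⇒≃ (walkPath-irrelevant P₄ q x v v′))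
    where
    P₂ P₃ P₄ : Plug
    P₂ = plug r  (floor-balanced ok₁ bal)
    P₃ = plug r′ (floor-balanced ok₁′ bal)
    P₄ = plug s  (floor-balanced ok₂ (floor-balanced ok₁ bal))
  ⇝⇒≃ (later {r = r} x⇝x′) p q (ok , v) (_ , v′) = ◅-congʳ (⇝⇒≃ x⇝x′ _ q v v′)

  -- Tilings of the cylinder as walks of floors

  module _ {N : ℕ} where

    private C = cylinder R N

    horizontals : Floors N → Fin N → DominoSet 2 n
    horizontals x k = proj₁ (lookup x k)

    -- The squares of floor k from which a vertical domino starts.
    verticals : Floors N → Fin N → Subset n
    verticals x k = proj₂ (lookup x k)

    flatten : DominoSet 3 (n ℕ.* N) → Floors N
    flatten t = tabulate λ k →
      tabulate (λ i → tabulate (λ l → lookup (lookup t (combine i k)) (inject₁ l))) ,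
      tabulate (λ i → lookup (lookup t (combine i k)) up)

    lookup-horizontals : ∀ t i k l →
      lookup (lookup (horizontals (flatten t) k) i) l ≡ lookup (lookup t (combine i k)) (inject₁ l)
    lookup-horizontals t i k l =
      trans (cong (λ f → lookup (lookup (proj₁ f) i) l) (Vec.lookup∘tabulate _ k))
        (trans (cong (λ S → lookup S l) (Vec.lookup∘tabulate _ i))
          (Vec.lookup∘tabulate (λ l → lookup (lookup t (combine i k)) (inject₁ l)) l))

    lookup-verticals : ∀ t i k → lookup (verticals (flatten t) k) i ≡ lookup (lookup t (combine i k)) up
    lookup-verticals t i k =
      trans (cong (λ f → lookup (proj₂ f) i) (Vec.lookup∘tabulate _ k)) (Vec.lookup∘tabulate _ i)

    ∈-horizontals⁺ : ∀ {t i k l} → (combine i k , inject₁ l) ∈ᵈ t → (i , l) ∈ᵈ horizontals (flatten t) k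
    ∈-horizontals⁺ {t} {i} {k} {l} p = lookup⇒∈ (trans (lookup-horizontals t i k l) (∈⇒lookup p))

    ∈-horizontals⁻ : ∀ {t i k l} → (i , l) ∈ᵈ horizontals (flatten t) k → (combine i k , inject₁ l) ∈ᵈ t
    ∈-horizontals⁻ {t} {i} {k} {l} p = lookup⇒∈ (trans (sym (lookup-horizontals t i k l)) (∈⇒lookup p))

    ∈-verticals⁺ : ∀ {t i k} → (combine i k , up) ∈ᵈ t → i ∈ verticals (flatten t) k
    ∈-verticals⁺ {t} {i} {k} p = lookup⇒∈ (trans (lookup-verticals t i k) (∈⇒lookup p))

    ∈-verticals⁻ : ∀ {t i k} → i ∈ verticals (flatten t) k → (combine i k , up) ∈ᵈ t
    ∈-verticals⁻ {t} {i} {k} p = lookup⇒∈ (trans (sym (lookup-verticals t i k)) (∈⇒lookup p))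

    floors-ext : {x y : Floors N} →
      (∀ i k l → lookup (lookup (horizontals x k) i) l ≡ lookup (lookup (horizontals y k) i) l) →
      (∀ i k → lookup (verticals x k) i ≡ lookup (verticals y k) i) → x ≡ y
    floors-ext eqʰ eqᵛ = lookup-ext λ k → cong₂ _,_
      (lookup-ext λ i → lookup-ext λ l → eqʰ i k l) (lookup-ext λ i → eqᵛ i k)

    flatten-injective : ∀ {t u} → flatten t ≡ flatten u → t ≡ u
    flatten-injective {t} {u} eq = lookup-ext λ m → lookup-ext λ d → same m d
      where
      same : ∀ m d → lookup (lookup t m) d ≡ lookup (lookup u m) d
      same m d with indexView {n} {N} m | directionView d
      ... | combined i k | horizontal l = trans (sym (lookup-horizontals t i k l))
        (trans (cong (λ x → lookup (lookup (horizontals x k) i) l) eq) (lookup-horizontals u i k l))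
      ... | combined i k | upward = trans (sym (lookup-verticals t i k))
        (trans (cong (λ x → lookup (verticals x k) i) eq) (lookup-verticals u i k))

    unflatten : Floors N → DominoSet 3 (n ℕ.* N)
    unflatten x = tabulate λ m → let i , k = remQuot {n} N m in
      lookup (horizontals x k) i ∷ʳ lookup (verticals x k) i

    lookup-∷ʳ-inject₁ : ∀ {A : Set} {m} (xs : Vec A m) y i → lookup (xs ∷ʳ y) (inject₁ i) ≡ lookup xs i
    lookup-∷ʳ-inject₁ (x ∷ xs) y zero    = refl
    lookup-∷ʳ-inject₁ (x ∷ xs) y (suc i) = lookup-∷ʳ-inject₁ xs y i

    lookup-∷ʳ-last : ∀ {A : Set} {m} (xs : Vec A m) y → lookup (xs ∷ʳ y) (Fin.fromℕ m) ≡ y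
    lookup-∷ʳ-last []       y = refl
    lookup-∷ʳ-last (x ∷ xs) y = lookup-∷ʳ-last xs y

    flatten-unflatten : ∀ x → flatten (unflatten x) ≡ x
    flatten-unflatten x = floors-ext
      (λ i k l → trans (lookup-horizontals (unflatten x) i k l) (trans (cong (λ S → lookup S (inject₁ l)) (at i k))
        (lookup-∷ʳ-inject₁ (lookup (horizontals x k) i) _ l)))
      (λ i k → trans (lookup-verticals (unflatten x) i k) (trans (cong (λ S → lookup S up) (at i k))
        (lookup-∷ʳ-last (lookup (horizontals x k) i) _)))
      where
      at : ∀ i k → lookup (unflatten x) (combine i k) ≡ lookup (horizontals x k) i ∷ʳ lookup (verticals x k) i
      at i k = trans (Vec.lookup∘tabulate _ (combine i k))
        (cong (λ (i , k) → lookup (horizontals x k) i ∷ʳ lookup (verticals x k) i) (Fin.remQuot-combine i k))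

  below : ∀ {N} → Subset n → Floors N → Fin N → Subset n
  below p (_       ∷ x) zero    = p
  below p ((_ , r) ∷ x) (suc k) = below r x k

  top : ∀ {N} → Subset n → Floors N → Subset n
  top p []            = p
  top p ((_ , r) ∷ x) = top r x

  isWalk⁺ : ∀ {N} p (x : Floors N) → (∀ k → IsFloor (below p x k) (horizontals x k) (verticals x k)) →
            IsWalk p x (top p x)
  isWalk⁺ p []            ok = refl
  isWalk⁺ p ((_ , r) ∷ x) ok = ok zero , isWalk⁺ r x (ok ∘ suc)

  isWalk⁻ : ∀ {N p q} (x : Floors N) → IsWalk p x q →
            (∀ k → IsFloor (below p x k) (horizontals x k) (verticals x k)) × top p x ≡ q
  isWalk⁻ []            eq       = (λ ()) , eq
  isWalk⁻ (_ ∷ x) (ok , v) with oks , eq ← isWalk⁻ x v = (λ { zero → ok ; (suc k) → oks k }) , eq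

  below-suc : ∀ {N} p (x : Floors N) {k m} → toℕ m ≡ suc (toℕ k) → below p x m ≡ verticals x k
  below-suc p (_ ∷ (_ ∷ x)) {zero}  {suc zero} refl = refl
  below-suc p ((_ , r) ∷ x) {suc k} {suc m}    eq   = below-suc r x (ℕ.suc-injective eq)

  below-cases : ∀ {N} p (x : Floors N) m →
    (toℕ m ≡ 0 × below p x m ≡ p) ⊎ ∃[ k ] (toℕ m ≡ suc (toℕ k) × below p x m ≡ verticals x k)
  below-cases p (_ ∷ x)       zero    = inj₁ (refl , refl)
  below-cases p ((_ , r) ∷ x) (suc m) with below-cases r x m
  ... | inj₁ (m≡0 , eq)   = inj₂ (zero , cong suc m≡0 , eq)
  ... | inj₂ (k , m≡ , eq) = inj₂ (suc k , cong suc m≡ , eq)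

  top-suc : ∀ {N} p (x : Floors N) {k} → N ≡ suc (toℕ k) → top p x ≡ verticals x k
  top-suc p (_ ∷ [])            {zero}  eq = refl
  top-suc p (_ ∷ _ ∷ _)         {zero}  ()
  top-suc p ((_ , r) ∷ x)       {suc k} eq = top-suc r x (ℕ.suc-injective eq)

  top-cases : ∀ {N} p (x : Floors N) →
    (N ≡ 0 × top p x ≡ p) ⊎ ∃[ k ] (N ≡ suc (toℕ k) × top p x ≡ verticals x k)
  top-cases p []            = inj₁ (refl , refl)
  top-cases p ((_ , r) ∷ x) with top-cases r x
  ... | inj₁ (N≡0 , eq)    = inj₂ (zero , cong suc N≡0 , eq)
  ... | inj₂ (k , N≡ , eq) = inj₂ (suc k , cong suc N≡ , eq)

  module _ {N : ℕ} where

    private C = cylinder R N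

    -- The three cases match the partition of a floor into its tiled part, the plug above and the
    -- plug below, so covering and disjointness in the cylinder can be checked floor by floor.
    data CoverView (x : Floors N) (j : Fin n) (m : Fin N) : Domino 3 (n ℕ.* N) → Set where
      level      : ∀ {i l} → (i , l) ∈ᵈ horizontals x m → Covers R (i , l) j →
                   CoverView x j m (combine i m , inject₁ l)
      from-here  : j ∈ verticals x m → CoverView x j m (combine j m , up)
      from-below : ∀ {k} → toℕ m ≡ suc (toℕ k) → j ∈ verticals x k → CoverView x j m (combine j k , up)

    coverView : ∀ t {δ} j m → δ ∈ᵈ t → Covers C δ (combine j m) → CoverView (flatten t) j m δ
    coverView t {e , d} j m δ∈ cov with indexView {n} {N} e | directionView d
    coverView t j m δ∈ (inj₁ eq) | combined i k | horizontal l
      with refl , refl ← Fin.combine-injective j m i k eq = level (∈-horizontals⁺ {t = t} δ∈) (inj₁ refl)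
    coverView t j m δ∈ (inj₂ p) | combined i k | horizontal l
      with q , refl ← shift-horizontal⁻ R distinct N p = level (∈-horizontals⁺ {t = t} δ∈) (inj₂ q)
    coverView t j m δ∈ (inj₁ eq) | combined i k | upward
      with refl , refl ← Fin.combine-injective j m i k eq = from-here (∈-verticals⁺ {t = t} δ∈)
    coverView t j m δ∈ (inj₂ p) | combined i k | upward
      with refl , m≡ ← shift-up⁻ R distinct N p = from-below m≡ (∈-verticals⁺ {t = t} δ∈)

    covers-level : ∀ {i l j} m → Covers R (i , l) j → Covers C (combine i m , inject₁ l) (combine j m)
    covers-level m (inj₁ refl) = inj₁ refl
    covers-level m (inj₂ p)    = inj₂ (shift-horizontal⁺ R distinct N m p)

    private
      combine-injective : ∀ {i j : Fin n} {k m : Fin N} → combine i k ≡ combine j m → i ≡ j × k ≡ m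
      combine-injective = Fin.combine-injective _ _ _ _

      horizontal≢vertical : ∀ {e e′ : Fin (n ℕ.* N)} {l : Fin 2} → (e , inject₁ l) ≢ (e′ , up)
      horizontal≢vertical eq = inject₁≢up (cong proj₂ eq)

    flatten-isWalk : ∀ t → IsTiling C full t → IsWalk empty (flatten t) empty
    flatten-isWalk t (contained , covering , disj) =
      subst (IsWalk empty x) top≡ (isWalk⁺ empty x λ k → isFloorOf (disjointᵛ k) (containedʰ k , coveringʰ k , disjʰ k))
      where
      x = flatten t

      vertical-below : ∀ {i m} → i ∈ below empty x m → ∃[ k ] (toℕ m ≡ suc (toℕ k) × (combine i k , up) ∈ᵈ t)
      vertical-below {i} {m} i∈ with below-cases empty x m
      ... | inj₁ (_ , eq)      = contradiction (subst (i ∈_) eq i∈) ∉⊥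
      ... | inj₂ (k , m≡ , eq) = k , m≡ , ∈-verticals⁻ {t = t} (subst (i ∈_) eq i∈)

      top≡ : top empty x ≡ empty
      top≡ with top-cases empty x
      ... | inj₁ (_ , eq)      = eq
      -- A vertical domino starting in the last floor would leave the cylinder.
      ... | inj₂ (k , N≡ , eq) = trans eq (Empty-unique λ (i , i∈) →
        let e , _ , p = proj₂ (contained (combine i k) up (∈-verticals⁻ {t = t} i∈)) in beyond i e p)
        where
        beyond : ∀ i e → ¬ IsShift C up (combine i k) e
        beyond i e p with combined j m ← indexView {n} {N} e =
          ℕ.<-irrefl (trans (proj₂ (shift-up⁻ R distinct N p)) (sym N≡)) (Fin.toℕ<n m)

      disjointᵛ : ∀ k → Empty (below empty x k ∩ verticals x k)
      disjointᵛ k (i , i∈) with i∈b , i∈v ← x∈p∩q⁻ (below empty x k) (verticals x k) i∈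
        with k′ , k≡ , δ∈ ← vertical-below i∈b =
        ℕ.<-irrefl (cong toℕ (proj₂ (combine-injective (cong proj₁ (disj _ _ _ _ (combine i k) δ∈ (∈-verticals⁻ {t = t} i∈v)
          (inj₂ (shift-up⁺ R distinct N i k≡)) (inj₁ refl)))))) (subst (toℕ k′ ℕ.<_) (sym k≡) ℕ.≤-refl)

      free : ∀ {i l j k} → (combine i k , inject₁ l) ∈ᵈ t → Covers R (i , l) j → j ∈ ∁ (below empty x k ∪ verticals x k)
      free {i} {l} {j} {k} δ∈ cov = x∉p⇒x∈∁p λ j∈ → [
        (λ j∈b → let k′ , k≡ , δ′∈ = vertical-below j∈b in
          horizontal≢vertical (disj _ _ _ _ (combine j k) δ∈ δ′∈ (covers-level k cov) (inj₂ (shift-up⁺ R distinct N j k≡)))) ,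
        (λ j∈v → horizontal≢vertical (disj _ _ _ _ (combine j k) δ∈ (∈-verticals⁻ {t = t} j∈v) (covers-level k cov) (inj₁ refl))) ]′
        (x∈p∪q⁻ (below empty x k) (verticals x k) j∈)

      containedʰ : ∀ k → Contained R (∁ (below empty x k ∪ verticals x k)) (horizontals x k)
      containedʰ k i l δ∈ʰ with δ∈ ← ∈-horizontals⁻ {t = t} {i} {k} {l} δ∈ʰ
        with e , _ , p ← proj₂ (contained (combine i k) (inject₁ l) δ∈)
        with combined j m ← indexView {n} {N} e
        with q , refl ← shift-horizontal⁻ R distinct N p =
        free δ∈ (inj₁ refl) , j , free δ∈ (inj₂ q) , q

      coveringʰ : ∀ k → Covering R (∁ (below empty x k ∪ verticals x k)) (horizontals x k)
      coveringʰ k j j∈ with e , d , δ∈ , cov ← covering (combine j k) ∈⊤ with coverView t j k δ∈ cov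
      ... | level {i} {l} δ∈ʰ covʰ = i , l , δ∈ʰ , covʰ
      ... | from-here j∈v       = contradiction (x∈p∪q⁺ (inj₂ j∈v)) (x∈∁p⇒x∉p j∈)
      ... | from-below k≡ j∈v   =
        contradiction (x∈p∪q⁺ (inj₁ (subst (j ∈_) (sym (below-suc empty x k≡)) j∈v))) (x∈∁p⇒x∉p j∈)

      disjʰ : ∀ k → PairwiseDisjoint R (horizontals x k)
      disjʰ k i l i′ l′ j δ∈ δ′∈ cov cov′
        with eq ← disj _ _ _ _ (combine j k) (∈-horizontals⁻ {t = t} {i} {k} {l} δ∈) (∈-horizontals⁻ {t = t} {i′} {k} {l′} δ′∈)
                    (covers-level k cov) (covers-level k cov′) =
        cong₂ _,_ (proj₁ (combine-injective (cong proj₁ eq))) (Fin.inject₁-injective (cong proj₂ eq))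

    isWalk-tiling : ∀ t → IsWalk empty (flatten t) empty → IsTiling C full t
    isWalk-tiling t walk = contained , covering , disj
      where
      x = flatten t
      floor : ∀ k → IsFloor (below empty x k) (horizontals x k) (verticals x k)
      floor = proj₁ (isWalk⁻ x walk)

      contained : Contained C full t
      contained e d δ∈ with indexView {n} {N} e | directionView d
      ... | combined i k | horizontal l
        with _ , j , _ , p ← proj₁ (tiles (floor k)) i l (∈-horizontals⁺ {t = t} δ∈) =
        ∈⊤ , combine j k , ∈⊤ , shift-horizontal⁺ R distinct N k p
      ... | combined i k | upward with suc (toℕ k) ℕ.<? N
      ... | yes k<N = ∈⊤ , combine i (Fin.fromℕ< k<N) , ∈⊤ , shift-up⁺ R distinct N i (Fin.toℕ-fromℕ< k<N)
      -- Here `k` is the last floor, and the plug above it is the end of the walk, which is empty.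
      ... | no k≮N  = contradiction (subst (i ∈_) (trans (sym (top-suc empty x N≡)) (proj₂ (isWalk⁻ x walk)))
                        (∈-verticals⁺ {t = t} δ∈)) ∉⊥
        where
        N≡ : N ≡ suc (toℕ k)
        N≡ = ℕ.≤-antisym (ℕ.≮⇒≥ k≮N) (Fin.toℕ<n k)

      covered : ∀ j m → Dec (j ∈ verticals x m) → Dec (j ∈ below empty x m) →
                ∃[ e ] ∃[ d ] ((e , d) ∈ᵈ t × Covers C (e , d) (combine j m))
      covered j m (yes j∈v) _ = combine j m , up , ∈-verticals⁻ {t = t} j∈v , inj₁ refl
      covered j m (no _) (yes j∈b) with below-cases empty x m
      ... | inj₁ (_ , eq)      = contradiction (subst (j ∈_) eq j∈b) ∉⊥
      ... | inj₂ (k , m≡ , eq) = combine j k , up , ∈-verticals⁻ {t = t} (subst (j ∈_) eq j∈b) ,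
        inj₂ (shift-up⁺ R distinct N j m≡)
      covered j m (no j∉v) (no j∉b)
        with i , l , δ∈ , cov ← proj₁ (proj₂ (tiles (floor m))) j
               (x∉p⇒x∈∁p λ j∈ → [ j∉b , j∉v ]′ (x∈p∪q⁻ (below empty x m) _ j∈)) =
        combine i m , inject₁ l , ∈-horizontals⁻ {t = t} {i} {m} {l} δ∈ , covers-level m cov

      covering : Covering C full t
      covering e _ with combined j m ← indexView {n} {N} e =
        covered j m (j ∈? verticals x m) (j ∈? below empty x m)

      free : ∀ {i l j m} → (i , l) ∈ᵈ horizontals x m → Covers R (i , l) j → j ∉ below empty x m × j ∉ verticals x m
      free {i} {l} {j} {m} δ∈ cov = (λ j∈ → x∈∁p⇒x∉p j∈∁ (x∈p∪q⁺ (inj₁ j∈))) , (λ j∈ → x∈∁p⇒x∉p j∈∁ (x∈p∪q⁺ (inj₂ j∈)))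
        where
        ends : Covers R (i , l) j → j ∈ ∁ (below empty x m ∪ verticals x m)
        ends (inj₁ refl) = proj₁ (proj₁ (tiles (floor m)) i l δ∈)
        ends (inj₂ q) with _ , j′ , j′∈ , p ← proj₁ (tiles (floor m)) i l δ∈ = subst (_∈ _) (isShift-functional distinct p q) j′∈
        j∈∁ : j ∈ ∁ (below empty x m ∪ verticals x m)
        j∈∁ = ends cov

      disj : PairwiseDisjoint C t
      disj e d e′ d′ c δ∈ δ′∈ cov cov′ with combined j m ← indexView {n} {N} c
        with coverView t j m δ∈ cov | coverView t j m δ′∈ cov′
      ... | level {i} {l} δʰ a | level {i′} {l′} δ′ʰ b with refl ← proj₂ (proj₂ (tiles (floor m))) i l i′ l′ j δʰ δ′ʰ a b = refl
      ... | level δʰ a        | from-here j∈     = contradiction j∈ (proj₂ (free δʰ a))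
      ... | level δʰ a        | from-below k≡ j∈ = contradiction (subst (j ∈_) (sym (below-suc empty x k≡)) j∈) (proj₁ (free δʰ a))
      ... | from-here j∈      | level δʰ a       = contradiction j∈ (proj₂ (free δʰ a))
      ... | from-below k≡ j∈  | level δʰ a       = contradiction (subst (j ∈_) (sym (below-suc empty x k≡)) j∈) (proj₁ (free δʰ a))
      ... | from-here _       | from-here _      = refl
      ... | from-here j∈      | from-below k≡ j∈′ =
        contradiction (j , x∈p∩q⁺ (subst (j ∈_) (sym (below-suc empty x k≡)) j∈′ , j∈)) (disjoint (floor m))
      ... | from-below k≡ j∈′ | from-here j∈     =
        contradiction (j , x∈p∩q⁺ (subst (j ∈_) (sym (below-suc empty x k≡)) j∈′ , j∈)) (disjoint (floor m))
      ... | from-below k≡ _   | from-below k′≡ _ with refl ← Fin.toℕ-injective (ℕ.suc-injective (trans (sym k≡) k′≡)) = refl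

    flatten-put-horizontal : ∀ s i m l t →
      flatten (put s (combine i m , inject₁ l) t) ≡ flatten t [ m ]%= Product.map₁ (put s (i , l))
    flatten-put-horizontal s i m l t = floors-ext
      (λ i′ k l′ → trans (lookup-horizontals (put s δ t) i′ k l′) (sym (horizontals-at i′ k l′)))
      (λ i′ k → trans (lookup-verticals (put s δ t) i′ k) (trans (lookup-put-other s δ _ t (horizontal≢vertical ∘ sym))
        (trans (sym (lookup-verticals t i′ k)) (cong (λ S → lookup S i′) (sym (verticals-at k))))))
      where
      x = flatten t
      δ = (combine i m , inject₁ l)
      x′ = x [ m ]%= Product.map₁ (put s (i , l))
      verticals-at : ∀ k → verticals x′ k ≡ verticals x k
      verticals-at k with k Fin.≟ m
      ... | yes refl = cong proj₂ (Vec.lookup∘updateAt m x)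
      ... | no k≢m   = cong proj₂ (Vec.lookup∘updateAt′ k m k≢m x)
      horizontals-at : ∀ i′ k l′ → lookup (lookup (horizontals x′ k) i′) l′ ≡ lookup (lookup (put s δ t) (combine i′ k)) (inject₁ l′)
      horizontals-at i′ k l′ with k Fin.≟ m
      ... | no k≢m   = trans (cong (λ f → lookup (lookup (proj₁ f) i′) l′) (Vec.lookup∘updateAt′ k m k≢m x))
        (trans (lookup-horizontals t i′ k l′)
          (sym (lookup-put-other s δ _ t (λ eq → k≢m (proj₂ (combine-injective (cong proj₁ eq)))))))
      ... | yes refl with (i′ , l′) ≟ᵈ (i , l)
      ...   | yes refl = trans (cong (λ f → lookup (lookup (proj₁ f) i′) l′) (Vec.lookup∘updateAt m x))
        (trans (lookup-put s (i , l) (horizontals x m)) (sym (lookup-put s δ t)))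
      ...   | no ≢     = trans (cong (λ f → lookup (lookup (proj₁ f) i′) l′) (Vec.lookup∘updateAt m x))
        (trans (lookup-put-other s (i , l) (i′ , l′) (horizontals x m) ≢)
          (trans (lookup-horizontals t i′ m l′) (sym (lookup-put-other s δ _ t
            (λ eq → ≢ (cong₂ _,_ (proj₁ (combine-injective (cong proj₁ eq))) (Fin.inject₁-injective (cong proj₂ eq))))))))

    flatten-put-vertical : ∀ s i m t →
      flatten (put s (combine i m , up) t) ≡ flatten t [ m ]%= Product.map₂ (_[ i ]≔ s)
    flatten-put-vertical s i m t = floors-ext
      (λ i′ k l′ → trans (lookup-horizontals (put s δ t) i′ k l′) (trans (lookup-put-other s δ _ t horizontal≢vertical)
        (trans (sym (lookup-horizontals t i′ k l′)) (cong (λ h → lookup (lookup h i′) l′) (sym (horizontals-at k))))))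
      (λ i′ k → trans (lookup-verticals (put s δ t) i′ k) (sym (verticals-at i′ k)))
      where
      x = flatten t
      δ = (combine i m , up)
      x′ = x [ m ]%= Product.map₂ (_[ i ]≔ s)
      horizontals-at : ∀ k → horizontals x′ k ≡ horizontals x k
      horizontals-at k with k Fin.≟ m
      ... | yes refl = cong proj₁ (Vec.lookup∘updateAt m x)
      ... | no k≢m   = cong proj₁ (Vec.lookup∘updateAt′ k m k≢m x)
      verticals-at : ∀ i′ k → lookup (verticals x′ k) i′ ≡ lookup (lookup (put s δ t) (combine i′ k)) up
      verticals-at i′ k with k Fin.≟ m
      ... | no k≢m   = trans (cong (λ f → lookup (proj₂ f) i′) (Vec.lookup∘updateAt′ k m k≢m x))
        (trans (lookup-verticals t i′ k)
          (sym (lookup-put-other s δ _ t (λ eq → k≢m (proj₂ (combine-injective (cong proj₁ eq)))))))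
      ... | yes refl with i′ Fin.≟ i
      ...   | yes refl = trans (cong (λ f → lookup (proj₂ f) i′) (Vec.lookup∘updateAt m x))
        (trans (Vec.lookup∘updateAt i (verticals x m)) (sym (lookup-put s δ t)))
      ...   | no i′≢i  = trans (cong (λ f → lookup (proj₂ f) i′) (Vec.lookup∘updateAt m x))
        (trans (Vec.lookup∘updateAt′ i′ i i′≢i (verticals x m))
          (trans (lookup-verticals t i′ m) (sym (lookup-put-other s δ _ t
            (λ eq → i′≢i (proj₁ (combine-injective (cong proj₁ eq))))))))

  planar-at : ∀ {N} (x : Floors N) m (f : DominoSet 2 n → DominoSet 2 n) →
              FlipSet R (horizontals x m) (f (horizontals x m)) → x ⇝ (x [ m ]%= Product.map₁ f)
  planar-at (_ ∷ x) zero    f fl = planar fl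
  planar-at (_ ∷ x) (suc m) f fl = later (planar-at x m f fl)

  -- The change `f` of the plug is left open because there are two uses: removal of the pair of
  -- squares, and restoration of an earlier plug when a flip is undone.
  vertical-at : ∀ {N} (x : Floors N) {m m⁺} i j k (f : Subset n → Subset n) → toℕ m⁺ ≡ suc (toℕ m) →
    IsShift R k i j → i ∉ f (verticals x m) → j ∉ f (verticals x m) →
    verticals x m ≡ f (verticals x m) ∪ (⁅ i ⁆ ∪ ⁅ j ⁆) →
    x ⇝ ((x [ m⁺ ]%= Product.map₁ (insert (i , k))) [ m ]%= Product.map (insert (i , k)) f)
  vertical-at (_ ∷ _ ∷ x) {zero}  {suc zero} i j k f refl p i∉ j∉ eq = vertical i j k p i∉ j∉ eq refl refl
  vertical-at (_ ∷ x)     {suc m} {suc m⁺}   i j k f m⁺≡  p i∉ j∉ eq =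
    later (vertical-at x i j k f (ℕ.suc-injective m⁺≡) p i∉ j∉ eq)

  module _ {N : ℕ} where

    private C = cylinder R N

    -- Two horizontal directions give a planar flip. If one direction is `up`, the flip affects two
    -- adjacent floors, and the direction of the removed dominoes decides which of the two
    -- orientations of `⇝` occurs.
    flatten-flip : ∀ t {t′} → IsTiling C full t → FlipSet C t t′ → flatten t ⇝ flatten t′ ⊎ flatten t′ ⇝ flatten t
    flatten-flip t (_ , _ , disj) (d , e , a , b , c , d≢e , pe , pd , a∈ , b∈ , refl)
      with indexView {n} {N} a | indexView {n} {N} b | indexView {n} {N} c | directionView d | directionView e
    ... | combined i m | combined j m₁ | combined i′ m₂ | horizontal k | horizontal l
      with p , refl ← shift-horizontal⁻ R distinct N pe | q , refl ← shift-horizontal⁻ R distinct N pd =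
      inj₁ (subst (flatten t ⇝_) (sym eq) (planar-at (flatten t) m f
        (k , l , i , j , i′ , d≢e ∘ cong inject₁ , p , q , ∈-horizontals⁺ {t = t} a∈ , ∈-horizontals⁺ {t = t} b∈ , refl)))
      where
      f : DominoSet 2 n → DominoSet 2 n
      f h = insert (i , l) (insert (i′ , l) (delete (i , k) (delete (j , k) h)))
      t₁ = delete (combine j m , inject₁ k) t
      t₂ = delete (combine i m , inject₁ k) t₁
      t₃ = insert (combine i′ m , inject₁ l) t₂
      open ≡-Reasoning
      eq : flatten (insert (combine i m , inject₁ l) t₃) ≡ flatten t [ m ]%= Product.map₁ f
      eq = begin
        flatten (insert (combine i m , inject₁ l) t₃)
          ≡⟨ flatten-put-horizontal inside i m l t₃ ⟩
        flatten t₃ [ m ]%= Product.map₁ (insert (i , l))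
          ≡⟨ cong (_[ m ]%= Product.map₁ (insert (i , l))) (flatten-put-horizontal inside i′ m l t₂) ⟩
        (flatten t₂ [ m ]%= Product.map₁ (insert (i′ , l))) [ m ]%= Product.map₁ (insert (i , l))
          ≡⟨ Vec.updateAt-updateAt m (flatten t₂) ⟩
        flatten t₂ [ m ]%= Product.map₁ (insert (i , l) ∘ insert (i′ , l))
          ≡⟨ cong (_[ m ]%= Product.map₁ (insert (i , l) ∘ insert (i′ , l))) (flatten-put-horizontal outside i m k t₁) ⟩
        (flatten t₁ [ m ]%= Product.map₁ (delete (i , k))) [ m ]%= Product.map₁ (insert (i , l) ∘ insert (i′ , l))
          ≡⟨ Vec.updateAt-updateAt m (flatten t₁) ⟩
        flatten t₁ [ m ]%= Product.map₁ (insert (i , l) ∘ insert (i′ , l) ∘ delete (i , k))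
          ≡⟨ cong (_[ m ]%= Product.map₁ (insert (i , l) ∘ insert (i′ , l) ∘ delete (i , k))) (flatten-put-horizontal outside j m k t) ⟩
        (flatten t [ m ]%= Product.map₁ (delete (j , k))) [ m ]%= Product.map₁ (insert (i , l) ∘ insert (i′ , l) ∘ delete (i , k))
          ≡⟨ Vec.updateAt-updateAt m (flatten t) ⟩
        flatten t [ m ]%= Product.map₁ f ∎
    ... | combined i m | combined j m₁ | combined i′ m₂ | upward | upward = contradiction refl d≢e
    ... | combined i m | combined _ m⁺ | combined j _ | horizontal k | upward
      with refl , m⁺≡ ← shift-up⁻ R distinct N pe | q , refl ← shift-horizontal⁻ R distinct N pd =
      -- The new dominoes are vertical, so the flip is read backwards from `flatten t′`. Undoing it
      -- restores the old plug, which contains neither `i` nor `j` because a horizontal domino of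
      -- `t` covers both.
      inj₂ (subst (flatten t′ ⇝_) restore (vertical-at (flatten t′) i j k (λ _ → verticals x m) m⁺≡ q
        (λ i∈ → horizontal≢vertical′ (disj _ _ _ _ (combine i m) a∈ (∈-verticals⁻ {t = t} i∈) (inj₁ refl) (inj₁ refl)))
        (λ j∈ → horizontal≢vertical′ (disj _ _ _ _ (combine j m) a∈ (∈-verticals⁻ {t = t} j∈) (inj₂ pd) (inj₁ refl)))
        verticals≡))
      where
      x = flatten t
      t₁ = delete (combine i m⁺ , inject₁ k) t
      t₂ = delete (combine i m , inject₁ k) t₁
      t₃ = insert (combine j m , up) t₂
      t′ = insert (combine i m , up) t₃
      I D : DominoSet 2 n → DominoSet 2 n
      I = insert (i , k)
      D = delete (i , k)
      V : Subset n → Subset n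
      V S = (S [ j ]≔ inside) [ i ]≔ inside
      horizontal≢vertical′ : ∀ {e e′ : Fin (n ℕ.* N)} {l : Fin 2} → (e , inject₁ l) ≢ (e′ , up)
      horizontal≢vertical′ eq = inject₁≢up (cong proj₂ eq)
      m≢m⁺ : m ≢ m⁺
      m≢m⁺ refl = ℕ.1+n≢n (sym m⁺≡)
      open ≡-Reasoning
      eq : flatten t′ ≡ (x [ m⁺ ]%= Product.map₁ D) [ m ]%= Product.map D V
      eq = begin
        flatten t′
          ≡⟨ flatten-put-vertical inside i m t₃ ⟩
        flatten t₃ [ m ]%= Product.map₂ (_[ i ]≔ inside)
          ≡⟨ cong (_[ m ]%= Product.map₂ (_[ i ]≔ inside)) (flatten-put-vertical inside j m t₂) ⟩
        (flatten t₂ [ m ]%= Product.map₂ (_[ j ]≔ inside)) [ m ]%= Product.map₂ (_[ i ]≔ inside)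
          ≡⟨ Vec.updateAt-updateAt m (flatten t₂) ⟩
        flatten t₂ [ m ]%= Product.map₂ V
          ≡⟨ cong (_[ m ]%= Product.map₂ V) (flatten-put-horizontal outside i m k t₁) ⟩
        (flatten t₁ [ m ]%= Product.map₁ D) [ m ]%= Product.map₂ V
          ≡⟨ Vec.updateAt-updateAt m (flatten t₁) ⟩
        flatten t₁ [ m ]%= Product.map D V
          ≡⟨ cong (_[ m ]%= Product.map D V) (flatten-put-horizontal outside i m⁺ k t) ⟩
        (x [ m⁺ ]%= Product.map₁ D) [ m ]%= Product.map D V ∎
      verticals≡ : verticals (flatten t′) m ≡ verticals x m ∪ (⁅ i ⁆ ∪ ⁅ j ⁆)
      verticals≡ = begin
        verticals (flatten t′) m ≡⟨ cong (λ y → verticals y m) eq ⟩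
        verticals ((x [ m⁺ ]%= Product.map₁ D) [ m ]%= Product.map D V) m
          ≡⟨ cong proj₂ (Vec.lookup∘updateAt m (x [ m⁺ ]%= Product.map₁ D)) ⟩
        V (verticals (x [ m⁺ ]%= Product.map₁ D) m)
          ≡⟨ cong (V ∘ proj₂) (Vec.lookup∘updateAt′ m m⁺ m≢m⁺ x) ⟩
        V (verticals x m) ≡⟨ insert-pair (verticals x m) i j ⟩
        verticals x m ∪ (⁅ i ⁆ ∪ ⁅ j ⁆) ∎
      restore : (flatten t′ [ m⁺ ]%= Product.map₁ I) [ m ]%= Product.map I (λ _ → verticals x m) ≡ x
      restore = begin
        (flatten t′ [ m⁺ ]%= Product.map₁ I) [ m ]%= F
          ≡⟨ cong (λ y → (y [ m⁺ ]%= Product.map₁ I) [ m ]%= F) eq ⟩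
        (((x [ m⁺ ]%= Product.map₁ D) [ m ]%= Product.map D V) [ m⁺ ]%= Product.map₁ I) [ m ]%= F
          ≡⟨ cong (_[ m ]%= F) (Vec.updateAt-commutes m⁺ m (m≢m⁺ ∘ sym) (x [ m⁺ ]%= Product.map₁ D)) ⟩
        (((x [ m⁺ ]%= Product.map₁ D) [ m⁺ ]%= Product.map₁ I) [ m ]%= Product.map D V) [ m ]%= F
          ≡⟨ cong (λ y → (y [ m ]%= Product.map D V) [ m ]%= F) (trans (Vec.updateAt-updateAt m⁺ x)
               (Vec.updateAt-id-local m⁺ x (cong (_, verticals x m⁺) (insert-delete (i , k) (horizontals x m⁺) (∈-horizontals⁺ {t = t} b∈))))) ⟩
        (x [ m ]%= Product.map D V) [ m ]%= F
          ≡⟨ trans (Vec.updateAt-updateAt m x)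
               (Vec.updateAt-id-local m x (cong (_, verticals x m) (insert-delete (i , k) (horizontals x m) (∈-horizontals⁺ {t = t} a∈)))) ⟩
        x ∎
        where
        F : DominoSet 2 n × Subset n → DominoSet 2 n × Subset n
        F = Product.map I (λ _ → verticals x m)
    ... | combined i m | combined j _ | combined _ m⁺ | upward | horizontal l
      with q , refl ← shift-horizontal⁻ R distinct N pe | refl , m⁺≡ ← shift-up⁻ R distinct N pd =
      inj₁ (subst (x ⇝_) (sym eq) (vertical-at x i j l O m⁺≡ q
        (remove-∉ (verticals x m [ j ]≔ outside) i)
        (remove-∉′ (verticals x m [ j ]≔ outside) (i≢j ∘ sym) (remove-∉ (verticals x m) j))
        (reinsert-pair (verticals x m) i≢j (∈-verticals⁺ {t = t} a∈) (∈-verticals⁺ {t = t} b∈))))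
      where
      x = flatten t
      t₁ = delete (combine j m , up) t
      t₂ = delete (combine i m , up) t₁
      t₃ = insert (combine i m⁺ , inject₁ l) t₂
      I : DominoSet 2 n → DominoSet 2 n
      I = insert (i , l)
      O : Subset n → Subset n
      O S = (S [ j ]≔ outside) [ i ]≔ outside
      i≢j : i ≢ j
      i≢j refl = Colours.isShift-≢ {R = R} q
      m≢m⁺ : m ≢ m⁺
      m≢m⁺ refl = ℕ.1+n≢n (sym m⁺≡)
      open ≡-Reasoning
      eq : flatten (insert (combine i m , inject₁ l) t₃) ≡ (x [ m⁺ ]%= Product.map₁ I) [ m ]%= Product.map I O
      eq = begin
        flatten (insert (combine i m , inject₁ l) t₃)
          ≡⟨ flatten-put-horizontal inside i m l t₃ ⟩
        flatten t₃ [ m ]%= Product.map₁ I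
          ≡⟨ cong (_[ m ]%= Product.map₁ I) (flatten-put-horizontal inside i m⁺ l t₂) ⟩
        (flatten t₂ [ m⁺ ]%= Product.map₁ I) [ m ]%= Product.map₁ I
          ≡⟨ cong (λ y → (y [ m⁺ ]%= Product.map₁ I) [ m ]%= Product.map₁ I) (trans (flatten-put-vertical outside i m t₁)
               (trans (cong (_[ m ]%= Product.map₂ (_[ i ]≔ outside)) (flatten-put-vertical outside j m t))
                 (Vec.updateAt-updateAt m x))) ⟩
        ((x [ m ]%= Product.map₂ O) [ m⁺ ]%= Product.map₁ I) [ m ]%= Product.map₁ I
          ≡⟨ cong (_[ m ]%= Product.map₁ I) (Vec.updateAt-commutes m⁺ m (m≢m⁺ ∘ sym) x) ⟩
        ((x [ m⁺ ]%= Product.map₁ I) [ m ]%= Product.map₂ O) [ m ]%= Product.map₁ I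
          ≡⟨ Vec.updateAt-updateAt m (x [ m⁺ ]%= Product.map₁ I) ⟩
        (x [ m⁺ ]%= Product.map₁ I) [ m ]%= Product.map I O ∎

  -- Enumeration of walks

  allFloors : ∀ N → List (Floors N)
  allFloors zero    = [] ∷ []
  allFloors (suc N) = cartesianProductWith Vec._∷_ (cartesianProduct (dominoSets 2 n) (subsets n)) (allFloors N)

  ∈-allFloors : ∀ {N} (x : Floors N) → x ∈ˡ allFloors N
  ∈-allFloors []            = here refl
  ∈-allFloors ((h , r) ∷ x) = ∈-cartesianProductWith⁺ Vec._∷_
    (∈-cartesianProduct⁺ (∈-dominoSets h) (∈-subsets r)) (∈-allFloors x)

  allFloors-unique : ∀ N → UniqueL (allFloors N)
  allFloors-unique zero    = [] ∷ []
  allFloors-unique (suc N) = ∷-cartesian-unique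
    (UniqueL.cartesianProduct⁺ (dominoSets-unique 2 n) (subsets-unique n)) (allFloors-unique N)

  record Walk (N : ℕ) (p q : Subset n) : Set where
    constructor walk
    field
      floors  : Floors N
      .isWalk : IsWalk p floors q

  open Walk public

  recomputedIsWalk : ∀ {N p q} (w : Walk N p q) → IsWalk p (floors w) q
  recomputedIsWalk {p = p} {q} (walk x v) = recompute (isWalk? p x q) v

  walk-≡ : ∀ {N p q} {w w′ : Walk N p q} → floors w ≡ floors w′ → w ≡ w′
  walk-≡ refl = refl

  toWalk : ∀ {N} p q → Floors N → Maybe (Walk N p q)
  toWalk p q x with isWalk? p x q
  ... | yes v = just (walk x v)
  ... | no _  = nothing

  toWalk-just⁻ : ∀ {N p q} (x : Floors N) {w} → toWalk p q x ≡ just w → floors w ≡ x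
  toWalk-just⁻ {p = p} {q} x eq with isWalk? p x q
  toWalk-just⁻ x refl | yes _ = refl

  toWalk-just⁺ : ∀ {N p q} (w : Walk N p q) → toWalk p q (floors w) ≡ just w
  toWalk-just⁺ {p = p} {q} (walk x v) with isWalk? p x q
  ... | yes _ = refl
  ... | no ¬v = ⊥-elim-irr (¬v v)

  walks : ∀ N p q → List (Walk N p q)
  walks N p q = mapMaybe (toWalk p q) (allFloors N)

  ∈-walks : ∀ {N p q} (w : Walk N p q) → w ∈ˡ walks N p q
  ∈-walks w = ∈-mapMaybe⁺ (toWalk _ _) (∈-allFloors (floors w)) (toWalk-just⁺ w)

  walks-unique : ∀ N p q → UniqueL (walks N p q)
  walks-unique N p q = mapMaybe-unique (toWalk p q)
    (λ {x} {x′} e e′ → trans (sym (toWalk-just⁻ x e)) (toWalk-just⁻ x′ e′)) (allFloors-unique N)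

  length-walks : ∀ N p q → length (walks N p q) ℕ.≤ length (allFloors N)
  length-walks N p q = List.length-mapMaybe (toWalk p q) (allFloors N)

  _⧺_ : ∀ {M N p q r} → Walk M p q → Walk N q r → Walk (M ℕ.+ N) p r
  walk x v ⧺ walk y w = walk (x Vec.++ y) (isWalk-++ x y v w)

  -- The first `M` floors determine the plug at the cut, by `isWalk-end`, so no walk is listed under
  -- two plugs `q`.
  walks-split : ∀ M N p r →
    walks (M ℕ.+ N) p r ↭ concatMap (λ q → cartesianProductWith _⧺_ (walks M p q) (walks N q r)) (subsets n)
  walks-split M N p r = unique-↭ (walks-unique (M ℕ.+ N) p r) uniq into (λ _ → ∈-walks _)
    where
    block : Subset n → List (Walk (M ℕ.+ N) p r)
    block q = cartesianProductWith _⧺_ (walks M p q) (walks N q r)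

    ⧺-injective : ∀ {q} {w w′ : Walk M p q} {v v′ : Walk N q r} → w ⧺ v ≡ w′ ⧺ v′ → w ≡ w′ × v ≡ v′
    ⧺-injective {w = w} {w′} {v} {v′} eq = Product.map walk-≡ walk-≡ (Vec.++-injective (floors w) (floors w′) (cong floors eq))

    disjoint-blocks : ∀ {q q′} → q ≢ q′ → ∀ {w} → ¬ (w ∈ˡ block q × w ∈ˡ block q′)
    disjoint-blocks {q} {q′} q≢q′ (w∈ , w∈′)
      with u , v , _ , _ , refl ← ∈-cartesianProductWith⁻ _⧺_ (walks M p q) (walks N q r) w∈
         | u′ , v′ , _ , _ , eq ← ∈-cartesianProductWith⁻ _⧺_ (walks M p q′) (walks N q′ r) w∈′ =
      q≢q′ (isWalk-end (floors u) (recomputedIsWalk u)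
        (subst (λ x → IsWalk p x q′) (sym (Vec.++-injectiveˡ (floors u) (floors u′) (cong floors eq))) (recomputedIsWalk u′)))

    uniq : UniqueL (concatMap block (subsets n))
    uniq = UniqueL.concat⁺
      (All.map⁺ (All.tabulate λ {q} _ →
        UniqueL.cartesianProductWith⁺ _⧺_ ⧺-injective (walks-unique M p q) (walks-unique N q r)))
      (AllPairs.map⁺ (AllPairs.map disjoint-blocks (subsets-unique n)))

    into : ∀ {w} → w ∈ˡ walks (M ℕ.+ N) p r → w ∈ˡ concatMap block (subsets n)
    into {walk z v} _ with Vec.splitAt M z
    ... | x , y , refl with q , v₁ , v₂ ← isWalk-split x y (recompute (isWalk? p (x Vec.++ y) r) v) =
      ∈-concatMap⁺ block (Any.map (λ { refl → ∈-cartesianProductWith⁺ _⧺_ (∈-walks (walk x v₁)) (∈-walks (walk y v₂)) })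
        (∈-subsets q))

  path : ∀ {N} p q → Walk N (support p) (support q) → Path p q
  path p q w = walkPath p q (floors w) (recomputedIsWalk w)

  path-⧺ : ∀ {M N} p q r (w : Walk M (support p) (support q)) (w′ : Walk N (support q) (support r)) →
           path p r (w ⧺ w′) ≡ path p q w ◅◅ path q r w′
  path-⧺ p q r w w′ = walkPath-++ p q r (floors w) (floors w′) _ _ _

  pathLength-path : ∀ {N} p q (w : Walk N (support p) (support q)) → pathLength (path p q w) ≡ N
  pathLength-path p q w = pathLength-walkPath p q (floors w) _

  path-surjective : ∀ {N} p q (γ : Path p q) → pathLength γ ≡ N →
                    Σ[ w ∈ Walk N (support p) (support q) ] path p q w ≃ γ
  path-surjective p q γ refl = walk (pathFloors γ) (isWalk-pathFloors γ) , walkPath-pathFloors γ _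

  tilingWalk : ∀ {N} → Tiling (cylinder R N) full → Walk N empty empty
  tilingWalk (tiling t tiles) = walk (flatten t) (flatten-isWalk t tiles)

  tilingWalk-injective : ∀ {N} {t u : Tiling (cylinder R N) full} → tilingWalk t ≡ tilingWalk u → t ≡ u
  tilingWalk-injective {t = t} {u} eq = tiling-≡ (flatten-injective {t = dominoes t} {dominoes u} (cong floors eq))

  tilings-walks : ∀ N → map tilingWalk (tilings (cylinder R N) full) ↭ walks N empty empty
  tilings-walks N = unique-↭ (UniqueL.map⁺ tilingWalk-injective (tilings-unique (cylinder R N) full))
    (walks-unique N empty empty) (λ _ → ∈-walks _) (λ {w} _ → from w)
    where
    from : ∀ w → w ∈ˡ map tilingWalk (tilings (cylinder R N) full)
    from (walk x v) = subst (_∈ˡ map tilingWalk (tilings (cylinder R N) full)) (walk-≡ {w = tilingWalk t} {walk x v} (flatten-unflatten x)) (∈-map⁺ tilingWalk (∈-tilings (cylinder R N) full t))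
      where
      t : Tiling (cylinder R N) full
      t = tiling (unflatten x) (isWalk-tiling (unflatten x) (subst (λ y → IsWalk empty y empty) (sym (flatten-unflatten x)) v))

  tilingPath : ∀ {N} → Tiling (cylinder R N) full → Path emptyPlug emptyPlug
  tilingPath t = path emptyPlug emptyPlug (tilingWalk t)

  tilingPath-cong : ∀ {N} {t u : Tiling (cylinder R N) full} → t ≈ u → tilingPath t ≃ tilingPath u
  tilingPath-cong ε = ≃-refl
  tilingPath-cong {N} (_◅_ {i = t} {u} fl fls) = ≃-trans (flip-path t u fl) (tilingPath-cong fls)
    where
    flip-path : ∀ t u → Flip {R = cylinder R N} t u → tilingPath t ≃ tilingPath u
    flip-path t@(tiling d tiles) u fl = [ (λ e → ⇝⇒≃ e emptyPlug emptyPlug (isWalkOf t) (isWalkOf u)) ,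
                         (λ e → ≃-sym (⇝⇒≃ e emptyPlug emptyPlug (isWalkOf u) (isWalkOf t))) ]′
      (flatten-flip d (recompute (isTiling? (cylinder R N) full d) tiles) fl)
      where
      isWalkOf : (t : Tiling (cylinder R N) full) → IsWalk empty (floors (tilingWalk t)) empty
      isWalkOf t = recomputedIsWalk (tilingWalk t)

  -- Even blocks and their contraction

  Even : ∀ {p q} → Path p q → Set
  Even γ = pathParity γ ≡ 0ℙ

  even-of-length : ∀ {p q} (γ : Path p q) {m} → pathLength γ ≡ m → parity m ≡ 0ℙ → Even γ
  even-of-length γ eq e = trans (cong parity eq) e

  -- `Φ` is the homomorphism with the parity proof as a separate argument, and `Φ-cong` makes its
  -- value independent of that proof; `α` and `β` are preimages of the two generators.
  module Constants (Φ : (γ : Path emptyPlug emptyPlug) → Even γ → F.Carrier)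
    (Φ-cong : ∀ {γ δ} e e′ → γ ≃ δ → Φ γ e F.≈ Φ δ e′)
    (Φ-homo : ∀ γ δ e e′ e″ → Φ (γ ◅◅ δ) e F.≈ Φ γ e′ ◅◅ Φ δ e″)
    (Φ-ε : ∀ e → Φ ε e F.≈ ε)
    (α β : Path emptyPlug emptyPlug) (α-even : Even α) (β-even : Even β)
    (Φ-α : Φ α α-even F.≈ (a ◅ ε)) (Φ-β : Φ β β-even F.≈ (b ◅ ε))
    where

    -- With two floors as a single step, even reachability becomes plain reachability in a finite
    -- graph: it is decidable, and the paths found are even.
    TwoFloors : Subset n → Subset n → Set
    TwoFloors p q = Σ[ x ∈ Floors 2 ] IsWalk p x q

    twoFloors? : ∀ p q → Dec (TwoFloors p q)
    twoFloors? p q = map′ Any.satisfied (λ (x , v) → Any.map (λ { refl → v }) (∈-allFloors x))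
      (Any.any? (λ x → isWalk? p x q) (allFloors 2))

    Reachable : Subset n → Set
    Reachable q = Star TwoFloors empty q

    reachable? : ∀ q → Dec (Reachable q)
    reachable? = Reachability.star? _≟ˢᵘᵇ_ twoFloors? (subsets n) ∈-subsets empty

    even-walk-reachable : ∀ k {p q} (x : Floors (k ℕ.* 2)) → IsWalk p x q → Star TwoFloors p q
    even-walk-reachable zero    []          refl           = ε
    even-walk-reachable (suc k) (f ∷ g ∷ x) (ok , ok′ , v) =
      (f ∷ g ∷ [] , ok , ok′ , refl) ◅ even-walk-reachable k x v

    -- The fixed path that closes up walks ending at `q`. Its evenness keeps closed walks in the
    -- domain of `Φ`; `reached` shows that whatever lies a block further is reachable as well.
    record Route (q : Subset n) : Set where
      field
        end-balanced : BalancedSet R q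
        reached      : Reachable q
        half         : ℕ

      end : Plug
      end = plug q end-balanced

      field
        route        : Path emptyPlug end
        route-length : pathLength route ≡ half ℕ.* 2

    open Route

    staying : Route empty
    staying = record
      { end-balanced = balanced-empty ; reached = ε ; half = 0 ; route = ε ; route-length = refl }

    extend : ∀ {p q} → Route p → Star TwoFloors p q → Route q
    extend B ε = B
    extend {p} B (_◅_ {j = r} (x , v) s) = extend longer s
      where
      r-balanced : BalancedSet R r
      r-balanced = isWalk-balanced x v (end-balanced B)
      longer : Route r
      longer = record
        { end-balanced = r-balanced
        ; reached      = reached B ◅◅ ((x , v) ◅ ε)
        ; half         = suc (half B)
        ; route        = route B ◅◅ walkPath (end B) (plug r r-balanced) x v
        ; route-length = trans (pathLength-◅◅ (route B) _)
            (trans (cong₂ ℕ._+_ (route-length B) (pathLength-walkPath (end B) (plug r r-balanced) x v)) (ℕ.+-comm _ 2))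
        }

    routeTo : ∀ {q} → Reachable q → Route q
    routeTo = extend staying

    halfTo : ∀ {q} → Dec (Reachable q) → ℕ
    halfTo (yes s) = half (routeTo s)
    -- Unreachable plugs need no route and must not enlarge the sum `maxHalf`, which serves as a
    -- crude maximum.
    halfTo (no _)  = 0

    maxHalf : ℕ
    maxHalf = sum (map (λ q → halfTo (reachable? q)) (subsets n))

    half≤maxHalf : ∀ q {s} → reachable? q ≡ yes s → half (routeTo s) ℕ.≤ maxHalf
    half≤maxHalf q eq = subst (ℕ._≤ maxHalf) (cong halfTo eq)
      (∈⇒≤sum (∈-map⁺ (λ q → halfTo (reachable? q)) (∈-subsets q)))

    -- Padding requires some edge at the empty plug. A path over the generator `a` has one: its
    -- image moves `origin`, so it is not the empty path.
    first-step : ∀ γ e → Φ γ e F.≈ (a ◅ ε) → Σ[ q ∈ Plug ] Step emptyPlug q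
    first-step ε       e h = contradiction (trans (sym (act-cong h origin)) (act-cong (Φ-ε e) origin)) step-a≢id
    first-step (s ◅ _) _ _ = _ , s

    private
      s₀ : Step emptyPlug _
      s₀ = proj₂ (first-step α α-even Φ-α)

    pad : ℕ → Path emptyPlug emptyPlug
    pad zero    = ε
    pad (suc j) = s₀ ◅ rev s₀ ◅ pad j

    pad-≃ : ∀ j → pad j ≃ ε
    pad-≃ zero    = ≃-refl
    pad-≃ (suc j) = ≃-trans (≃-cong {γ = s₀ ◅ rev s₀ ◅ ε} {γ′ = ε} (cancel s₀) (pad-≃ j)) ≃-refl

    pathLength-pad : ∀ j → pathLength (pad j) ≡ j ℕ.* 2
    pathLength-pad zero    = refl
    pathLength-pad (suc j) = cong (2 ℕ.+_) (pathLength-pad j)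

    hα hβ : ℕ
    hα = proj₁ (half-of-even (pathLength α) α-even)
    hβ = proj₁ (half-of-even (pathLength β) β-even)

    abstract
      -- Half a block has room for half of two routes and of either `α` or `β`; the successor makes
      -- blocks nonempty.
      halfBlock : ℕ
      halfBlock = suc (hα ℕ.+ hβ ℕ.+ (maxHalf ℕ.+ maxHalf))

      halfBlock≢0 : NonZero halfBlock
      halfBlock≢0 = ℕ.nonZero

      halfBlock-large : hα ℕ.+ hβ ℕ.+ (maxHalf ℕ.+ maxHalf) ℕ.≤ halfBlock
      halfBlock-large = ℕ.n≤1+n _

    block : ℕ
    block = halfBlock ℕ.* 2

    abstract
      -- Bounding by all sequences of floors gives one constant for all pairs of plugs.
      bound : ℕ
      bound = length (allFloors block)

      length-walks≤bound : ∀ p q → length (walks block p q) ℕ.≤ bound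
      length-walks≤bound p q = length-walks block p q

    cancelʳ : ∀ {p q r} (γ : Path p q) (δ : Path q r) → (γ ◅◅ δ) ◅◅ inverse δ ≃ γ
    cancelʳ γ δ = ≃-trans (≡⇒≃ (Star.◅◅-assoc γ δ (inverse δ)))
      (≃-trans (◅◅-congʳ {γ = γ} (inverseʳ δ)) (≡⇒≃ (◅◅-identityʳ γ)))

    cancelˡ : ∀ {p q r} (γ : Path p q) (δ : Path p r) → γ ◅◅ (inverse γ ◅◅ δ) ≃ δ
    cancelˡ γ δ = ≃-trans (≡⇒≃ (sym (Star.◅◅-assoc γ (inverse γ) δ))) (◅◅-congˡ (inverseʳ γ))

    cancelˡ′ : ∀ {p q r} (γ : Path p q) (δ : Path q r) → inverse γ ◅◅ (γ ◅◅ δ) ≃ δ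
    cancelˡ′ γ δ = ≃-trans (≡⇒≃ (sym (Star.◅◅-assoc (inverse γ) γ δ))) (◅◅-congˡ (inverseˡ γ))

    closed : ∀ {p q N} (B : Route p) (B′ : Route q) → Walk N p q → Path emptyPlug emptyPlug
    closed B B′ w = route B ◅◅ (path (end B) (end B′) w ◅◅ inverse (route B′))

    closed-even : ∀ {p q} (B : Route p) (B′ : Route q) (w : Walk block p q) → Even (closed B B′ w)
    closed-even B B′ w = even-of-length (closed B B′ w)
      (trans (pathLength-◅◅ (route B) _) (cong₂ ℕ._+_ (route-length B)
        (trans (pathLength-◅◅ (path (end B) (end B′) w) _) (cong₂ ℕ._+_ (pathLength-path (end B) (end B′) w)
          (trans (pathLength-inverse (route B′)) (route-length B′))))))
      (even-+ (half B ℕ.* 2) (parity-*2 (half B)) (even-+ block (parity-*2 halfBlock) (parity-*2 (half B′))))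

    blockMap : ∀ {p q} (B : Route p) (B′ : Route q) → Walk block p q → ReducedWord → ReducedWord
    blockMap B B′ w = act (Φ (closed B B′ w) (closed-even B B′ w))

    -- From `p` go home, pad by steps back and forth to the exact block length, follow `σ`, and go
    -- out to `q`. Closing up cancels both routes and the padding.
    special-walk : ∀ {p q} (B : Route p) (B′ : Route q) → half B ℕ.≤ maxHalf → half B′ ℕ.≤ maxHalf →
      ∀ σ h → pathLength σ ≡ h ℕ.* 2 → h ℕ.≤ hα ℕ.+ hβ →
      Σ[ w ∈ Walk block p q ] (closed B B′ w ≃ σ)
    special-walk B B′ B≤ B′≤ σ h σ-length h≤ = w ,
      ≃-trans (◅◅-congʳ {γ = route B} (≃-trans (◅◅-congˡ w-path) (≃-trans (≡⇒≃ (Star.◅◅-assoc (inverse (route B)) _ _))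
          (◅◅-congʳ {γ = inverse (route B)} (cancelʳ (pad j ◅◅ σ) (route B′))))))
        (≃-trans (cancelˡ (route B) (pad j ◅◅ σ)) (◅◅-congˡ (pad-≃ j)))
      where
      used : ℕ
      used = half B ℕ.+ h ℕ.+ half B′
      used≤ : used ℕ.≤ halfBlock
      used≤ = ℕ.≤-trans (ℕ.+-mono-≤ (ℕ.+-mono-≤ B≤ h≤) B′≤)
        (ℕ.≤-trans (ℕ.≤-reflexive (reorder maxHalf (hα ℕ.+ hβ))) halfBlock-large)
        where
        reorder : ∀ m s → m ℕ.+ s ℕ.+ m ≡ s ℕ.+ (m ℕ.+ m)
        reorder = solve-∀
      j : ℕ
      j = halfBlock ℕ.∸ used
      σ′ : Path (end B) (end B′)
      σ′ = inverse (route B) ◅◅ ((pad j ◅◅ σ) ◅◅ route B′)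
      σ′-length : pathLength σ′ ≡ block
      σ′-length = trans (pathLength-◅◅ (inverse (route B)) _)
        (trans (cong₂ ℕ._+_ (trans (pathLength-inverse (route B)) (route-length B))
          (trans (pathLength-◅◅ (pad j ◅◅ σ) (route B′))
            (cong₂ ℕ._+_ (trans (pathLength-◅◅ (pad j) σ) (cong₂ ℕ._+_ (pathLength-pad j) σ-length)) (route-length B′))))
        (trans (factor (half B) j h (half B′)) (cong (ℕ._* 2) (ℕ.m∸n+n≡m used≤))))
        where
        factor : ∀ a j h b → a ℕ.* 2 ℕ.+ ((j ℕ.* 2 ℕ.+ h ℕ.* 2) ℕ.+ b ℕ.* 2) ≡ (j ℕ.+ (a ℕ.+ h ℕ.+ b)) ℕ.* 2
        factor = solve-∀
      walk-of-σ′ = path-surjective (end B) (end B′) σ′ σ′-length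
      w = proj₁ walk-of-σ′
      w-path = proj₂ walk-of-σ′

    blockMap-special : ∀ {p q} (B : Route p) (B′ : Route q) w {σ} e {γ} → closed B B′ w ≃ σ → Φ σ e F.≈ γ →
                       ∀ y → blockMap B B′ w y ≡ act γ y
    blockMap-special B B′ w {σ} e h h′ y = trans (act-cong (Φ-cong (closed-even B B′ w) e h) y) (act-cong h′ y)

    E D : ℕ
    E = 2 ℕ.* (bound ℕ.* bound)
    D = suc E

    -- The total length with the block in front, so that one more block has by definition the form
    -- that `walks-split` cuts.
    blocks : ℕ → ℕ → ℕ
    blocks zero    r = r
    blocks (suc m) r = block ℕ.+ blocks m r

    blocks≡ : ∀ m r → blocks m r ≡ r ℕ.+ m ℕ.* block
    blocks≡ zero    r = sym (ℕ.+-identityʳ r)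
    blocks≡ (suc m) r = trans (cong (block ℕ.+_) (blocks≡ m r)) (exchange block r (m ℕ.* block))
      where
      exchange : ∀ k r s → k ℕ.+ (r ℕ.+ s) ≡ r ℕ.+ (k ℕ.+ s)
      exchange = solve-∀

    module _ (ω : Path emptyPlug emptyPlug) where

      Compatible : ℕ → Set
      Compatible N = parity (N ℕ.+ pathLength ω) ≡ 0ℙ

      completed : ∀ {N p} → Route p → Walk N p empty → Path emptyPlug emptyPlug
      completed B w = route B ◅◅ (path (end B) emptyPlug w ◅◅ ω)

      completed-even : ∀ {N p} → Compatible N → (B : Route p) (w : Walk N p empty) → Even (completed B w)
      completed-even {N} e B w = even-of-length (completed B w)
        (trans (pathLength-◅◅ (route B) _) (cong₂ ℕ._+_ (route-length B)
          (trans (pathLength-◅◅ (path (end B) emptyPlug w) ω) (cong (ℕ._+ pathLength ω) (pathLength-path (end B) emptyPlug w)))))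
        (even-+ (half B ℕ.* 2) (parity-*2 (half B)) e)

      image : ∀ {N p} → Compatible N → Route p → Walk N p empty → ReducedWord
      image e B w = act (Φ (completed B w) (completed-even e B w)) origin

      images : ∀ N {p} → Compatible N → Route p → List ReducedWord
      images N {p} e B = map (image e B) (walks N p empty)

      -- Insert the route of `B′` backwards and forwards at the cut. Both pieces are then closed and
      -- even, so `Φ` applies to each.
      image-⧺ : ∀ {N p q} (e : Compatible (block ℕ.+ N)) (e′ : Compatible N) (B : Route p) (B′ : Route q)
        (w : Walk block p q) (w′ : Walk N q empty) → image e B (w ⧺ w′) ≡ blockMap B B′ w (image e′ B′ w′)
      image-⧺ e e′ B B′ w w′ = trans (act-cong (F.trans (Φ-cong _ both-even homotopy)
          (Φ-homo (closed B B′ w) (completed B′ w′) both-even (closed-even B B′ w) (completed-even e′ B′ w′))) origin)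
        (act-◅◅ (Φ (closed B B′ w) (closed-even B B′ w)) (Φ (completed B′ w′) (completed-even e′ B′ w′)) origin)
        where
        γ  = path (end B) (end B′) w
        γ′ = path (end B′) emptyPlug w′
        both-even : Even (closed B B′ w ◅◅ completed B′ w′)
        both-even = even-of-length (closed B B′ w ◅◅ completed B′ w′) (pathLength-◅◅ (closed B B′ w) (completed B′ w′))
          (even-+ (pathLength (closed B B′ w)) (closed-even B B′ w) (completed-even e′ B′ w′))
        homotopy : completed B (w ⧺ w′) ≃ closed B B′ w ◅◅ completed B′ w′
        homotopy = ≃-trans (◅◅-congʳ {γ = route B}
          (≃-trans (≡⇒≃ (trans (cong (_◅◅ ω) (path-⧺ (end B) (end B′) emptyPlug w w′)) (Star.◅◅-assoc γ γ′ ω)))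
            (≃-trans (◅◅-congʳ {γ = γ} (≃-sym (cancelˡ′ (route B′) (γ′ ◅◅ ω))))
              (≡⇒≃ (sym (Star.◅◅-assoc γ (inverse (route B′)) (completed B′ w′)))))))
          (≡⇒≃ (sym (Star.◅◅-assoc (route B) (γ ◅◅ inverse (route B′)) (completed B′ w′))))

      -- With no blocks this is the trivial bound of the ℓ²-norm by the ℓ¹-norm. One more block is a
      -- sum over the plug `q` at its end, and each summand is a convolution with the walks from `p`
      -- to `q`. The start `p` is arbitrary because the remainder starts at `q`.
      images-spread : ∀ m r {p} (e : Compatible (blocks m r)) (B : Route p) → half B ℕ.≤ maxHalf →
                      Spread (E ℕ.^ m) (D ℕ.^ m) (images (blocks m r) e B)
      images-spread zero    r e B B≤ = ℕ.*-monoʳ-≤ 1 (⟨⟩≤length (images r e B) (images r e B))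
      images-spread (suc m) r {p} e B B≤ =
        spread-↭ {E ℕ.^ suc m} {D ℕ.^ suc m} (↭-trans (↭.map⁺ (f) (walks-split block N p empty))
                   (↭-reflexive (List.map-concatMap (f) pieces (subsets n))))
          (spread-concatMap (E ℕ.^ suc m) (D ℕ.^ suc m) (λ q → map (f) (pieces q)) (subsets n)
            (λ q → through q (reachable? q) refl))
        where
        N = blocks m r
        f : Walk (block ℕ.+ N) p empty → ReducedWord
        f = image e B
        e′ : Compatible N
        e′ = even-+⁻ block (parity-*2 halfBlock) (trans (cong parity (sym (ℕ.+-assoc block N (pathLength ω)))) e)
        pieces : Subset n → List (Walk (block ℕ.+ N) p empty)
        pieces q = cartesianProductWith _⧺_ (walks block p q) (walks N q empty)
        -- The equation ensures that the witness used for the route to `q` is the one measured by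
        -- `maxHalf`.
        through : ∀ q (r? : Dec (Reachable q)) → reachable? q ≡ r? →
                  Spread (E ℕ.^ suc m) (D ℕ.^ suc m) (map (f) (pieces q))
        through q (no ¬r) _ = subst (λ ws → Spread (E ℕ.^ suc m) (D ℕ.^ suc m)
            (map (f) (cartesianProductWith _⧺_ ws (walks N q empty))))
          (sym (uninhabited⇒[] (λ w → ¬r (reached B ◅◅ even-walk-reachable halfBlock (floors w) (recomputedIsWalk w)))
            (walks block p q)))
          (ℕ.≤-trans (ℕ.≤-reflexive (ℕ.*-zeroʳ (D ℕ.^ suc m))) z≤n)
        through q (yes s) eq = subst (Spread (E ℕ.^ suc m) (D ℕ.^ suc m))
          (sym (map-cartesianProductWith (f) _⧺_ (blockMap B B′) (image {N} e′ B′) (image-⧺ {N} e e′ B B′)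
            (walks block p q) (walks N q empty)))
          (block-spread (blockMap B B′) (λ w → act-injective (Φ (closed B B′ w) (closed-even B B′ w)))
            (blockMap-special B B′ (proj₁ w₀) refl (proj₂ w₀) (Φ-ε refl))
            (blockMap-special B B′ (proj₁ wₐ) α-even (proj₂ wₐ) Φ-α)
            (blockMap-special B B′ (proj₁ w_b) β-even (proj₂ w_b) Φ-β)
            m bound (∈-walks (proj₁ w₀)) (∈-walks (proj₁ wₐ)) (∈-walks (proj₁ w_b)) (length-walks≤bound p q)
            (images-spread m r e′ B′ B′≤))
          where
          B′ = routeTo s
          B′≤ = half≤maxHalf q eq
          w₀ : Σ[ w ∈ Walk block p q ] (closed B B′ w ≃ ε)
          w₀ = special-walk B B′ B≤ B′≤ ε 0 refl z≤n
          wₐ : Σ[ w ∈ Walk block p q ] (closed B B′ w ≃ α)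
          wₐ = special-walk B B′ B≤ B′≤ α hα (proj₂ (half-of-even (pathLength α) α-even)) (ℕ.m≤m+n hα hβ)
          w_b : Σ[ w ∈ Walk block p q ] (closed B B′ w ≃ β)
          w_b = special-walk B B′ B≤ B′≤ β hβ (proj₂ (half-of-even (pathLength β) β-even)) (ℕ.m≤n+m hβ hα)

    module _ (m r : ℕ) where
      private
        N = blocks m r

        Bounded : List (Tiling (cylinder R N) full) → Set
        Bounded T = D ℕ.^ m ℕ.* equivalentPairs T ℕ.≤ E ℕ.^ m ℕ.* (length T ℕ.* length T)

        from-tiling : ∀ {T} → T ≡ tilings (cylinder R N) full → Tiling (cylinder R N) full → Bounded T
        from-tiling {T} T≡ t₀ = begin
          D ℕ.^ m ℕ.* equivalentPairs T
            ≤⟨ ℕ.*-monoʳ-≤ (D ℕ.^ m) (ℕ.≤-trans (ℕ.≤-reflexive (equivalentPairs-≡ T)) (equivalent-pairs _≈?_ f f-cong T T)) ⟩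
          D ℕ.^ m ℕ.* ∥ map f T ∥²
            ≤⟨ spread-↭ {E ℕ.^ m} {D ℕ.^ m} rearranged (images-spread ω m r e staying z≤n) ⟩
          E ℕ.^ m ℕ.* (length (map f T) ℕ.* length (map f T))
            ≡⟨ cong (λ l → E ℕ.^ m ℕ.* (l ℕ.* l)) (List.length-map f T) ⟩
          E ℕ.^ m ℕ.* (length T ℕ.* length T) ∎
          where
          open ℕ.≤-Reasoning
          -- Closing with a path over the same number of floors gives the length 2 N, even for odd
          -- N.
          ω : Path emptyPlug emptyPlug
          ω = inverse (tilingPath t₀)
          e : Compatible ω N
          e = trans (cong (λ l → parity (N ℕ.+ l))
                (trans (pathLength-inverse (tilingPath t₀)) (pathLength-path emptyPlug emptyPlug (tilingWalk t₀))))
              (trans (cong parity (double N)) (parity-*2 N))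
            where
            double : ∀ k → k ℕ.+ k ≡ k ℕ.* 2
            double = solve-∀
          f : Tiling (cylinder R N) full → ReducedWord
          f t = image ω {N} e staying (tilingWalk t)
          f-cong : ∀ {t u} → t ≈ u → f t ≡ f u
          f-cong {t} {u} t≈u = act-cong (Φ-cong (completed-even ω {N} e staying (tilingWalk t)) (completed-even ω {N} e staying (tilingWalk u))
            (◅◅-congˡ {γ = tilingPath t} {tilingPath u} {ω} (tilingPath-cong t≈u))) origin
          rearranged : map f T ↭ images ω N e staying
          rearranged = ↭-trans (↭-reflexive (trans (cong (map f) T≡) (List.map-∘ (tilings (cylinder R N) full))))
            (↭.map⁺ (image ω {N} e staying) (tilings-walks N))

      -- Without a tiling there is nothing to close the walks with, but then the left side vanishes.
      equivalent-pairs-bound : ∀ N′ → N ≡ N′ → (T : List (Tiling (cylinder R N′) full)) → T ≡ tilings (cylinder R N′) full →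
        D ℕ.^ m ℕ.* equivalentPairs T ℕ.≤ E ℕ.^ m ℕ.* (length T ℕ.* length T)
      equivalent-pairs-bound _ refl T T≡ = [ (λ T≡[] → subst Bounded (sym T≡[]) none) , from-tiling T≡ ]′ (empty-or-inhabited T)
        where
        none : Bounded []
        none = ℕ.≤-trans (ℕ.≤-reflexive (trans (cong (D ℕ.^ m ℕ.*_) (equivalentPairs-≡ {R = cylinder R N} {full} [])) (ℕ.*-zeroʳ (D ℕ.^ m)))) z≤n

    decay-per-block : Σ[ K ∈ ℕ ] Σ[ E ∈ ℕ ] (NonZero K × (∀ m r (T : List (Tiling (cylinder R (r ℕ.+ m ℕ.* K)) full)) →
      T ≡ tilings (cylinder R (r ℕ.+ m ℕ.* K)) full →
      suc E ℕ.^ m ℕ.* equivalentPairs T ℕ.≤ E ℕ.^ m ℕ.* (length T ℕ.* length T)))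
    decay-per-block = block , E , ℕ.m*n≢0 halfBlock 2 {{halfBlock≢0}} , λ m r →
      equivalent-pairs-bound m r (r ℕ.+ m ℕ.* block) (blocks≡ m r)

-- From blocks to all heights

m/[1+m]<1 : ∀ m → + m ℚ./ suc m < 1ℚ
m/[1+m]<1 m = ℚ.toℚᵘ-cancel-< (begin-strict
  toℚᵘ (+ m ℚ./ suc m)   ≃⟨ ℚ.toℚᵘ-fromℚᵘ (mkℚᵘ (+ m) m) ⟩
  mkℚᵘ (+ m) m           <⟨ *<* (ℤ.*-monoʳ-<-pos (+ suc m) {+ m} {+ suc m} (ℤ.+<+ ℕ.≤-refl)) ⟩
  mkℚᵘ (+ suc m) m       ≃⟨ *≡* (trans (ℤ.*-identityʳ (+ suc m)) (sym (ℤ.*-identityˡ (+ suc m)))) ⟩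
  toℚᵘ 1ℚ                ∎)
  where open ℚᵘ.≤-Reasoning

module _ (K E : ℕ) .{{K≢0 : NonZero K}} (e t : ℕ → ℕ)
  (bound : ∀ m r → suc E ℕ.^ m ℕ.* e (r ℕ.+ m ℕ.* K) ℕ.≤ E ℕ.^ m ℕ.* t (r ℕ.+ m ℕ.* K)) where

  private
    instance
      denominator≢0 : NonZero (K ℕ.* (2 ℕ.* suc E))
      denominator≢0 = ℕ.m*n≢0 K (2 ℕ.* suc E)

    M : ℕ
    M = ℕ.pred (K ℕ.* (2 ℕ.* suc E))

    M+1 : suc M ≡ K ℕ.* (2 ℕ.* suc E)
    M+1 = ℕ.suc-pred (K ℕ.* (2 ℕ.* suc E))

    instance
      -- As `K` is positive, M + 1 is at least 2; this makes the rate M / (M + 1) positive.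
      M≢0 : NonZero M
      M≢0 = ℕ.>-nonZero (ℕ.s≤s⁻¹ (ℕ.≤-trans
        (ℕ.*-mono-≤ (ℕ.>-nonZero⁻¹ K) (ℕ.*-monoʳ-≤ 2 {1} {suc E} (s≤s z≤n)))
        (ℕ.≤-reflexive (sym M+1))))

    short : ∀ N → N ℕ.≤ K ℕ.* suc (N ℕ./ K)
    short N = begin
      N                              ≡⟨ ℕ.m≡m%n+[m/n]*n N K ⟩
      N ℕ.% K ℕ.+ N ℕ./ K ℕ.* K      ≤⟨ ℕ.+-monoˡ-≤ (N ℕ./ K ℕ.* K) (ℕ.<⇒≤ (ℕ.m%n<n N K)) ⟩
      suc (N ℕ./ K) ℕ.* K            ≡⟨ ℕ.*-comm (suc (N ℕ./ K)) K ⟩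
      K ℕ.* suc (N ℕ./ K)            ∎
      where open ℕ.≤-Reasoning

    many : ∀ m₀ N → m₀ ℕ.* K ℕ.≤ N → m₀ ℕ.≤ N ℕ./ K
    many m₀ N N₀≤N = subst (ℕ._≤ N ℕ./ K) (ℕ.m*n/n≡m m₀ K) (ℕ./-monoˡ-≤ K N₀≤N)

    bound-at : ∀ N → suc E ℕ.^ (N ℕ./ K) ℕ.* e N ℕ.≤ E ℕ.^ (N ℕ./ K) ℕ.* t N
    bound-at N = subst (λ N′ → suc E ℕ.^ (N ℕ./ K) ℕ.* e N′ ℕ.≤ E ℕ.^ (N ℕ./ K) ℕ.* t N′)
      (sym (ℕ.m≡m%n+[m/n]*n N K)) (bound (N ℕ./ K) (N ℕ.% K))

  exponential-decay : ∃[ c ] (0ℚ < c × c < 1ℚ ×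
    (∀ η → 0ℚ < η → ∃[ N₀ ] (∀ N → N₀ ℕ.≤ N → .{{_ : NonZero (t N)}} → + e N ℚ./ t N ≤ η * c ^ N)))
  exponential-decay = + M ℚ./ suc M , ℚ.positive⁻¹ _ {{ℚ.normalize-pos M (suc M)}} , m/[1+m]<1 M , λ η 0<η →
    -- From `m₀` blocks on, the strict inequality required by `block-decay` holds for the
    -- denominator of `η`.
    let m₀ = suc ((ℚ.↧ₙ η ℕ.* (2 ℕ.* suc E)) ℕ.* (2 ℕ.* E)) in
    m₀ ℕ.* K , λ N N₀≤N → /-≤ (e N) (t N) M (suc M) N η 0<η
      (block-decay K E M M+1 (ℚ.↧ₙ η) (N ℕ./ K) N (e N) (t N) (short N) (many m₀ N N₀≤N) (bound-at N))

DecaysPerBlock : QuadriculatedDisk → Set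
DecaysPerBlock 𝓓 = Σ[ K ∈ ℕ ] Σ[ E ∈ ℕ ] (NonZero K × (∀ m r (T : List (Tiling (cylinder squares (r ℕ.+ m ℕ.* K)) full)) →
    T ≡ tilings (cylinder squares (r ℕ.+ m ℕ.* K)) full →
    suc E ℕ.^ m ℕ.* equivalentPairs T ℕ.≤ E ℕ.^ m ℕ.* (length T ℕ.* length T)))
  where open QuadriculatedDisk 𝓓

on-all-tilings : ∀ 𝓓 N x y →
  (∀ T → T ≡ tilings (cylinder (QuadriculatedDisk.squares 𝓓) N) full → x ℕ.* equivalentPairs T ℕ.≤ y ℕ.* (length T ℕ.* length T)) →
  x ℕ.* RandomTilings.#equivalentPairs 𝓓 N ℕ.≤ y ℕ.* (RandomTilings.#tilings 𝓓 N ℕ.* RandomTilings.#tilings 𝓓 N)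
on-all-tilings 𝓓 N x y h = subst (λ e → x ℕ.* e ℕ.≤ y ℕ.* (#tilings ℕ.* #tilings))
  (equivalentPairs-≡ allTilings) (h allTilings refl)
  where open RandomTilings 𝓓 N

prob≈-decays : ∀ 𝓓 → DecaysPerBlock 𝓓 →
    ∃[ c ] (0ℚ < c × c < 1ℚ ×
    (∀ ε → 0ℚ < ε → ∃[ N₀ ] (∀ N → N₀ ℕ.≤ N →
    .{{_ : NonZero (RandomTilings.#tilings 𝓓 N)}} →
    RandomTilings.prob≈ 𝓓 N ≤ ε * c ^ N)))
prob≈-decays 𝓓 (K , E , K≢0 , bound) =
  let c , 0<c , c<1 , below = exponential-decay K E {{K≢0}} (RandomTilings.#equivalentPairs 𝓓) squared bound′ in
  c , 0<c , c<1 , λ η 0<η → proj₁ (below η 0<η) , λ N N₀≤N →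
    proj₂ (below η 0<η) N N₀≤N {{squared≢0 N}}
  where
  squared : ℕ → ℕ
  squared N = RandomTilings.#tilings 𝓓 N ℕ.* RandomTilings.#tilings 𝓓 N

  squared≢0 : ∀ N .{{_ : NonZero (RandomTilings.#tilings 𝓓 N)}} → NonZero (squared N)
  squared≢0 N = ℕ.m*n≢0 (RandomTilings.#tilings 𝓓 N) (RandomTilings.#tilings 𝓓 N)

  bound′ : ∀ m r → suc E ℕ.^ m ℕ.* RandomTilings.#equivalentPairs 𝓓 (r ℕ.+ m ℕ.* K) ℕ.≤
                   E ℕ.^ m ℕ.* squared (r ℕ.+ m ℕ.* K)
  bound′ m r = on-all-tilings 𝓓 (r ℕ.+ m ℕ.* K) (suc E ℕ.^ m) (E ℕ.^ m) (bound m r)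

theorem1 : (𝓓 : QuadriculatedDisk) → Balanced 𝓓 → Nontrivial 𝓓 → StronglyIrregular 𝓓 →
    ∃[ c ] (0ℚ < c × c < 1ℚ ×
    (∀ ε → 0ℚ < ε → ∃[ N₀ ] (∀ N → N₀ ℕ.≤ N →
    .{{_ : NonZero (RandomTilings.#tilings 𝓓 N)}} →
    RandomTilings.prob≈ 𝓓 N ≤ ε * c ^ N)))
theorem1 𝓓 balanced nontrivial (φ , φ-hom , φ-surjective) = prob≈-decays 𝓓 decay-per-block
  where
  open QuadriculatedDisk 𝓓
  open Disk squares distinct balanced nontrivial
  module G⁺ = Group evenDominoGroup
  module φ = GroupMorphisms.IsGroupHomomorphism φ-hom

  α⁺ β⁺ : G⁺.Carrier
  α⁺ = proj₁ (φ-surjective (a ◅ ε))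
  β⁺ = proj₁ (φ-surjective (b ◅ ε))

  Φ : (γ : Path emptyPlug emptyPlug) → Even γ → F.Carrier
  Φ γ e = φ (γ , e)

  -- Equality in the kernel compares only the underlying paths, so the two parity proofs may differ.
  Φ-cong : ∀ {γ δ} e e′ → γ ≃ δ → Φ γ e F.≈ Φ δ e′
  Φ-cong {γ} {δ} e e′ = φ.⟦⟧-cong {γ , e} {δ , e′}

  Φ-homo : ∀ γ δ e e′ e″ → Φ (γ ◅◅ δ) e F.≈ Φ γ e′ ◅◅ Φ δ e″
  Φ-homo γ δ e e′ e″ = F.trans (Φ-cong {γ ◅◅ δ} e (proj₂ ((γ , e′) G⁺.∙ (δ , e″))) ≃-refl) (φ.homo (γ , e′) (δ , e″))

  Φ-ε : ∀ e → Φ ε e F.≈ ε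
  Φ-ε e = F.trans (Φ-cong {ε} e (proj₂ G⁺.ε) ≃-refl) φ.ε-homo

  open Constants Φ Φ-cong Φ-homo Φ-ε (proj₁ α⁺) (proj₁ β⁺) (proj₂ α⁺) (proj₂ β⁺)
    (proj₂ (φ-surjective (a ◅ ε)) {α⁺} ≃-refl) (proj₂ (φ-surjective (b ◅ ε)) {β⁺} ≃-refl)
    using (decay-per-block)
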